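{- For all integers $q_1 > q_2 \geq 3$, there exists $c>0$ such that for $p = p(n) \le c \cdot n^{ -\frac{q_2}{q_1(q_2-1)}}$, the hypergraph $H(n,q_1,q_2,p)$ is asymmetrically-2-colorable asymptotically almost surely (i.e. with probability tending to $1$ as $n \to \infty$).
   Context: $[n]=\{1,\dotsc,n\}$; $[n]_p$ is the random subset of $[n]$ containing each element independently with probability $p$. $H(n,q_1,q_2)$ is the hypergraph with vertex set $[n]$ whose edges are all arithmetic progressions (nonzero common difference) in $[n]$ of length $q_1$ ("long edges") and of length $q_2$ ("short edges"). $H(n,q_1,q_2,p)$ is the subhypergraph of $H(n,q_1,q_2)$ induced by $[n]_p$. A hypergraph whose edges have sizes $q_1$ (long) or $q_2$ (short) is asymmetrically-2-colorable if its vertices can be colored red/blue so that no long edge is entirely red and no short edge is entirely blue.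
   Formalization: The probabilities p(n) are taken to be rational numbers in [0,1] rather than arbitrary reals; the bound on p is stated after raising both sides to the power q_1(q_2-1). -}

module Defs where

open import Data.Nat as ℕ using (ℕ; zero; suc; _<_; _≤_; _∸_)
open import Data.Integer using (+_)
open import Data.Rational as ℚ using (ℚ; 0ℚ; 1ℚ; _/_)
open import Data.Bool using (Bool; true; false)
open import Data.Fin using (fromℕ<)
open import Data.Vec using (Vec; []; _∷_; lookup)
open import Data.List using (List; map; foldr)
open import Data.Product using (Σ; ∃; _×_)
open import Relation.Binary.PropositionalEquality using (_≡_)
open import Relation.Nullary using (¬_)

_^ℚ_ : ℚ → ℕ → ℚ
x ^ℚ zero  = 1ℚ
x ^ℚ suc k = x ℚ.* (x ^ℚ k)

ℕ→ℚ : ℕ → ℚ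
ℕ→ℚ m = (+ m) / 1

sumℚ : List ℚ → ℚ
sumℚ = foldr ℚ._+_ 0ℚ

-- A subset S of [n] is a Vec Bool n; vertex v ∈ [n] = {1,…,n} is stored at index v-1.
-- Membership of vertex v (a natural number) in S:
_∈S_ : ℕ → {n : ℕ} → Vec Bool n → Set
v ∈S S = Σ (1 ≤ v) λ _ → Σ (v ∸ 1 < _) λ h → lookup S (fromℕ< h) ≡ true

card : {n : ℕ} → Vec Bool n → ℕ
card []          = 0
card (true ∷ S)  = suc (card S)
card (false ∷ S) = card S

-- The AP {a, a+d, …, a+(q-1)d} with d ≥ 1 is an edge of length q of H(n,q1,q2)
-- iff a ≥ 1 and a+(q-1)d ≤ n; it is an edge of the induced subhypergraph on S
-- iff additionally all its terms lie in S (then the first two conditions follow).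
-- (APs with negative difference give the same vertex sets.)
-- colouring: true = red, false = blue
allColoured : (ℕ → Bool) → Bool → (q a d : ℕ) → Set
allColoured χ col q a d = ∀ i → i < q → χ (a ℕ.+ i ℕ.* d) ≡ col

AsymColourable : (q1 q2 : ℕ) {n : ℕ} → Vec Bool n → Set
AsymColourable q1 q2 S =
  ∃ λ (χ : ℕ → Bool) →
    (∀ a d → 1 ≤ d → (∀ i → i < q1 → (a ℕ.+ i ℕ.* d) ∈S S) → ¬ allColoured χ true q1 a d)
    ×
    (∀ a d → 1 ≤ d → (∀ i → i < q2 → (a ℕ.+ i ℕ.* d) ∈S S) → ¬ allColoured χ false q2 a d)

-- probability that [n]_p equals S: p^|S| (1-p)^(n-|S|)
weight : ℚ → {n : ℕ} → Vec Bool n → ℚ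
weight p {n} S = (p ^ℚ card S) ℚ.* ((1ℚ ℚ.- p) ^ℚ (n ∸ card S))

module Submission where

open import Defs
open import Data.Nat as ℕ using (ℕ; zero; suc; _+_; _*_; _∸_; _^_; _<_; _≤_; _≥_; z≤n; s≤s)
import Data.Nat.Properties as ℕ
import Data.Nat.DivMod as ℕ
open import Data.Nat.Induction using (<-rec)
open import Data.Nat.Tactic.RingSolver using () renaming (solve-∀ to ℕ-solve-∀)
open import Data.Integer as ℤ using (ℤ; +_; -_; ∣_∣)
import Data.Integer.Properties as ℤ
open import Data.Integer.Tactic.RingSolver using () renaming (solve-∀ to ℤ-solve-∀)
open import Data.Rational as ℚ using (ℚ; 0ℚ; 1ℚ)
import Data.Rational.Properties as ℚ
open import Data.Rational.Solver using (module +-*-Solver)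
import Data.Rational.Unnormalised as ℚᵘ
import Data.Rational.Unnormalised.Properties as ℚᵘ
open import Data.Bool using (Bool; true; false; if_then_else_; not; _∧_)
import Data.Bool.Properties as Bool
open import Data.Vec as Vec using (Vec)
open import Data.List using (List; []; _∷_; _++_; map; filter; length; concat; concatMap; applyUpTo; upTo; filterᵇ; foldr; deduplicate; take; cartesianProductWith; cartesianProduct; [_])
import Data.List.Properties as List
open import Data.List.Membership.Propositional using (_∈_; _∉_; find; lose)
import Data.List.Membership.Propositional.Properties as Mem
open import Data.List.Membership.DecPropositional ℕ._≟_ using (_∈?_)
open import Data.List.Relation.Unary.Any as Any using (Any; here; there)
open import Data.List.Relation.Unary.All as All using (All; []; _∷_)
import Data.List.Relation.Unary.All.Properties as All
open import Data.List.Relation.Unary.AllPairs using ([]; _∷_)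
open import Data.List.Relation.Unary.Unique.Propositional using (Unique)
import Data.List.Relation.Unary.Unique.Propositional.Properties as Unique
import Data.List.Relation.Unary.Unique.DecPropositional as DecUniq
import Data.List.Relation.Unary.Unique.DecPropositional.Properties as DecUnique
open import Data.List.Relation.Binary.Subset.Propositional using (_⊆_)
open import Data.Product using (Σ; ∃; _×_; _,_; proj₁; proj₂)
open import Data.Sum using (_⊎_; inj₁; inj₂; [_,_]′)
open import Data.Empty using (⊥; ⊥-elim)
open import Function using (_∘_; id; case_of_)
open import Function.Bundles using (Equivalence)
open import Relation.Binary.Definitions using (tri<; tri≈; tri>)
open import Relation.Nullary using (¬_; Dec; yes; no; ¬?)
open import Relation.Nullary.Decidable using (_×-dec_; map′; T?; dec-true)
open import Relation.Binary.PropositionalEquality using (_≡_; _≢_; refl; sym; trans; cong; cong₂; subst; subst₂)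

-- Call a configuration of vertices, f of which are free while the others are determined by pairs of earlier
-- points, light if its expected number n^f p^N is polynomially small. Two long edges sharing many points span
-- the same rational line, and a family of such edges is hit by the first vertices of the member that starts
-- furthest right; colouring those vertices blue deals with all long edges on one line. A component of the
-- hypergraph is therefore explored line by line: every unprocessed short edge is added together with a long
-- edge through each of its new vertices. Either the colouring extends, or the step exhibits a light
-- configuration (a kill). A regular step, which attaches r - 1 generic long edges to a short edge, has
-- expected multiplicity O(c) per vertex, and any other step has a polynomially small one. For small c
-- the runs die out: the expected number of kills and of runs with more than T = O(log n) steps, weighted by
-- a geometric factor for the vertices that still have to be processed, tends to 0. A first moment bound
-- over these finitely many witnesses leaves subsets of total weight at least 1 - ε, all of them colourable.

-- Write a = q(r - 1), with q the long and r the short length. The hypothesis says p^a n^r ≤ c^a, so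
-- f a < r N makes n^f p^N at most n^(-1/a), which absorbs every power of log n. A regular step has
-- f = r and N ≥ a: it sits exactly at the threshold, only the constant c makes it subcritical, and
-- no factor growing with the explored set is affordable. It is therefore counted from a single
-- vertex, whereas all other steps may be counted from the whole explored set. A run starts on the
-- line of a long edge, of weight about n^2 p^q, which need not be small; so a kill has to be light
-- jointly with its start, whence the 2 and the q in its inequality. The obstacle is that long edges
-- can overlap heavily. Unless the line of a long edge is light already, any two of its edges share
-- at least 2q/r vertices, and then r - 2 blue vertices hit them all, too few to fill a short edge.
-- Extending the colouring works because a blue short edge, or a long edge outside the known lines,
-- would tie some long edge to points that are already determined; this saves a free vertex and
-- gives a kill.

module Lists where

  -- Lists of vertices: differences, fresh lists, progressions.

  infixl 6 _∖_

  abstract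

    _∖_ : List ℕ → List ℕ → List ℕ
    xs ∖ K = filter (λ x → ¬? (x ∈? K)) xs

    ∈-∖⁺ : ∀ {xs K x} → x ∈ xs → x ∉ K → x ∈ xs ∖ K
    ∈-∖⁺ {K = K} = Mem.∈-filter⁺ (λ x → ¬? (x ∈? K))

    ∈-∖⁻ : ∀ {xs K x} → x ∈ xs ∖ K → x ∈ xs × x ∉ K
    ∈-∖⁻ {K = K} = Mem.∈-filter⁻ (λ x → ¬? (x ∈? K))

    ∖-unique : ∀ {xs K} → Unique xs → Unique (xs ∖ K)
    ∖-unique {K = K} = Unique.filter⁺ (λ x → ¬? (x ∈? K))

    ∖-all : ∀ xs {K} → (∀ {x} → x ∈ xs → x ∉ K) → xs ∖ K ≡ xs
    ∖-all xs h = List.filter-all _ (All.tabulate h)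

    length-∖-≤ : ∀ xs K → length (xs ∖ K) ≤ length xs
    length-∖-≤ xs K = List.length-filter _ xs

    length-∖-< : ∀ {xs K x} → x ∈ xs → x ∈ K → length (xs ∖ K) < length xs
    length-∖-< {xs} x∈ x∈K = List.filter-notAll _ xs (lose x∈ λ k → k x∈K)

    length-∖-filter : ∀ xs K → length (xs ∖ K) + length (filter (_∈? K) xs) ≡ length xs
    length-∖-filter [] K = refl
    length-∖-filter (x ∷ xs) K with x ∈? K
    ... | yes _ = trans (ℕ.+-suc _ _) (cong suc (length-∖-filter xs K))
    ... | no _  = cong suc (length-∖-filter xs K)

  ⊆⊎∃∉ : ∀ xs K → xs ⊆ K ⊎ ∃ λ x → x ∈ xs × x ∉ K
  ⊆⊎∃∉ xs K with All.all? (_∈? K) xs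
  ... | yes p = inj₁ (All.lookup p)
  ... | no ¬p = inj₂ (find (All.¬All⇒Any¬ (_∈? K) xs ¬p))

  unique-⊆⇒length≤ : ∀ {xs ys : List ℕ} → Unique xs → xs ⊆ ys → length xs ≤ length ys
  unique-⊆⇒length≤ {[]} _ _ = z≤n
  unique-⊆⇒length≤ {x ∷ xs} {ys} (x∉ ∷ u) sub with Mem.∈-∃++ (sub (here refl))
  ... | as , bs , refl = begin
    suc (length xs)            ≤⟨ s≤s (unique-⊆⇒length≤ u sub′) ⟩
    suc (length (as ++ bs))    ≡⟨ sym (List.length-++-sucʳ as x bs) ⟩
    length (as ++ x ∷ bs)      ∎
    where
    open ℕ.≤-Reasoning
    sub′ : xs ⊆ as ++ bs
    sub′ {y} y∈ with Mem.∈-++⁻ as (sub (there y∈))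
    ... | inj₁ p         = Mem.∈-++⁺ˡ p
    ... | inj₂ (here refl) = ⊥-elim (All.lookup x∉ y∈ refl)
    ... | inj₂ (there p) = Mem.∈-++⁺ʳ as p

  MeetsOnce : List ℕ → List ℕ → Set
  MeetsOnce xs K = ∀ {x y} → x ∈ xs → x ∈ K → y ∈ xs → y ∈ K → x ≡ y

  abstract

    length-∖-meetsOnce : ∀ {xs K} → Unique xs → MeetsOnce xs K → length xs ≤ suc (length (xs ∖ K))
    length-∖-meetsOnce {[]} _ _ = z≤n
    length-∖-meetsOnce {x ∷ xs} {K} (x∉ ∷ u) once with x ∈? K
    ... | yes x∈K = s≤s (ℕ.≤-reflexive (cong length (sym (∖-all xs rest))))
      where
      rest : ∀ {y} → y ∈ xs → y ∉ K
      rest y∈ y∈K = All.lookup x∉ y∈ (once (here refl) x∈K (there y∈) y∈K)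
    ... | no _ = s≤s (length-∖-meetsOnce u (λ a b c d → once (there a) b (there c) d))

  length-∖-disjoint : ∀ {xs K c} → Unique xs → length xs ≤ c + length (xs ∖ K) →
    ∀ {K′} → (∀ {x} → x ∈ xs → x ∉ K′) → length xs ≤ c + length (xs ∖ (K′ ++ K))
  length-∖-disjoint {xs} {K} {c} u h {K′} dis =
    ℕ.≤-trans h (ℕ.+-monoʳ-≤ c (unique-⊆⇒length≤ (∖-unique u) sub))
    where
    sub : xs ∖ K ⊆ xs ∖ (K′ ++ K)
    sub p with ∈-∖⁻ {xs} {K} p
    ... | x∈ , x∉ = ∈-∖⁺ x∈ λ q → case-++ (Mem.∈-++⁻ K′ q)
      where
      case-++ : _ ∈ K′ ⊎ _ ∈ K → ⊥
      case-++ (inj₁ a) = dis x∈ a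
      case-++ (inj₂ a) = x∉ a

  -- The slack `c` counts vertices of `xs` lost so far, so that losses to several pieces can be
  -- accumulated piece by piece.
  length-∖-++ : ∀ {xs K c} → Unique xs → length xs ≤ c + length (xs ∖ K) →
    ∀ {K′} → MeetsOnce xs K′ → length xs ≤ suc c + length (xs ∖ (K′ ++ K))
  length-∖-++ {xs} {K} {c} u h {K′} once = begin
    length xs                              ≤⟨ h ⟩
    c + length (xs ∖ K)                    ≤⟨ ℕ.+-monoʳ-≤ c (length-∖-meetsOnce (∖-unique u) once′) ⟩
    c + suc (length (xs ∖ K ∖ K′))         ≡⟨ ℕ.+-suc c _ ⟩
    suc c + length (xs ∖ K ∖ K′)           ≤⟨ ℕ.+-monoʳ-≤ (suc c) (unique-⊆⇒length≤ (∖-unique (∖-unique u)) sub) ⟩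
    suc c + length (xs ∖ (K′ ++ K))        ∎
    where
    open ℕ.≤-Reasoning
    once′ : MeetsOnce (xs ∖ K) K′
    once′ a b c d = once (proj₁ (∈-∖⁻ {xs} {K} a)) b (proj₁ (∈-∖⁻ {xs} {K} c)) d
    sub : xs ∖ K ∖ K′ ⊆ xs ∖ (K′ ++ K)
    sub p with ∈-∖⁻ {xs ∖ K} {K′} p
    ... | x∈ , x∉′ with ∈-∖⁻ {xs} {K} x∈
    ... | x∈xs , x∉K = ∈-∖⁺ x∈xs λ q → case-++ (Mem.∈-++⁻ K′ q)
      where
      case-++ : _ ∈ K′ ⊎ _ ∈ K → ⊥
      case-++ (inj₁ a) = x∉′ a
      case-++ (inj₂ a) = x∉K a

  -- Distinctness makes p^N the probability that a list of length N is present; freshness with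
  -- respect to `A` lets the probabilities of consecutive steps multiply.
  record New (V A xs : List ℕ) : Set where
    constructor mkNew
    field
      unique : Unique xs
      fresh  : ∀ {x} → x ∈ xs → x ∉ A
      inV    : xs ⊆ V

  New-[] : ∀ {V A} → New V A []
  New-[] = mkNew [] (λ ()) (λ ())

  New-++ : ∀ {V A xs ys} → New V A xs → New V (xs ++ A) ys → New V A (xs ++ ys)
  New-++ {V} {A} {xs} {ys} (mkNew u f i) (mkNew u′ f′ i′) = mkNew
    (Unique.++⁺ u u′ λ (p , q) → f′ q (Mem.∈-++⁺ˡ p)) fr iv
    where
    fr : ∀ {x} → x ∈ xs ++ ys → x ∉ A
    fr p with Mem.∈-++⁻ xs p
    ... | inj₁ a = f a
    ... | inj₂ a = λ b → f′ a (Mem.∈-++⁺ʳ xs b)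
    iv : xs ++ ys ⊆ V
    iv p with Mem.∈-++⁻ xs p
    ... | inj₁ a = i a
    ... | inj₂ a = i′ a

  New-∖ : ∀ {V A xs} → Unique xs → xs ⊆ V → New V A (xs ∖ A)
  New-∖ {V} {A} {xs} u i = mkNew (∖-unique u) (λ p → proj₂ (∈-∖⁻ {xs} {A} p)) (λ p → i (proj₁ (∈-∖⁻ {xs} {A} p)))

  New-cong : ∀ {V A B xs} → B ⊆ A → New V A xs → New V B xs
  New-cong s (mkNew u f i) = mkNew u (λ p q → f p (s q)) i

  -- First term and difference. The length is supplied separately, so a short edge is an initial
  -- segment of the long progression with the same data, and statements about long progressions
  -- apply to it.
  Pts : Set
  Pts = ℕ × ℕ

  pts : ℕ → Pts → List ℕ
  pts k (a , d) = applyUpTo (λ i → a + i * d) k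

  ∈-pts⁺ : ∀ {k i} e → i < k → proj₁ e + i * proj₂ e ∈ pts k e
  ∈-pts⁺ e = Mem.∈-applyUpTo⁺ _

  ∈-pts⁻ : ∀ {k x} e → x ∈ pts k e → ∃ λ i → i < k × x ≡ proj₁ e + i * proj₂ e
  ∈-pts⁻ e = Mem.∈-applyUpTo⁻ _

  length-pts : ∀ k e → length (pts k e) ≡ k
  length-pts k e = List.length-applyUpTo _ k

  pts-injective : ∀ a {d i j} → 1 ≤ d → a + i * d ≡ a + j * d → i ≡ j
  pts-injective a {suc d} {i} {j} _ eq = ℕ.*-cancelʳ-≡ i j (suc d) (ℕ.+-cancelˡ-≡ a _ _ eq)

  pts-unique : ∀ k e → 1 ≤ proj₂ e → Unique (pts k e)
  pts-unique k (a , d) 1≤d = Unique.applyUpTo⁺₁ _ k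
    λ i<j _ eq → ℕ.<⇒≢ i<j (pts-injective a 1≤d eq)

open Lists

-- Bounded rational coordinates on the line of a progression.

module RationalLines where

  signed : ℕ → List ℤ
  signed Q = concatMap (λ k → + k ∷ - (+ k) ∷ []) (upTo (suc Q))

  ∈-signed : ∀ {Q s} → ∣ s ∣ ≤ Q → s ∈ signed Q
  ∈-signed {Q} {s} h = Mem.∈-concatMap⁺ (λ k → + k ∷ - (+ k) ∷ []) (lose (Mem.∈-upTo⁺ (s≤s h)) member)
    where
    member : s ∈ + ∣ s ∣ ∷ - (+ ∣ s ∣) ∷ []
    member with ℤ.+∣i∣≡i⊎+∣i∣≡-i s
    ... | inj₁ e = here (sym e)
    ... | inj₂ e = there (here (sym (trans (cong -_ e) (ℤ.neg-involutive s))))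

  -- The point y + (s/(t+1))(z - y) whenever this is a natural number. Absolute value and truncated
  -- division only make the function total; spurious values merely enlarge the list of candidates.
  affine : ℕ → ℕ → ℕ → ℤ → ℕ
  affine y z t s = ∣ + suc t ℤ.* + y ℤ.+ s ℤ.* (+ z ℤ.- + y) ∣ ℕ./ suc t

  length-cartesianProductWith : ∀ {A B C : Set} (f : A → B → C) xs ys →
    length (cartesianProductWith f xs ys) ≡ length xs * length ys
  length-cartesianProductWith f []       ys = refl
  length-cartesianProductWith f (x ∷ xs) ys =
    trans (List.length-++ (map (f x) ys))
          (cong₂ _+_ (List.length-map (f x) ys) (length-cartesianProductWith f xs ys))

  interpSize : ℕ → ℕ
  interpSize Q = Q * length (signed Q)

  abstract
    -- The points determined by `y` and `z`. Their number depends on `Q` alone, not on n, which is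
    -- why a determined vertex costs only a constant factor.
    interp : ℕ → ℕ → ℕ → List ℕ
    interp Q y z = cartesianProductWith (affine y z) (upTo Q) (signed Q)

    ∈-interp : ∀ {Q} y z {x t s} → t < Q → ∣ s ∣ ≤ Q →
      + suc t ℤ.* + x ≡ + suc t ℤ.* + y ℤ.+ s ℤ.* (+ z ℤ.- + y) → x ∈ interp Q y z
    ∈-interp {Q} y z {x} {t} {s} t<Q s≤Q eq =
      subst (_∈ interp Q y z) value
        (Mem.∈-cartesianProductWith⁺ (affine y z) {a = t} {b = s} (Mem.∈-upTo⁺ t<Q) (∈-signed s≤Q))
      where
      value : affine y z t s ≡ x
      value = trans (cong (λ i → ∣ i ∣ ℕ./ suc t) (sym eq))
                (trans (cong (ℕ._/ suc t) (ℤ.abs-* (+ suc t) (+ x))) (trans (cong (ℕ._/ suc t) (ℕ.*-comm (suc t) x)) (ℕ.m*n/n≡m x (suc t))))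

    length-interp : ∀ Q y z → length (interp Q y z) ≡ interpSize Q
    length-interp Q y z = trans (length-cartesianProductWith (affine y z) (upTo Q) (signed Q))
                                (cong (_* length (signed Q)) (List.length-upTo Q))

  -- x has coordinate s/t on the line a + ℚd.
  data OnLine (B : ℕ) (e : Pts) (x : ℕ) : Set where
    coord : ∀ t s → t < B → ∣ s ∣ ≤ B →
      + suc t ℤ.* + x ≡ + suc t ℤ.* + proj₁ e ℤ.+ s ℤ.* + proj₂ e → OnLine B e x

  OnLine-mono : ∀ {B C e x} → B ≤ C → OnLine B e x → OnLine C e x
  OnLine-mono le (coord t s p r eq) = coord t s (ℕ.<-≤-trans p le) (ℕ.≤-trans r le) eq

  pts-onLine : ∀ {k x} e → 1 ≤ k → x ∈ pts k e → OnLine k e x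
  pts-onLine {k} e@(a , d) 1≤k x∈ with ∈-pts⁻ e x∈
  ... | i , i<k , refl = coord 0 (+ i) 1≤k (ℕ.<⇒≤ i<k) eq
    where
    eq : + 1 ℤ.* + (a + i * d) ≡ + 1 ℤ.* + a ℤ.+ + i ℤ.* + d
    eq = trans (ℤ.*-identityˡ _) (trans (ℤ.pos-+ a (i * d))
          (cong₂ ℤ._+_ (sym (ℤ.*-identityˡ (+ a))) (ℤ.pos-* i d)))

  private
    abs-bound : ∀ {i j B C} → ∣ i ∣ ≤ B → ∣ j ∣ ≤ C → ∣ i ℤ.* j ∣ ≤ B * C
    abs-bound {i} {j} h k = ℕ.≤-trans (ℕ.≤-reflexive (ℤ.abs-* i j)) (ℕ.*-mono-≤ h k)

    abs-bound-+ : ∀ {i j B C} → ∣ i ∣ ≤ B → ∣ j ∣ ≤ C → ∣ i ℤ.+ j ∣ ≤ B + C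
    abs-bound-+ {i} {j} h k = ℕ.≤-trans (ℤ.∣i+j∣≤∣i∣+∣j∣ i j) (ℕ.+-mono-≤ h k)

    abs-bound-sub : ∀ {i j B C} → ∣ i ∣ ≤ B → ∣ j ∣ ≤ C → ∣ i ℤ.- j ∣ ≤ B + C
    abs-bound-sub {i} {j} h k = ℕ.≤-trans (ℤ.∣i-j∣≤∣i∣+∣j∣ i j) (ℕ.+-mono-≤ h k)

    two-points : ∀ (a d ty sy y tx sx x : ℤ) →
      ty ℤ.* y ≡ ty ℤ.* a ℤ.+ sy ℤ.* d → tx ℤ.* x ≡ tx ℤ.* a ℤ.+ sx ℤ.* d →
      ty ℤ.* tx ℤ.* (x ℤ.- y) ≡ (sx ℤ.* ty ℤ.- sy ℤ.* tx) ℤ.* d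
    two-points a d ty sy y tx sx x ey ex =
      trans (lhs ty tx x y) (trans (cong₂ (λ u v → ty ℤ.* u ℤ.- tx ℤ.* v) ex ey) (rhs ty tx a d sx sy))
      where
      lhs : ∀ ty tx x y → ty ℤ.* tx ℤ.* (x ℤ.- y) ≡ ty ℤ.* (tx ℤ.* x) ℤ.- tx ℤ.* (ty ℤ.* y)
      lhs = ℤ-solve-∀
      rhs : ∀ ty tx a d sx sy → ty ℤ.* (tx ℤ.* a ℤ.+ sx ℤ.* d) ℤ.- tx ℤ.* (ty ℤ.* a ℤ.+ sy ℤ.* d)
            ≡ (sx ℤ.* ty ℤ.- sy ℤ.* tx) ℤ.* d
      rhs = ℤ-solve-∀

  detBound : ℕ → ℕ
  detBound B = (B * B + B * B) * (B * B)

  -- Eliminating the first term and the difference from the three coordinate equations gives M ty tx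
  -- (x - y) = K (z - y). Since y ≠ z, M is nonzero, so x is an affine combination of y and z whose
  -- numerator and denominator are at most `detBound B`.
  onLine⇒interp : ∀ {B e x y z} → OnLine B e y → OnLine B e z → OnLine B e x → y ≢ z →
    x ∈ interp (detBound B) y z
  onLine⇒interp {B} {a , d} {x} {y} {z} (coord ty′ sy ty<B sy≤B ey) (coord tz′ sz tz<B sz≤B ez)
    (coord tx′ sx tx<B sx≤B ex) y≢z = go (∣ M ∣ * (suc ty′ * suc tx′)) refl
    where
    ty = + suc ty′
    tz = + suc tz′
    tx = + suc tx′
    M = sz ℤ.* ty ℤ.- sy ℤ.* tz
    K = (sx ℤ.* ty ℤ.- sy ℤ.* tx) ℤ.* (ty ℤ.* tz)
    hx : ty ℤ.* tx ℤ.* (+ x ℤ.- + y) ≡ (sx ℤ.* ty ℤ.- sy ℤ.* tx) ℤ.* + d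
    hx = two-points (+ a) (+ d) ty sy (+ y) tx sx (+ x) ey ex
    hz : ty ℤ.* tz ℤ.* (+ z ℤ.- + y) ≡ M ℤ.* + d
    hz = two-points (+ a) (+ d) ty sy (+ y) tz sz (+ z) ey ez
    key : M ℤ.* (ty ℤ.* tx) ℤ.* (+ x ℤ.- + y) ≡ K ℤ.* (+ z ℤ.- + y)
    key = trans (ℤ.*-assoc M (ty ℤ.* tx) (+ x ℤ.- + y)) (trans (cong (M ℤ.*_) hx) (trans (swap M (sx ℤ.* ty ℤ.- sy ℤ.* tx) (+ d))
            (trans (cong ((sx ℤ.* ty ℤ.- sy ℤ.* tx) ℤ.*_) (sym hz)) (sym (ℤ.*-assoc (sx ℤ.* ty ℤ.- sy ℤ.* tx) (ty ℤ.* tz) (+ z ℤ.- + y))))))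
      where
      swap : ∀ m k e → m ℤ.* (k ℤ.* e) ≡ k ℤ.* (m ℤ.* e)
      swap = ℤ-solve-∀
    M≢0 : M ≢ + 0
    M≢0 M≡0 = y≢z (sym (ℤ.+-injective (ℤ.i-j≡0⇒i≡j (+ z) (+ y)
      (ℤ.*-cancelˡ-≡ (ty ℤ.* tz) _ (+ 0) (trans hz (trans (cong (ℤ._* + d) M≡0) (sym (ℤ.*-zeroʳ (ty ℤ.* tz)))))))))
    B² : ∀ {m n} → m ≤ B → n ≤ B → m * n ≤ B * B
    B² = ℕ.*-mono-≤
    M≤ : ∣ M ∣ ≤ B * B + B * B
    M≤ = abs-bound-sub {sz ℤ.* ty} {sy ℤ.* tz} (abs-bound {sz} {ty} sz≤B ty<B) (abs-bound {sy} {tz} sy≤B tz<B)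
    K≤ : ∣ K ∣ ≤ detBound B
    K≤ = abs-bound {sx ℤ.* ty ℤ.- sy ℤ.* tx} {ty ℤ.* tz}
           (abs-bound-sub {sx ℤ.* ty} {sy ℤ.* tx} (abs-bound {sx} {ty} sx≤B ty<B) (abs-bound {sy} {tx} sy≤B tx<B))
           (abs-bound {ty} {tz} ty<B tz<B)
    shift : ∀ T x y w → T ℤ.* (x ℤ.- y) ≡ w → T ℤ.* x ≡ T ℤ.* y ℤ.+ w
    shift T x y w h = trans (expand T x y) (cong (λ u → T ℤ.* y ℤ.+ u) h)
      where
      expand : ∀ T x y → T ℤ.* x ≡ T ℤ.* y ℤ.+ T ℤ.* (x ℤ.- y)
      expand = ℤ-solve-∀
    pos : + (∣ M ∣ * (suc ty′ * suc tx′)) ≡ + ∣ M ∣ ℤ.* (ty ℤ.* tx)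
    pos = trans (ℤ.pos-* ∣ M ∣ _) (cong (+ ∣ M ∣ ℤ.*_) (ℤ.pos-* (suc ty′) (suc tx′)))
    go : ∀ T → T ≡ ∣ M ∣ * (suc ty′ * suc tx′) → x ∈ interp (detBound B) y z
    go zero eq with ℕ.m*n≡0⇒m≡0∨n≡0 ∣ M ∣ (sym eq)
    ... | inj₁ M0 = ⊥-elim (M≢0 (ℤ.∣i∣≡0⇒i≡0 M0))
    -- Denominators are positive by encoding, so the sign of `M` has to move into the numerator.
    go (suc t) eq with ℤ.+∣i∣≡i⊎+∣i∣≡-i M
    ... | inj₁ e = ∈-interp y z {t = t} {s = K}
                     (ℕ.≤-trans (ℕ.≤-reflexive eq) (ℕ.*-mono-≤ M≤ (B² ty<B tx<B))) K≤
                     (shift (+ suc t) (+ x) (+ y) _ (trans (cong (ℤ._* (+ x ℤ.- + y))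
                       (trans (cong +_ eq) (trans pos (cong (ℤ._* (ty ℤ.* tx)) e)))) key))
    ... | inj₂ e = ∈-interp y z {t = t} {s = - K}
                     (ℕ.≤-trans (ℕ.≤-reflexive eq) (ℕ.*-mono-≤ M≤ (B² ty<B tx<B)))
                     (ℕ.≤-trans (ℕ.≤-reflexive (ℤ.∣-i∣≡∣i∣ K)) K≤)
                     (shift (+ suc t) (+ x) (+ y) _ (trans (cong (ℤ._* (+ x ℤ.- + y))
                       (trans (cong +_ eq) (trans pos (trans (cong (ℤ._* (ty ℤ.* tx)) e) (sym (ℤ.neg-distribˡ-* M (ty ℤ.* tx)))))))
                       (trans (sym (ℤ.neg-distribˡ-* (M ℤ.* (ty ℤ.* tx)) (+ x ℤ.- + y))) (trans (cong -_ key) (ℤ.neg-distribˡ-* K (+ z ℤ.- + y))))))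

  lineBound : ℕ → ℕ → ℕ
  lineBound k B = k * (B * B) + k * (B * B + B * B)

  private
    cast : ∀ a i d → + (a + i * d) ≡ + a ℤ.+ + i ℤ.* + d
    cast a i d = trans (ℤ.pos-+ a (i * d)) (cong (λ w → + a ℤ.+ w) (ℤ.pos-* i d))

    -- Interpolation inside the second progression: its l-th term is the i-th plus (l - i)/(j - i)
    -- times the difference of the j-th and the i-th. All indices are below `k`, so the height grows
    -- by a factor depending on `k` and `B` only.
    pts-onLine-ordered : ∀ {k B a d a′ d′ l i j} → l < k → j < k → i < j →
      OnLine B (a , d) (a′ + i * d′) → OnLine B (a , d) (a′ + j * d′) →
      OnLine (lineBound k B) (a , d) (a′ + l * d′)
    pts-onLine-ordered {k} {B} {a} {d} {a′} {d′} {l} {i} {j} l<k j<k i<j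
      (coord ty′ sy ty<B sy≤B ey) (coord tz′ sz tz<B sz≤B ez)
      with ℕ.m≤n⇒∃[o]m+o≡n i<j
    ... | m′ , refl = coord t′ s t< s≤ eq
      where
      ty = + suc ty′
      tz = + suc tz′
      m = + suc m′
      t′ = tz′ + ty′ * suc tz′ + m′ * (suc ty′ * suc tz′)
      s = m ℤ.* (tz ℤ.* sy) ℤ.+ (+ l ℤ.- + i) ℤ.* (ty ℤ.* sz ℤ.- tz ℤ.* sy)
      t≡ : + suc t′ ≡ m ℤ.* (ty ℤ.* tz)
      t≡ = trans (ℤ.pos-* (suc m′) (suc ty′ * suc tz′)) (cong (m ℤ.*_) (ℤ.pos-* (suc ty′) (suc tz′)))
      m<k : suc m′ ≤ k
      m<k = ℕ.≤-trans (s≤s (ℕ.m≤n+m m′ i)) (ℕ.<⇒≤ j<k)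
      t< : t′ < lineBound k B
      t< = ℕ.≤-trans (ℕ.*-mono-≤ m<k (ℕ.*-mono-≤ ty<B tz<B)) (ℕ.m≤m+n _ _)
      l-i≤ : ∣ + l ℤ.- + i ∣ ≤ k
      l-i≤ = ℕ.≤-trans (ℕ.≤-reflexive (cong ∣_∣ (ℤ.m-n≡m⊖n l i))) (ℕ.≤-trans (ℤ.∣m⊝n∣≤m⊔n l i)
               (ℕ.⊔-lub (ℕ.<⇒≤ l<k) (ℕ.≤-trans (ℕ.m≤n⇒m≤1+n (ℕ.m≤m+n i m′)) (ℕ.<⇒≤ j<k))))
      s≤ : ∣ s ∣ ≤ lineBound k B
      s≤ = abs-bound-+ {m ℤ.* (tz ℤ.* sy)} {(+ l ℤ.- + i) ℤ.* (ty ℤ.* sz ℤ.- tz ℤ.* sy)}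
             (abs-bound {m} {tz ℤ.* sy} m<k (abs-bound {tz} {sy} tz<B sy≤B))
             (abs-bound {+ l ℤ.- + i} {ty ℤ.* sz ℤ.- tz ℤ.* sy} l-i≤
               (abs-bound-sub {ty ℤ.* sz} {tz ℤ.* sy} (abs-bound {ty} {sz} ty<B sz≤B) (abs-bound {tz} {sy} tz<B sy≤B)))
      Y = + a′ ℤ.+ + i ℤ.* + d′
      Z = + a′ ℤ.+ (m ℤ.+ + i) ℤ.* + d′
      castZ : + (a′ + (suc i + m′) * d′) ≡ Z
      castZ = trans (cast a′ (suc i + m′) d′) (cong (λ u → + a′ ℤ.+ u ℤ.* + d′)
                (trans (cong +_ (cong suc (ℕ.+-comm i m′))) (ℤ.pos-+ (suc m′) i)))
      ring₁ : ∀ ty tz m a′ d′ l i →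
        m ℤ.* (ty ℤ.* tz) ℤ.* (a′ ℤ.+ l ℤ.* d′) ≡
        m ℤ.* (tz ℤ.* (ty ℤ.* (a′ ℤ.+ i ℤ.* d′))) ℤ.+ (l ℤ.- i) ℤ.*
          (ty ℤ.* (tz ℤ.* (a′ ℤ.+ (m ℤ.+ i) ℤ.* d′)) ℤ.- tz ℤ.* (ty ℤ.* (a′ ℤ.+ i ℤ.* d′)))
      ring₁ = ℤ-solve-∀
      ring₂ : ∀ ty tz m a d l i sy sz →
        m ℤ.* (tz ℤ.* (ty ℤ.* a ℤ.+ sy ℤ.* d)) ℤ.+ (l ℤ.- i) ℤ.*
          (ty ℤ.* (tz ℤ.* a ℤ.+ sz ℤ.* d) ℤ.- tz ℤ.* (ty ℤ.* a ℤ.+ sy ℤ.* d)) ≡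
        m ℤ.* (ty ℤ.* tz) ℤ.* a ℤ.+ (m ℤ.* (tz ℤ.* sy) ℤ.+ (l ℤ.- i) ℤ.* (ty ℤ.* sz ℤ.- tz ℤ.* sy)) ℤ.* d
      ring₂ = ℤ-solve-∀
      eq : + suc t′ ℤ.* + (a′ + l * d′) ≡ + suc t′ ℤ.* + a ℤ.+ s ℤ.* + d
      eq = trans (cong₂ ℤ._*_ t≡ (cast a′ l d′)) (trans (ring₁ ty tz m (+ a′) (+ d′) (+ l) (+ i))
             (trans (cong₂ (λ u v → m ℤ.* (tz ℤ.* u) ℤ.+ (+ l ℤ.- + i) ℤ.* (ty ℤ.* v ℤ.- tz ℤ.* u))
                       (trans (cong (ty ℤ.*_) (sym (cast a′ i d′))) ey) (trans (cong (tz ℤ.*_) (sym castZ)) ez))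
             (trans (ring₂ ty tz m (+ a) (+ d) (+ l) (+ i) sy sz)
               (cong (λ u → u ℤ.* + a ℤ.+ s ℤ.* + d) (sym t≡)))))

  pts-onLine-ext : ∀ {k B e x y z} f → y ∈ pts k f → z ∈ pts k f → y ≢ z →
    OnLine B e y → OnLine B e z → x ∈ pts k f → OnLine (lineBound k B) e x
  pts-onLine-ext {e = e} f y∈ z∈ y≢z oy oz x∈
    with ∈-pts⁻ f y∈ | ∈-pts⁻ f z∈ | ∈-pts⁻ f x∈
  ... | i , i<k , refl | j , j<k , refl | l , l<k , refl with ℕ.<-cmp i j
  ... | tri< i<j _ _ = pts-onLine-ordered {a = proj₁ e} {d = proj₂ e} l<k j<k i<j oy oz
  ... | tri≈ _ refl _ = ⊥-elim (y≢z refl)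
  ... | tri> _ _ j<i = pts-onLine-ordered {a = proj₁ e} {d = proj₂ e} l<k i<k j<i oz oy

open RationalLines

-- Spans and generated configurations.

module Spans where

  length-concat-const : ∀ {A : Set} c (xss : List (List A)) → (∀ {xs} → xs ∈ xss → length xs ≡ c) →
    length (concat xss) ≡ length xss * c
  length-concat-const c []         h = refl
  length-concat-const c (xs ∷ xss) h =
    trans (List.length-++ xs) (cong₂ _+_ (h (here refl)) (length-concat-const c xss (h ∘ there)))

  abstract
    span : ℕ → List ℕ → List ℕ
    span Q K = K ++ concat (cartesianProductWith (interp Q) K K)

    ⊆-span : ∀ {Q K} → K ⊆ span Q K
    ⊆-span = Mem.∈-++⁺ˡ

    interp-span : ∀ {Q K x y z} → y ∈ K → z ∈ K → x ∈ interp Q y z → x ∈ span Q K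
    interp-span {Q} {K} y∈ z∈ x∈ = Mem.∈-++⁺ʳ K (Mem.∈-concat⁺′ x∈ (Mem.∈-cartesianProductWith⁺ (interp Q) y∈ z∈))

    span-mono : ∀ {Q K L} → K ⊆ L → span Q K ⊆ span Q L
    span-mono {Q} {K} {L} s {x} x∈ with Mem.∈-++⁻ K x∈
    ... | inj₁ p = Mem.∈-++⁺ˡ (s p)
    ... | inj₂ p with Mem.∈-concat⁻′ _ p
    ... | zs , x∈zs , zs∈ with Mem.∈-cartesianProductWith⁻ (interp Q) K K zs∈
    ... | y , z , y∈ , z∈ , refl = interp-span (s y∈) (s z∈) x∈zs

    length-span : ∀ Q K → length (span Q K) ≡ length K + length K * length K * interpSize Q
    length-span Q K = trans (List.length-++ K) (cong (λ n → length K + n)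
      (trans (length-concat-const (interpSize Q) (cartesianProductWith (interp Q) K K) size)
             (cong (_* interpSize Q) (length-cartesianProductWith (interp Q) K K))))
      where
      size : ∀ {xs} → xs ∈ cartesianProductWith (interp Q) K K → length xs ≡ interpSize Q
      size p with Mem.∈-cartesianProductWith⁻ (interp Q) K K p
      ... | y , z , _ , _ , refl = length-interp Q y z

  -- Three rounds are the longest chain that occurs: listed edges give a blue vertex on their line,
  -- two such points give another vertex of a short edge, and this vertex together with a listed one
  -- gives a long edge.
  spanⁿ : ℕ → ℕ → List ℕ → List ℕ
  spanⁿ zero    Q K = K
  spanⁿ (suc h) Q K = span Q (spanⁿ h Q K)

  base⊆spanⁿ : ∀ h {Q K} → K ⊆ spanⁿ h Q K
  base⊆spanⁿ zero    p = p
  base⊆spanⁿ (suc h) p = ⊆-span (base⊆spanⁿ h p)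

  spanⁿ-mono : ∀ h {Q K L} → K ⊆ L → spanⁿ h Q K ⊆ spanⁿ h Q L
  spanⁿ-mono zero    s = s
  spanⁿ-mono (suc h) s = span-mono (spanⁿ-mono h s)

  -- The list xs is built from the base A one vertex at a time; at most f of its vertices are free, the
  -- others are determined by pairs of earlier vertices, possibly through intermediate points that are
  -- themselves not listed.
  data Gen (Q : ℕ) (A : List ℕ) : ℕ → List ℕ → Set where
    done : ∀ {f} → Gen Q A f []
    free : ∀ {f x xs} → Gen Q (x ∷ A) f xs → Gen Q A (suc f) (x ∷ xs)
    det  : ∀ {f x xs} → x ∈ spanⁿ 3 Q A → Gen Q (x ∷ A) f xs → Gen Q A f (x ∷ xs)

  ∷-mono : ∀ {A B : List ℕ} {x} → A ⊆ B → x ∷ A ⊆ x ∷ B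
  ∷-mono s (here refl) = here refl
  ∷-mono s (there p)   = there (s p)

  Gen-mono : ∀ {Q A B f xs} → A ⊆ B → Gen Q A f xs → Gen Q B f xs
  Gen-mono s done      = done
  Gen-mono s (free g)  = free (Gen-mono (∷-mono s) g)
  Gen-mono s (det p g) = det (spanⁿ-mono 3 s p) (Gen-mono (∷-mono s) g)

  private
    shuffle : ∀ (x : ℕ) xs A → (x ∷ xs) ++ A ⊆ xs ++ x ∷ A
    shuffle x xs A (here refl) = Mem.∈-++⁺ʳ xs (here refl)
    shuffle x xs A (there p) with Mem.∈-++⁻ xs p
    ... | inj₁ a = Mem.∈-++⁺ˡ a
    ... | inj₂ a = Mem.∈-++⁺ʳ xs (there a)

  Gen-weaken : ∀ {Q A f g xs} → f ≤ g → Gen Q A f xs → Gen Q A g xs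
  Gen-weaken le done = done
  Gen-weaken (s≤s le) (free G) = free (Gen-weaken le G)
  Gen-weaken le (det p G) = det p (Gen-weaken le G)

  Gen-++ : ∀ {Q A f g xs ys} → Gen Q A f xs → Gen Q (xs ++ A) g ys → Gen Q A (f + g) (xs ++ ys)
  Gen-++ {f = f} {g} done G = Gen-weaken (ℕ.m≤n+m g f) G
  Gen-++ {A = A} (free {x = x} {xs} F) G = free (Gen-++ F (Gen-mono (shuffle x xs A) G))
  Gen-++ {A = A} (det {x = x} {xs} p F) G = det p (Gen-++ F (Gen-mono (shuffle x xs A) G))

  Gen-take : ∀ {Q A f xs} k → Gen Q A f xs → Gen Q A f (take k xs)
  Gen-take zero    G         = done
  Gen-take (suc k) done      = done
  Gen-take (suc k) (free G)  = free (Gen-take k G)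
  Gen-take (suc k) (det p G) = det p (Gen-take k G)

  module _ {B : ℕ} where

    private Q = detBound B

    determined : ∀ {h K e x y z} → y ∈ spanⁿ h Q K → z ∈ spanⁿ h Q K → y ≢ z →
      OnLine B e y → OnLine B e z → OnLine B e x → x ∈ spanⁿ (suc h) Q K
    determined y∈ z∈ y≢z oy oz ox = interp-span y∈ z∈ (onLine⇒interp oy oz ox y≢z)

    -- The subscripts 0, 1, 2 count the free vertices that a line still needs to have two known
    -- points. The known points may themselves be unlisted, two rounds away from `A`; the third
    -- round produces the vertices of `xs`.
    Gen-line₀ : ∀ {A} e {y z xs} → y ∈ spanⁿ 2 Q A → z ∈ spanⁿ 2 Q A → y ≢ z → OnLine B e y → OnLine B e z →
      (∀ {x} → x ∈ xs → OnLine B e x) → Gen Q A 0 xs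
    Gen-line₀ e {xs = []} y∈ z∈ y≢z oy oz ox = done
    Gen-line₀ {A} e {xs = x ∷ xs} y∈ z∈ y≢z oy oz ox =
      det (determined {2} y∈ z∈ y≢z oy oz (ox (here refl)))
          (Gen-line₀ e (spanⁿ-mono 2 {Q} {A} there y∈) (spanⁿ-mono 2 {Q} {A} there z∈) y≢z oy oz (ox ∘ there))

    Gen-line₁ : ∀ {A} e {y xs} → y ∈ A → OnLine B e y → (∀ {x} → x ∈ xs → y ≢ x) →
      (∀ {x} → x ∈ xs → OnLine B e x) → Gen Q A 1 xs
    Gen-line₁ e {xs = []} y∈ oy ne ox = done
    Gen-line₁ e {xs = x ∷ xs} y∈ oy ne ox =
      free (Gen-line₀ e (base⊆spanⁿ 2 (there y∈)) (base⊆spanⁿ 2 (here refl)) (ne (here refl))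
        oy (ox (here refl)) (ox ∘ there))

    Gen-line₂ : ∀ {A} e {xs} → Unique xs → (∀ {x} → x ∈ xs → OnLine B e x) → Gen Q A 2 xs
    Gen-line₂ e {[]} u ox = done
    Gen-line₂ e {x ∷ xs} (x∉ ∷ u) ox =
      free (Gen-line₁ e (here refl) (ox (here refl)) (λ p → All.lookup x∉ p) (ox ∘ there))

open Spans

-- Small hitting sets for the long edges on one line.

module HittingSets where

  -- The first hit `i` is returned along with the count, because its distance from the left end is
  -- what the applications can bound from below.
  sparse-count : ∀ {P : ℕ → Set} (P? : ∀ x → Dec (P x)) f m G →
    (∀ i j → i < j → j < m → P (f i) → P (f j) → i + G ≤ j) →
    length (filter P? (applyUpTo f m)) ≡ 0 ⊎
    (∃ λ c → ∃ λ i → length (filter P? (applyUpTo f m)) ≡ suc c × i < m × P (f i) × i + c * G < m)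
  sparse-count P? f zero G gap = inj₁ refl
  sparse-count P? f (suc m) G gap with sparse-count P? (f ∘ suc) m G
    (λ i j i<j j<m pi pj → ℕ.≤-pred (gap (suc i) (suc j) (s≤s i<j) (s≤s j<m) pi pj)) | P? (f 0)
  ... | inj₁ e | yes p = inj₂ (0 , 0 , cong suc e , s≤s z≤n , p , s≤s z≤n)
  ... | inj₁ e | no _  = inj₁ e
  ... | inj₂ (c , i , e , i<m , pi , le) | no _ = inj₂ (c , suc i , e , s≤s i<m , pi , s≤s le)
  ... | inj₂ (c , i , e , i<m , pi , le) | yes p = inj₂ (suc c , 0 , cong suc e , s≤s z≤n , p , (begin-strict
    G + c * G       ≤⟨ ℕ.+-monoˡ-≤ (c * G) (gap 0 (suc i) (s≤s z≤n) (s≤s i<m) p pi) ⟩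
    suc i + c * G   <⟨ s≤s le ⟩
    suc m           ∎))
    where open ℕ.≤-Reasoning

  common : ℕ → Pts → Pts → ℕ
  common q e e′ = length (filter (_∈? pts q e′) (pts q e))

  module _ (q : ℕ) (e₁ e′ : Pts) (d₁≥1 : 1 ≤ proj₂ e₁) (d′≥1 : 1 ≤ proj₂ e′) (left : proj₁ e′ ≤ proj₁ e₁) where

    private
      a₁ = proj₁ e₁
      d₁ = proj₂ e₁
      a′ = proj₁ e′
      d′ = proj₂ e′

      pos : ∀ a i g d → a + (i + g) * d ≡ a + i * d + g * d
      pos = ℕ-solve-∀

    Common : ℕ → Set
    Common i = a₁ + i * d₁ ∈ pts q e′

    private
      period : ∀ {i g} → Common i → Common (i + g) → ∃ λ h → g * d₁ ≡ h * d′
      period {i} {g} ci cj with ∈-pts⁻ e′ ci | ∈-pts⁻ e′ cj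
      ... | u , _ , eu | v , _ , ev with ℕ.≤-total u v
      ... | inj₁ u≤v with ℕ.m≤n⇒∃[o]m+o≡n u≤v
      ... | h , refl = h , ℕ.+-cancelˡ-≡ (a₁ + i * d₁) _ _ (begin
        a₁ + i * d₁ + g * d₁     ≡⟨ sym (pos a₁ i g d₁) ⟩
        a₁ + (i + g) * d₁        ≡⟨ ev ⟩
        a′ + (u + h) * d′        ≡⟨ pos a′ u h d′ ⟩
        a′ + u * d′ + h * d′     ≡⟨ cong (_+ h * d′) (sym eu) ⟩
        a₁ + i * d₁ + h * d′     ∎)
        where open Relation.Binary.PropositionalEquality.≡-Reasoning
      period {i} {g} ci cj | u , _ , eu | v , _ , ev | inj₂ v≤u = 0 , ℕ.n≤0⇒n≡0 (ℕ.+-cancelˡ-≤ (a₁ + i * d₁) (g * d₁) 0 (begin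
        a₁ + i * d₁ + g * d₁     ≡⟨ sym (pos a₁ i g d₁) ⟩
        a₁ + (i + g) * d₁        ≡⟨ ev ⟩
        a′ + v * d′              ≤⟨ ℕ.+-monoʳ-≤ a′ (ℕ.*-monoˡ-≤ d′ v≤u) ⟩
        a′ + u * d′              ≡⟨ sym eu ⟩
        a₁ + i * d₁              ≡⟨ sym (ℕ.+-identityʳ _) ⟩
        a₁ + i * d₁ + 0          ∎))
        where open ℕ.≤-Reasoning

      index< : ∀ {u v} → a′ + u * d′ ≤ a′ + v * d′ → u ≤ v
      index< {u} {v} le = ℕ.*-cancelʳ-≤ u v d′ {{ℕ.>-nonZero d′≥1}} (ℕ.+-cancelˡ-≤ a′ _ _ le)

    -- The difference of two common points is a multiple of both differences, so shifting a common
    -- point by it preserves the residue class. Shifted to the left, the point still lies in `e₁`,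
    -- hence not to the left of the start of `e′`.
    Common-back : ∀ {i g k} → Common i → Common (i + g) → Common (k + g) → Common k
    Common-back {i} {g} {k} ci cj ck with period {i} {g} ci cj | ∈-pts⁻ e′ ck
    ... | h , eq | w , w<q , ew with ℕ.m≤n⇒∃[o]m+o≡n h≤w
      where
      open ℕ.≤-Reasoning
      h≤w : h ≤ w
      h≤w = index< (begin
        a′ + h * d′              ≤⟨ ℕ.+-monoˡ-≤ (h * d′) (ℕ.≤-trans left (ℕ.m≤m+n a₁ (k * d₁))) ⟩
        a₁ + k * d₁ + h * d′     ≡⟨ cong (λ u → a₁ + k * d₁ + u) (sym eq) ⟩
        a₁ + k * d₁ + g * d₁     ≡⟨ sym (pos a₁ k g d₁) ⟩
        a₁ + (k + g) * d₁        ≡⟨ ew ⟩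
        a′ + w * d′              ∎)
    ... | w′ , refl = subst (_∈ pts q e′) (ℕ.+-cancelʳ-≡ (h * d′) _ _ (begin
        a′ + w′ * d′ + h * d′    ≡⟨ sym (pos a′ w′ h d′) ⟩
        a′ + (w′ + h) * d′       ≡⟨ cong (λ u → a′ + u * d′) (ℕ.+-comm w′ h) ⟩
        a′ + (h + w′) * d′       ≡⟨ sym ew ⟩
        a₁ + (k + g) * d₁        ≡⟨ pos a₁ k g d₁ ⟩
        a₁ + k * d₁ + g * d₁     ≡⟨ cong (λ u → a₁ + k * d₁ + u) eq ⟩
        a₁ + k * d₁ + h * d′     ∎)) (∈-pts⁺ e′ (ℕ.≤-<-trans (ℕ.m≤n+m w′ h) w<q))
      where open Relation.Binary.PropositionalEquality.≡-Reasoning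

    -- To the right nothing is known about where `e′` ends, hence the further common point `l`.
    Common-forth : ∀ {i g k l} → Common i → Common (i + g) → Common k → Common l → k + g ≤ l → Common (k + g)
    Common-forth {i} {g} {k} {l} ci cj ck cl le with period {i} {g} ci cj | ∈-pts⁻ e′ ck | ∈-pts⁻ e′ cl
    ... | h , eq | w , w<q , ew | z , z<q , ez = subst (_∈ pts q e′) (sym value) (∈-pts⁺ e′ w+h<q)
      where
      value : a₁ + (k + g) * d₁ ≡ a′ + (w + h) * d′
      value = trans (pos a₁ k g d₁) (trans (cong₂ _+_ ew eq) (sym (pos a′ w h d′)))
      w+h<q : w + h < q
      w+h<q = ℕ.≤-<-trans (index< (subst (_≤ a′ + z * d′) value
        (ℕ.≤-trans (ℕ.+-monoʳ-≤ a₁ (ℕ.*-monoˡ-≤ d₁ le)) (ℕ.≤-reflexive ez)))) z<q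

    private
      Common? : ∀ x → Dec (x ∈ pts q e′)
      Common? = _∈? pts q e′

      no-short-gap : ∀ {R} → (∀ i → i < R → ¬ Common i) → ∀ {i g} → Common i → Common (i + suc g) → suc g ≤ R → ⊥
      no-short-gap {R} none {i} {g} ci cj g≤R = <-rec (λ k → ¬ Common k) step i ci
        where
        step : ∀ k → (∀ {j} → j < k → ¬ Common j) → ¬ Common k
        step k rec ck with ℕ.m≤n⇒∃[o]m+o≡n (ℕ.≤-trans g≤R (ℕ.≮⇒≥ (λ k<R → none k k<R ck)))
        ... | k′ , refl = rec (s≤s (ℕ.m≤n+m k′ g)) (Common-back {i} {suc g} {k′} ci cj (subst Common (ℕ.+-comm (suc g) k′) ck))

    module _ (r : ℕ) (3≤r : 3 ≤ r) (r<q : r < q) (many : 2 * q ≤ r * common q e₁ e′) where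

      -- If the first R vertices are not common, every gap exceeds R, since a shorter gap could be
      -- used to shift a common point back into this run. Then C common points require (R + 1) C ≤
      -- q, while there are at least 2q/r of them; with r ≤ R + 2 this leaves R = 0, contrary to r ≥
      -- 3.
      hit-run : ∀ R → r ≤ 2 + R → (∀ i → i < R → ¬ Common i) → ⊥
      hit-run R r≤ none with sparse-count Common? (λ i → a₁ + i * d₁) q (suc R) gap
        where
        gap : ∀ i j → i < j → j < q → Common i → Common j → i + suc R ≤ j
        gap i j i<j _ ci cj with ℕ.m≤n⇒∃[o]m+o≡n i<j
        ... | g , refl with suc g ℕ.≤? R
        ... | yes g≤R = ⊥-elim (no-short-gap none {i} {g} ci (subst Common (sym (ℕ.+-suc i g)) cj) g≤R)
        ... | no g≰R = ℕ.≤-trans (ℕ.+-monoʳ-≤ i (ℕ.≰⇒> g≰R)) (ℕ.≤-reflexive (ℕ.+-suc i g))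
      ... | inj₁ e = ℕ.<⇒≱ (ℕ.<-≤-trans (ℕ.≤-<-trans z≤n r<q) (ℕ.m≤m+n q _))
                       (ℕ.≤-trans many (ℕ.≤-reflexive (trans (cong (r *_) e) (ℕ.*-zeroʳ r))))
      ... | inj₂ (c , i , e , i<q , ci , le) = ℕ.<⇒≱ R≥1 (ℕ.+-cancelˡ-≤ (2 + R) R 0 (begin
        2 + R + R     ≡⟨ double R ⟩
        2 * suc R     ≤⟨ ℕ.*-cancelʳ-≤ (2 * suc R) (2 + R) (suc c) bound ⟩
        2 + R         ≡⟨ sym (ℕ.+-identityʳ _) ⟩
        2 + R + 0     ∎))
        where
        open ℕ.≤-Reasoning
        R≥1 : 1 ≤ R
        R≥1 = ℕ.+-cancelˡ-≤ 2 1 R (ℕ.≤-trans 3≤r r≤)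
        double : ∀ R → 2 + R + R ≡ 2 * suc R
        double = ℕ-solve-∀
        R≤i : R ≤ i
        R≤i = ℕ.≮⇒≥ λ i<R → none i i<R ci
        bound : 2 * suc R * suc c ≤ (2 + R) * suc c
        bound = begin
          2 * suc R * suc c               ≡⟨ rearrange R c ⟩
          2 * suc (R + c * suc R)         ≤⟨ ℕ.*-monoʳ-≤ 2 (s≤s (ℕ.+-monoˡ-≤ (c * suc R) R≤i)) ⟩
          2 * suc (i + c * suc R)         ≤⟨ ℕ.*-monoʳ-≤ 2 le ⟩
          2 * q                           ≤⟨ many ⟩
          r * common q e₁ e′              ≡⟨ cong (r *_) e ⟩
          r * suc c                       ≤⟨ ℕ.*-monoˡ-≤ (suc c) r≤ ⟩
          (2 + R) * suc c                 ∎
          where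
          rearrange : ∀ R c → 2 * suc R * suc c ≡ 2 * suc (R + c * suc R)
          rearrange = ℕ-solve-∀

      -- All gaps are at least max(w + 1, r − w), and w is the only index below r that may be common.
      hit-run-except : ∀ w → suc w ≤ r → (∀ i → i < r → Common i → i ≡ w) → ⊥
      hit-run-except w w<r only with Common? (a₁ + w * d₁)
      ... | no ¬cw = hit-run r (ℕ.m≤n+m r 2) λ i i<r ci → ¬cw (subst Common (only i i<r ci) ci)
      ... | yes cw = finish (sparse-count Common? (λ i → a₁ + i * d₁) q (suc w ℕ.⊔ (r ∸ w)) gap)
        where
        open ℕ.≤-Reasoning
        w≤ : ∀ i → Common i → w ≤ i
        w≤ i ci = ℕ.≮⇒≥ λ i<w → ℕ.<⇒≢ i<w (only i (ℕ.<-trans i<w w<r) ci)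
        gap : ∀ i j → i < j → j < q → Common i → Common j → i + (suc w ℕ.⊔ (r ∸ w)) ≤ j
        gap i j i<j _ ci cj with ℕ.m≤n⇒∃[o]m+o≡n i<j
        ... | g , refl = ℕ.≤-trans (ℕ.+-monoʳ-≤ i (ℕ.⊔-lub big₁ big₂)) (ℕ.≤-reflexive (ℕ.+-suc i g))
          where
          cj′ : Common (i + suc g)
          cj′ = subst Common (sym (ℕ.+-suc i g)) cj
          big₁ : suc w ≤ suc g
          big₁ = s≤s (ℕ.≮⇒≥ λ g<w → case ℕ.m≤n⇒∃[o]m+o≡n g<w of λ { (k , refl) →
            ℕ.<⇒≢ (s≤s (ℕ.m≤n+m k g)) (only k (ℕ.<-trans (s≤s (ℕ.m≤n+m k g)) w<r)
              (Common-back {i} {suc g} {k} ci cj′ (subst Common (ℕ.+-comm (suc g) k) cw))) })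
          big₂ : r ∸ w ≤ suc g
          big₂ = ℕ.≮⇒≥ λ g< → ℕ.<⇒≢ (ℕ.m<m+n w {suc g} (s≤s z≤n)) (sym (only (w + suc g)
            (ℕ.<-≤-trans (ℕ.+-monoʳ-< w g<) (ℕ.≤-reflexive (ℕ.m+[n∸m]≡n (ℕ.<⇒≤ w<r))))
            (Common-forth {i} {suc g} {w} ci cj′ cw cj′ (ℕ.+-monoˡ-≤ (suc g) (w≤ i ci)))))
        finish : _ → ⊥
        finish (inj₁ e) = ℕ.<⇒≱ (ℕ.<-≤-trans (ℕ.≤-<-trans z≤n r<q) (ℕ.m≤m+n q _))
                            (ℕ.≤-trans many (ℕ.≤-reflexive (trans (cong (r *_) e) (ℕ.*-zeroʳ r))))
        finish (inj₂ (zero , i , e , _ , _ , _)) = ℕ.<⇒≱ r<q (ℕ.≤-trans (ℕ.m≤m+n q (1 * q)) (ℕ.≤-trans many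
                            (ℕ.≤-reflexive (trans (cong (r *_) e) (ℕ.*-identityʳ r)))))
        finish (inj₂ (suc c , i , e , _ , ci , le)) = ℕ.<⇒≱ small (ℕ.≤-trans many (ℕ.≤-reflexive (cong (r *_) e)))
          where
          G = suc w ℕ.⊔ (r ∸ w)
          w+G : r ≤ w + G
          w+G = ℕ.≤-trans (ℕ.≤-reflexive (sym (ℕ.m+[n∸m]≡n (ℕ.<⇒≤ w<r)))) (ℕ.+-monoʳ-≤ w (ℕ.m≤n⊔m (suc w) (r ∸ w)))
          -- The two lower bounds on the gap add up to (w + 1) + (r - w).
          2G : suc r ≤ 2 * G
          2G = begin
            suc r                ≡⟨ cong suc (sym (ℕ.m+[n∸m]≡n (ℕ.<⇒≤ w<r))) ⟩
            suc w + (r ∸ w)      ≤⟨ ℕ.+-mono-≤ (ℕ.m≤m⊔n (suc w) (r ∸ w)) (ℕ.≤-trans (ℕ.m≤n⊔m (suc w) (r ∸ w)) (ℕ.m≤m+n G 0)) ⟩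
            2 * G                ∎
          rearrange₁ : ∀ r c → r * suc (suc c) + c ≡ 2 * r + c * suc r
          rearrange₁ = ℕ-solve-∀
          rearrange₂ : ∀ w G c → 2 * (w + G) + c * (2 * G) ≡ 2 * (w + suc c * G)
          rearrange₂ = ℕ-solve-∀
          small : r * suc (suc c) < 2 * q
          small = begin-strict
            r * suc (suc c)                ≤⟨ ℕ.m≤m+n _ c ⟩
            r * suc (suc c) + c            ≡⟨ rearrange₁ r c ⟩
            2 * r + c * suc r              ≤⟨ ℕ.+-mono-≤ (ℕ.*-monoʳ-≤ 2 w+G) (ℕ.*-monoʳ-≤ c 2G) ⟩
            2 * (w + G) + c * (2 * G)      ≡⟨ rearrange₂ w G c ⟩
            2 * (w + suc c * G)            ≤⟨ ℕ.*-monoʳ-≤ 2 (ℕ.+-monoˡ-≤ (suc c * G) (w≤ i ci)) ⟩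
            2 * (i + suc c * G)            <⟨ ℕ.*-monoʳ-< 2 le ⟩
            2 * q                          ∎

  leftmost : ∀ (es : List Pts) {e} → e ∈ es → ∃ λ e₁ → e₁ ∈ es × (∀ {e′} → e′ ∈ es → proj₁ e′ ≤ proj₁ e₁)
  leftmost (e ∷ []) _ = e , here refl , λ { (here refl) → ℕ.≤-refl }
  leftmost (e ∷ es@(_ ∷ _)) _ with leftmost es (here refl)
  ... | e₁ , e₁∈ , max with ℕ.≤-total (proj₁ e) (proj₁ e₁)
  ... | inj₁ le = e₁ , there e₁∈ , λ { (here refl) → le ; (there p) → max p }
  ... | inj₂ ge = e , here refl , λ { (here refl) → ℕ.≤-refl ; (there p) → ℕ.≤-trans (max p) ge }

  empty? : (es : List Pts) → (∀ {e} → e ∉ es) ⊎ ∃ λ e → e ∈ es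
  empty? []       = inj₁ λ ()
  empty? (e ∷ es) = inj₂ (e , here refl)

  record Hitting (q : ℕ) (es : List Pts) (size : ℕ) : Set where
    field
      blues   : List ℕ
      covered : ∀ {x} → x ∈ blues → ∃ λ e → e ∈ es × x ∈ pts q e
      small   : length blues ≤ size
      hits    : ∀ {e} → e ∈ es → ∃ λ x → x ∈ pts q e × x ∈ blues

  pts-mono : ∀ {k l x} e → k ≤ l → x ∈ pts k e → x ∈ pts l e
  pts-mono e k≤l p with ∈-pts⁻ e p
  ... | i , i<k , refl = ∈-pts⁺ e (ℕ.<-≤-trans i<k k≤l)

  -- The hitting set consists of the first vertices of the edge that starts furthest right.
  module _ (q r : ℕ) (3≤r : 3 ≤ r) (r<q : r < q) (es : List Pts)
    (d≥1 : ∀ {e} → e ∈ es → 1 ≤ proj₂ e)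
    (many : ∀ {e e′} → e ∈ es → e′ ∈ es → 2 * q ≤ r * common q e e′) where

    abstract

      hitting : Hitting q es (r ∸ 2)
      hitting with empty? es
      ... | inj₁ none = record { blues = [] ; covered = λ () ; small = z≤n ; hits = λ p → ⊥-elim (none p) }
      ... | inj₂ (e₀ , e₀∈) with leftmost es e₀∈
      ... | e₁ , e₁∈ , max = record
        { blues   = pts (r ∸ 2) e₁
        ; covered = λ p → e₁ , e₁∈ , pts-mono e₁ (ℕ.≤-trans (ℕ.m∸n≤m r 2) (ℕ.<⇒≤ r<q)) p
        ; small   = ℕ.≤-reflexive (length-pts (r ∸ 2) e₁)
        ; hits    = hits
        }
        where
        hits : ∀ {e} → e ∈ es → ∃ λ x → x ∈ pts q e × x ∈ pts (r ∸ 2) e₁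
        hits {e} e∈ with Any.any? (_∈? pts q e) (pts (r ∸ 2) e₁)
        ... | yes p = let x , a , b = find p in x , b , a
        ... | no ¬p = ⊥-elim (hit-run q e₁ e (d≥1 e₁∈) (d≥1 e∈) (max e∈) r 3≤r r<q (many e₁∈ e∈) (r ∸ 2)
                        (ℕ.m≤n+m∸n r 2) λ i i< ci → ¬p (lose (∈-pts⁺ e₁ i<) ci))

      -- Serves when `w` must not become blue. Avoiding it costs one vertex more: if `w` is among
      -- the first r - 1 vertices, the first r without `w` are taken instead.
      hitting-avoiding : ∀ w → Σ (Hitting q es (r ∸ 1)) λ H → w ∉ Hitting.blues H
      hitting-avoiding w with empty? es
      ... | inj₁ none = record { blues = [] ; covered = λ () ; small = z≤n ; hits = λ p → ⊥-elim (none p) } , λ ()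
      ... | inj₂ (e₀ , e₀∈) with leftmost es e₀∈
      ... | e₁ , e₁∈ , max with w ∈? pts (r ∸ 1) e₁
      ... | no w∉ = record
        { blues   = pts (r ∸ 1) e₁
        ; covered = λ p → e₁ , e₁∈ , pts-mono e₁ (ℕ.≤-trans (ℕ.m∸n≤m r 1) (ℕ.<⇒≤ r<q)) p
        ; small   = ℕ.≤-reflexive (length-pts (r ∸ 1) e₁)
        ; hits    = hits
        } , w∉
        where
        hits : ∀ {e} → e ∈ es → ∃ λ x → x ∈ pts q e × x ∈ pts (r ∸ 1) e₁
        hits {e} e∈ with Any.any? (_∈? pts q e) (pts (r ∸ 1) e₁)
        ... | yes p = let x , a , b = find p in x , b , a
        ... | no ¬p = ⊥-elim (hit-run q e₁ e (d≥1 e₁∈) (d≥1 e∈) (max e∈) r 3≤r r<q (many e₁∈ e∈) (r ∸ 1)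
                        (ℕ.≤-trans (ℕ.m≤n+m∸n r 1) (ℕ.n≤1+n _)) λ i i< ci → ¬p (lose (∈-pts⁺ e₁ i<) ci))
      ... | yes w∈ = record
        { blues   = pts r e₁ ∖ [ w ]
        ; covered = λ p → e₁ , e₁∈ , pts-mono e₁ (ℕ.<⇒≤ r<q) (proj₁ (∈-∖⁻ {pts r e₁} {[ w ]} p))
        ; small   = ℕ.≤-pred (ℕ.≤-trans shorter (ℕ.≤-trans (ℕ.≤-reflexive (length-pts r e₁)) (ℕ.m≤n+m∸n r 1)))
        ; hits    = hits
        } , λ p → proj₂ (∈-∖⁻ {pts r e₁} {[ w ]} p) (here refl)
        where
        shorter : length (pts r e₁ ∖ [ w ]) < length (pts r e₁)
        shorter = length-∖-< (pts-mono e₁ (ℕ.m∸n≤m r 1) w∈) (here refl)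
        hits : ∀ {e} → e ∈ es → ∃ λ x → x ∈ pts q e × x ∈ pts r e₁ ∖ [ w ]
        hits {e} e∈ with Any.any? (_∈? pts q e) (pts r e₁ ∖ [ w ])
        ... | yes p = let x , a , b = find p in x , b , a
        ... | no ¬p with ∈-pts⁻ e₁ w∈
        ... | iw , iw<r , refl = ⊥-elim (hit-run-except q e₁ e (d≥1 e₁∈) (d≥1 e∈) (max e∈) r 3≤r r<q (many e₁∈ e∈) iw
                        (ℕ.≤-trans iw<r (ℕ.m∸n≤m r 1)) only)
          where
          only : ∀ i → i < r → Common q e₁ e (d≥1 e₁∈) (d≥1 e∈) (max e∈) i → i ≡ iw
          only i i<r ci with i ℕ.≟ iw
          ... | yes e≡ = e≡
          ... | no i≢ = ⊥-elim (¬p (lose (∈-∖⁺ (∈-pts⁺ e₁ i<r) λ { (here e≡) → i≢ (pts-injective (proj₁ e₁) (d≥1 e₁∈) e≡) }) ci))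

open HittingSets

-- Long and short edges, lines, and kills.

module Hypergraphs where

  Share : ℕ → Pts → Pts → Set
  Share q e e′ = ∃ λ x → ∃ λ y → (x ∈ pts q e × y ∈ pts q e) × (x ∈ pts q e′ × y ∈ pts q e′) × x ≢ y

  share? : ∀ q e e′ → Dec (Share q e e′)
  share? q e e′ = map′ to from
    (Any.any? (λ x → Any.any? (λ y → (x ∈? pts q e′ ×-dec y ∈? pts q e′) ×-dec ¬? (x ℕ.≟ y)) (pts q e)) (pts q e))
    where
    to : Any (λ x → Any (λ y → (x ∈ pts q e′ × y ∈ pts q e′) × x ≢ y) (pts q e)) (pts q e) → Share q e e′
    to p with find p
    ... | x , x∈ , p′ with find p′
    ... | y , y∈ , both , ne = x , y , (x∈ , y∈) , both , ne
    from : Share q e e′ → Any (λ x → Any (λ y → (x ∈ pts q e′ × y ∈ pts q e′) × x ≢ y) (pts q e)) (pts q e)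
    from (x , y , (x∈ , y∈) , both , ne) = lose x∈ (lose y∈ (both , ne))

  ¬share⇒meetsOnce : ∀ {q e e′} → ¬ Share q e e′ → MeetsOnce (pts q e) (pts q e′)
  ¬share⇒meetsOnce {q} {e} ¬s {x} {y} x∈ x∈′ y∈ y∈′ with x ℕ.≟ y
  ... | yes eq = eq
  ... | no ne  = ⊥-elim (¬s (x , y , (x∈ , y∈) , (x∈′ , y∈′) , ne))

  share-sym : ∀ {q e e′} → Share q e e′ → Share q e′ e
  share-sym (x , y , s , s′ , ne) = x , y , s′ , s , ne

  -- Lfam: the long edges; Sfam: the short edges all of whose vertices lie on long edges.
  record Hypergraph (q r : ℕ) : Set where
    field
      3≤r : 3 ≤ r
      r<q : r < q
      Lfam Sfam : List Pts
      V : List ℕ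
      long≥1  : ∀ {e} → e ∈ Lfam → 1 ≤ proj₂ e
      short≥1 : ∀ {f} → f ∈ Sfam → 1 ≤ proj₂ f
      long⊆V  : ∀ {e} → e ∈ Lfam → pts q e ⊆ V
      short⊆  : ∀ {f x} → f ∈ Sfam → x ∈ pts r f → ∃ λ e → e ∈ Lfam × x ∈ pts q e

  lineBound-≥ : ∀ {k B} → 1 ≤ k → B ≤ lineBound k B
  lineBound-≥ {suc k} {zero}  _ = z≤n
  lineBound-≥ {suc k} {suc B} _ = ℕ.≤-trans (ℕ.m≤m*n (suc B) (suc B)) (ℕ.≤-trans (ℕ.m≤m+n _ _) (ℕ.m≤m+n _ _))

  -- Heights of coordinates relative to a long edge: `bound₁` for progressions sharing two points
  -- with it, `bound₂` for progressions sharing two points with those. `depth` is the resulting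
  -- height for interpolation between any two such points.
  bound₁ bound₂ depth : ℕ → ℕ
  bound₁ q = lineBound q q
  bound₂ q = lineBound q (bound₁ q)
  depth q = detBound (bound₂ q)

  -- Exponents: the expected number of configurations with f free and N listed vertices is of order
  -- n^f p^N, and p^(cost q r) ≈ n^(-r).
  cost : ℕ → ℕ → ℕ
  cost q r = q * (r ∸ 1)

  -- No single step of the exploration adds more vertices than this.
  size : ℕ → ℕ → ℕ
  size q r = 4 * (r * q)

  module Geometry {q r : ℕ} (H : Hypergraph q r) where

    open Hypergraph H public

    Online : Pts → ℕ → Set
    Online = OnLine (bound₂ q)

    1≤q : 1 ≤ q
    1≤q = ℕ.≤-trans (s≤s z≤n) r<q

    1≤r : 1 ≤ r
    1≤r = ℕ.≤-trans (s≤s z≤n) 3≤r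

    2≤q : 2 ≤ q
    2≤q = ℕ.≤-trans (ℕ.≤-trans (s≤s (s≤s z≤n)) 3≤r) (ℕ.<⇒≤ r<q)

    online : ∀ {x} e → x ∈ pts q e → Online e x
    online e p = OnLine-mono (ℕ.≤-trans (lineBound-≥ 1≤q) (lineBound-≥ 1≤q)) (pts-onLine e 1≤q p)

    online-ext : ∀ {e x y z} f → y ∈ pts q f → z ∈ pts q f → y ≢ z →
      OnLine (bound₁ q) e y → OnLine (bound₁ q) e z → x ∈ pts q f → Online e x
    online-ext = pts-onLine-ext

    short⊆long : ∀ {x} f → x ∈ pts r f → x ∈ pts q f
    short⊆long f = pts-mono f (ℕ.<⇒≤ r<q)

    distinct : ∀ k e → 1 ≤ proj₂ e → 2 ≤ k → ∃ λ x → ∃ λ y → x ∈ pts k e × y ∈ pts k e × x ≢ y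
    distinct k e d≥1 2≤k = _ , _ , ∈-pts⁺ {i = 0} e (ℕ.<⇒≤ 2≤k) , ∈-pts⁺ {i = 1} e 2≤k ,
      λ eq → case pts-injective (proj₁ e) {i = 0} {j = 1} d≥1 eq of λ ()

    Parallel : Pts → List Pts
    Parallel e = filter (share? q e) Lfam

    abstract

      -- A single round of sharing is enough: a long edge that has two vertices on this list without
      -- sharing two with `e` is later seen to be explored already or to produce a kill.
      line : Pts → List ℕ
      line e = deduplicate ℕ._≟_ (concatMap (pts q) (Parallel e))

      line-unique : ∀ e → Unique (line e)
      line-unique e = DecUnique.deduplicate-! ℕ._≟_ (concatMap (pts q) (Parallel e))

      ∈-line⁻ : ∀ {e x} → x ∈ line e → ∃ λ e′ → (e′ ∈ Lfam × Share q e e′) × x ∈ pts q e′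
      ∈-line⁻ {e} p with find (Mem.∈-concatMap⁻ (pts q) {xs = Parallel e} (Mem.∈-deduplicate⁻ ℕ._≟_ _ p))
      ... | e′ , e′∈ , x∈ = e′ , Mem.∈-filter⁻ (share? q e) e′∈ , x∈

      ∈-line⁺ : ∀ {e e′ x} → e′ ∈ Lfam → Share q e e′ → x ∈ pts q e′ → x ∈ line e
      ∈-line⁺ {e} e′∈ s x∈ = Mem.∈-deduplicate⁺ ℕ._≟_ (Mem.∈-concatMap⁺ (pts q)
        (lose (Mem.∈-filter⁺ (share? q e) e′∈ s) x∈))

    share-refl : ∀ {e} → e ∈ Lfam → Share q e e
    share-refl {e} e∈ with distinct q e (long≥1 e∈) 2≤q
    ... | x , y , x∈ , y∈ , ne = x , y , (x∈ , y∈) , (x∈ , y∈) , ne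

    edge⊆line : ∀ {e} → e ∈ Lfam → pts q e ⊆ line e
    edge⊆line e∈ = ∈-line⁺ e∈ (share-refl e∈)

    line⊆V : ∀ {e} → line e ⊆ V
    line⊆V {e} p with ∈-line⁻ {e} p
    ... | e′ , (e′∈ , _) , x∈ = long⊆V e′∈ x∈

    line-onLine : ∀ {e x} → x ∈ line e → OnLine (bound₁ q) e x
    line-onLine {e} p with ∈-line⁻ {e} p
    ... | e′ , (_ , y , z , (y∈ , z∈) , (y∈′ , z∈′) , ne) , x∈ =
      pts-onLine-ext e′ y∈′ z∈′ ne (pts-onLine e 1≤q y∈) (pts-onLine e 1≤q z∈) x∈

    line-online : ∀ {e x} → x ∈ line e → Online e x
    line-online {e} p = OnLine-mono (lineBound-≥ 1≤q) (line-onLine {e} p)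

    record StartKill : Set where
      constructor startKill
      field
        {xs}  : List ℕ
        gen   : Gen (depth q) [] 2 xs
        new   : New V [] xs
        light : 2 * cost q r < r * length xs
        short : length xs ≤ size q r

    record Kill (A : List ℕ) : Set where
      constructor kill
      field
        {f}   : ℕ
        {xs}  : List ℕ
        gen   : Gen (depth q) A f xs
        new   : New V A xs
        light : (f + 2) * cost q r < r * (length xs + q)
        short : length xs ≤ size q r

    2q≤size : 2 * q ≤ size q r
    2q≤size = ℕ.*-mono-≤ {2} {4} (s≤s (s≤s z≤n)) (ℕ.m≤n*m q r {{ℕ.>-nonZero 1≤r}})

    module Light (nsk : ¬ StartKill) where

      line-light : ∀ e → r * length (line e) ≤ 2 * cost q r
      line-light e with ℕ.<-≤-connex (2 * cost q r) (r * length (line e))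
      ... | inj₂ le = le
      -- The list is cut to 2q vertices to respect `size`. It stays light, as 2q(r - 1) < 2qr.
      ... | inj₁ heavy = ⊥-elim (nsk (startKill (Gen-take (2 * q) (Gen-line₂ e (line-unique e) line-online))
          (mkNew (Unique.take⁺ (2 * q) (line-unique e)) (λ _ ()) (λ p → line⊆V {e} (∈-take p))) light
          (ℕ.≤-trans (ℕ.≤-reflexive (List.length-take (2 * q) (line e))) (ℕ.≤-trans (ℕ.m⊓n≤m _ _) 2q≤size))))
        where
        ∈-take : ∀ {x k} {xs : List ℕ} → x ∈ take k xs → x ∈ xs
        ∈-take {k = suc k} {_ ∷ _} (here eq) = here eq
        ∈-take {k = suc k} {_ ∷ _} (there p) = there (∈-take {k = k} p)
        r≥1 = 1≤r
        full : ∀ q r → 1 ≤ q → 1 ≤ r → 2 * (q * (r ∸ 1)) < r * (2 * q)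
        full (suc q) (suc r) _ _ = ℕ.≤-trans (ℕ.m≤m+n _ (suc (q + q))) (ℕ.≤-reflexive (eq q r))
          where
          eq : ∀ q r → suc (2 * (suc q * r)) + suc (q + q) ≡ suc r * (2 * suc q)
          eq = ℕ-solve-∀
        light : 2 * cost q r < r * length (take (2 * q) (line e))
        light with ℕ.≤-total (length (line e)) (2 * q)
        ... | inj₁ le = ℕ.<-≤-trans heavy (ℕ.≤-reflexive (cong (r *_) (sym (trans (List.length-take (2 * q) (line e)) (ℕ.m≥n⇒m⊓n≡n le)))))
        ... | inj₂ ge = ℕ.<-≤-trans (full q r 1≤q 1≤r) (ℕ.≤-reflexive (cong (r *_) (sym (trans (List.length-take (2 * q) (line e)) (ℕ.m≤n⇒m⊓n≡m ge)))))

      length-line : ∀ e → length (line e) ≤ 2 * q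
      length-line e = ℕ.*-cancelˡ-≤ r {{ℕ.>-nonZero 1≤r}} (ℕ.≤-trans (line-light e)
        (ℕ.≤-trans (ℕ.*-monoʳ-≤ 2 (ℕ.*-monoʳ-≤ q (ℕ.m∸n≤m r 1))) (ℕ.≤-reflexive (eq q r))))
        where
        eq : ∀ q r → 2 * (q * r) ≡ r * (2 * q)
        eq = ℕ-solve-∀

      -- The union of the two edges lies in the line of `e`, so it has at most 2q(r - 1)/r vertices,
      -- which is 2q/r short of 2q.
      parallel-common : ∀ {e e₁ e₂} → e₁ ∈ Parallel e → e₂ ∈ Parallel e → 2 * q ≤ r * common q e₁ e₂
      parallel-common {e} {e₁} {e₂} e₁∈ e₂∈ with Mem.∈-filter⁻ (share? q e) e₁∈ | Mem.∈-filter⁻ (share? q e) e₂∈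
      ... | e₁∈L , s₁ | e₂∈L , s₂ = solve r 1≤r (length-∖-filter (pts q e₁) (pts q e₂)) (length-pts q e₁) union
        where
        K = pts q e₁ ∖ pts q e₂ ++ pts q e₂
        K-unique : Unique K
        K-unique = Unique.++⁺ (∖-unique (pts-unique q e₁ (long≥1 e₁∈L))) (pts-unique q e₂ (long≥1 e₂∈L))
          λ (p , p′) → proj₂ (∈-∖⁻ {pts q e₁} {pts q e₂} p) p′
        K⊆ : K ⊆ line e
        K⊆ p with Mem.∈-++⁻ (pts q e₁ ∖ pts q e₂) p
        ... | inj₁ a = ∈-line⁺ e₁∈L s₁ (proj₁ (∈-∖⁻ {pts q e₁} {pts q e₂} a))
        ... | inj₂ a = ∈-line⁺ e₂∈L s₂ a
        union : r * (length (pts q e₁ ∖ pts q e₂) + q) ≤ 2 * (q * (r ∸ 1))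
        union = begin
          r * (length (pts q e₁ ∖ pts q e₂) + q)                    ≡⟨ cong (λ m → r * (length (pts q e₁ ∖ pts q e₂) + m)) (sym (length-pts q e₂)) ⟩
          r * (length (pts q e₁ ∖ pts q e₂) + length (pts q e₂))    ≡⟨ cong (r *_) (sym (List.length-++ (pts q e₁ ∖ pts q e₂))) ⟩
          r * length K                                              ≤⟨ ℕ.*-monoʳ-≤ r (unique-⊆⇒length≤ K-unique K⊆) ⟩
          r * length (line e)                                       ≤⟨ line-light e ⟩
          2 * (q * (r ∸ 1))                                         ∎
          where open ℕ.≤-Reasoning
        solve : ∀ r → 1 ≤ r → ∀ {x y m} → y + x ≡ m → m ≡ q → r * (y + q) ≤ 2 * (q * (r ∸ 1)) → 2 * q ≤ r * x
        solve (suc r) _ {x} {y} refl refl le = ℕ.+-cancelˡ-≤ (suc r * (y + (y + x))) _ _ (begin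
          suc r * (y + (y + x)) + 2 * (y + x)              ≤⟨ ℕ.+-monoˡ-≤ (2 * (y + x)) le ⟩
          2 * ((y + x) * r) + 2 * (y + x)                  ≡⟨ eq r x y ⟩
          suc r * (y + (y + x)) + suc r * x                ∎)
          where
          open ℕ.≤-Reasoning
          eq : ∀ r x y → 2 * ((y + x) * r) + 2 * (y + x) ≡ suc r * (y + (y + x)) + suc r * x
          eq = ℕ-solve-∀

open Hypergraphs

-- Partial colourings, and the step adding a line through an old vertex.

module Colourings where

  length-∖-≥ : ∀ {xs K} → Unique xs → length xs ≤ length K + length (xs ∖ K)
  length-∖-≥ {xs} {K} u = begin
    length xs                                        ≡⟨ sym (length-∖-filter xs K) ⟩
    length (xs ∖ K) + length (filter (_∈? K) xs)     ≤⟨ ℕ.+-monoʳ-≤ (length (xs ∖ K)) (unique-⊆⇒length≤ (Unique.filter⁺ (_∈? K) u) (λ p → proj₂ (Mem.∈-filter⁻ (_∈? K) {xs = xs} p))) ⟩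
    length (xs ∖ K) + length K                       ≡⟨ ℕ.+-comm (length (xs ∖ K)) _ ⟩
    length K + length (xs ∖ K)                       ∎
    where open ℕ.≤-Reasoning

  ⊈⇒∃ : ∀ {xs K} → ¬ (xs ⊆ K) → ∃ λ x → x ∈ xs × x ∉ K
  ⊈⇒∃ {xs} {K} h with ⊆⊎∃∉ xs K
  ... | inj₁ s = ⊥-elim (h s)
  ... | inj₂ p = p

  one∈ : ∀ {xs : List ℕ} → 1 ≤ length xs → ∃ λ x → x ∈ xs
  one∈ {x ∷ xs} _ = x , here refl

  two∈ : ∀ {xs : List ℕ} → Unique xs → 2 ≤ length xs → ∃ λ x → ∃ λ y → x ∈ xs × y ∈ xs × x ≢ y
  two∈ {x ∷ y ∷ xs} ((ne ∷ _) ∷ _) _ = x , y , here refl , there (here refl) , ne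
  two∈ {_ ∷ []} _ (s≤s ())

  -- Adding F q clears the truncated subtraction in `cost`; the light inequalities are checked in
  -- this form.
  cost-+ : ∀ F {q r} → 1 ≤ r → F * cost q r + F * q ≡ F * (q * r)
  cost-+ F {q} {suc r} _ = eq F q r
    where
    eq : ∀ F q r → F * (q * r) + F * q ≡ F * (q * suc r)
    eq = ℕ-solve-∀

  cost-< : ∀ F {q r X} → 1 ≤ r → F * (q * r) < X + F * q → F * cost q r < X
  cost-< F {q} {r} {X} 1≤r lt = ℕ.+-cancelʳ-< (F * q) _ _ (subst (_< X + F * q) (sym (cost-+ F 1≤r)) lt)

  module Colouring {q r : ℕ} (H : Hypergraph q r) where

    open Geometry H public

    -- `closed` restores linearity relative to `A`: a long edge not contained in `A` meets it at
    -- most once. Blue is confined to `A`, so the conditions on a larger set concern only the edges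
    -- that the new vertices complete or make blue.
    record State (A β : List ℕ) : Set where
      field
        closed : ∀ {e x y} → e ∈ Lfam → x ∈ pts q e → y ∈ pts q e → x ≢ y → x ∈ A → y ∈ A → pts q e ⊆ A
        hit    : ∀ {e} → e ∈ Lfam → pts q e ⊆ A → ∃ λ x → x ∈ pts q e × x ∈ β
        β⊆A    : β ⊆ A
        noBlue : ∀ {f} → f ∈ Sfam → ¬ (pts r f ⊆ β)

      meetsOnce : ∀ {e z} → e ∈ Lfam → z ∈ pts q e → z ∉ A → MeetsOnce (pts q e) A
      meetsOnce e∈ z∈ z∉ {x} {y} x∈ x∈A y∈ y∈A with x ℕ.≟ y
      ... | yes eq = eq
      ... | no ne  = ⊥-elim (z∉ (closed e∈ x∈ y∈ ne x∈A y∈A z∈))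

    length-edge-∖ : ∀ {e A} → e ∈ Lfam → MeetsOnce (pts q e) A → q ≤ suc (length (pts q e ∖ A))
    length-edge-∖ {e} {A} e∈ once = subst (_≤ suc (length (pts q e ∖ A))) (length-pts q e)
      (length-∖-meetsOnce (pts-unique q e (long≥1 e∈)) once)

    length-∖-pts : ∀ e A → length (pts q e ∖ A) ≤ q
    length-∖-pts e A = ℕ.≤-trans (length-∖-≤ (pts q e) A) (ℕ.≤-reflexive (length-pts q e))

    q≤rq : q ≤ r * q
    q≤rq = ℕ.m≤n*m q r {{ℕ.>-nonZero 1≤r}}

    q≤size : q ≤ size q r
    q≤size = ℕ.≤-trans q≤rq (ℕ.m≤m+n _ _)

    new-edge : ∀ {e A} → e ∈ Lfam → New V A (pts q e ∖ A)
    new-edge {e} e∈ = New-∖ (pts-unique q e (long≥1 e∈)) (long⊆V e∈)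

    private
      light₀ : ∀ {N} → q ≤ suc N → 2 * cost q r < r * (N + q)
      light₀ {N} le = cost-< 2 {q} {r} 1≤r (begin-strict
        2 * (q * r)                  ≡⟨ eq₁ q r ⟩
        r * q + r * q                ≤⟨ ℕ.+-monoˡ-≤ (r * q) (ℕ.*-monoʳ-≤ r le) ⟩
        r * suc N + r * q            ≡⟨ eq₂ r N q ⟩
        r * (N + q) + r              <⟨ ℕ.+-monoʳ-< (r * (N + q)) (ℕ.<-≤-trans r<q (ℕ.m≤m+n q _)) ⟩
        r * (N + q) + 2 * q          ∎)
        where
        open ℕ.≤-Reasoning
        eq₁ : ∀ q r → 2 * (q * r) ≡ r * q + r * q
        eq₁ = ℕ-solve-∀
        eq₂ : ∀ r N q → r * suc N + r * q ≡ r * (N + q) + r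
        eq₂ = ℕ-solve-∀

    -- Two determined points fix the line of `e`, so its q - 1 or more new vertices need no free
    -- choice. Together with the start there are 2 free vertices against at least 2q - 1 listed
    -- ones, which is light because r < 2q.
    kill-determined : ∀ {A e w c} → e ∈ Lfam → MeetsOnce (pts q e) A →
      w ∈ spanⁿ 2 (depth q) A → c ∈ spanⁿ 2 (depth q) A → w ≢ c → Online e w → Online e c → Kill A
    kill-determined {A} {e} e∈ once w∈ c∈ ne ow oc =
      kill {xs = pts q e ∖ A} (Gen-line₀ e w∈ c∈ ne ow oc λ p → online e (proj₁ (∈-∖⁻ {pts q e} {A} p)))
        (new-edge e∈) (light₀ (length-edge-∖ e∈ once)) (ℕ.≤-trans (length-∖-pts e A) q≤size)

    module _ {A β : List ℕ} (S : State A β) where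

      open State S

      -- `es` may leave out parallel edges that old blue vertices hit already. The last hypothesis
      -- concerns only short edges containing a newly blue vertex; the remaining ones are covered by
      -- the old state.
      addLine : ∀ {e xs es size} → (∀ {x} → x ∈ xs → x ∉ A) → line e ⊆ xs ++ A →
        (∀ {e′ x y} → e′ ∈ Lfam → x ∈ pts q e′ → y ∈ pts q e′ → x ≢ y → x ∈ xs ++ A → y ∈ xs ++ A →
          pts q e′ ⊆ A ⊎ Share q e e′) →
        (Z : Hitting q es size) → (∀ {e′} → e′ ∈ es → e′ ∈ Parallel e) →
        (∀ {e′} → e′ ∈ Parallel e → e′ ∈ es ⊎ ∃ λ x → x ∈ pts q e′ × x ∈ β) →
        (∀ {f c} → f ∈ Sfam → pts r f ⊆ Hitting.blues Z ++ β → c ∈ pts r f → c ∈ Hitting.blues Z → ⊥) →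
        State (xs ++ A) (Hitting.blues Z ++ β)
      addLine {e} {xs} {es} fresh line⊆ two Z es⊆ es⊇ nb = record
        { closed = λ e′∈ x∈ y∈ ne x∈′ y∈′ → case two e′∈ x∈ y∈ ne x∈′ y∈′ of λ
            { (inj₁ s) p → Mem.∈-++⁺ʳ xs (s p)
            ; (inj₂ s) p → line⊆ (∈-line⁺ e′∈ s p) }
        ; hit = hit′
        ; β⊆A = λ p → [ (λ b → blue⊆ b) , (λ b → Mem.∈-++⁺ʳ xs (β⊆A b)) ]′ (Mem.∈-++⁻ blues p)
        ; noBlue = λ {f} f∈ all → case Any.any? (_∈? blues) (pts r f) of λ
            { (yes p) → let c , c∈ , c∈b = find p in nb f∈ all c∈ c∈b
            ; (no ¬p) → noBlue f∈ λ x∈ → [ (λ b → ⊥-elim (¬p (lose x∈ b))) , id ]′ (Mem.∈-++⁻ blues (all x∈)) }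
        }
        where
        open Hitting Z
        blue⊆ : ∀ {x} → x ∈ blues → x ∈ xs ++ A
        blue⊆ b with covered b
        ... | e′ , e′∈ , x∈ with Mem.∈-filter⁻ (share? q e) (es⊆ e′∈)
        ... | e′∈L , s = line⊆ (∈-line⁺ e′∈L s x∈)
        hit′ : ∀ {e′} → e′ ∈ Lfam → pts q e′ ⊆ xs ++ A → ∃ λ x → x ∈ pts q e′ × x ∈ blues ++ β
        hit′ {e′} e′∈ sub with distinct q e′ (long≥1 e′∈) 2≤q
        ... | x , y , x∈ , y∈ , ne with two e′∈ x∈ y∈ ne (sub x∈) (sub y∈)
        ... | inj₁ s = let z , z∈ , z∈β = hit e′∈ s in z , z∈ , Mem.∈-++⁺ʳ blues z∈β
        ... | inj₂ s with es⊇ (Mem.∈-filter⁺ (share? q e) e′∈ s)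
        ... | inj₁ m = let z , z∈ , z∈b = hits m in z , z∈ , Mem.∈-++⁺ˡ z∈b
        ... | inj₂ (z , z∈ , z∈β) = z , z∈ , Mem.∈-++⁺ʳ blues z∈β

    record Extension (A : List ℕ) (f : ℕ) : Set where
      field
        xs     : List ℕ
        β      : List ℕ
        gen    : Gen (depth q) A f xs
        new    : New V A xs
        light  : f * cost q r < r * length xs
        short  : length xs ≤ size q r
        state  : State (xs ++ A) β

    module Steps (nsk : ¬ StartKill) where

      open Light nsk public

      -- This is where r < q enters: r(q - 1) exceeds q(r - 1) by q - r. In the same way `light₂`
      -- has an excess of 3(q - r).
      light₁ : ∀ {N} → q ≤ suc N → 1 * cost q r < r * N
      light₁ {N} le = cost-< 1 {q} {r} 1≤r (begin-strict
        1 * (q * r)        ≡⟨ eq₁ q r ⟩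
        r * q              ≤⟨ ℕ.*-monoʳ-≤ r le ⟩
        r * suc N          ≡⟨ eq₂ r N ⟩
        r * N + r          <⟨ ℕ.+-monoʳ-< (r * N) (ℕ.<-≤-trans r<q (ℕ.m≤m+n q _)) ⟩
        r * N + 1 * q      ∎)
        where
        open ℕ.≤-Reasoning
        eq₁ : ∀ q r → 1 * (q * r) ≡ r * q
        eq₁ = ℕ-solve-∀
        eq₂ : ∀ r N → r * suc N ≡ r * N + r
        eq₂ = ℕ-solve-∀

      light₂ : ∀ {M N} → q ≤ 1 + M → q ≤ 2 + N → (1 + 2) * cost q r < r * ((M + N) + q)
      light₂ {M} {N} le le′ = cost-< 3 {q} {r} 1≤r (begin-strict
        3 * (q * r)                       ≡⟨ eq₁ q r ⟩
        r * (q + q + q)                   ≤⟨ ℕ.*-monoʳ-≤ r (ℕ.+-monoˡ-≤ q (ℕ.+-mono-≤ le le′)) ⟩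
        r * (1 + M + (2 + N) + q)         ≡⟨ eq₂ r M N q ⟩
        r * ((M + N) + q) + 3 * r         <⟨ ℕ.+-monoʳ-< (r * ((M + N) + q)) (ℕ.*-monoʳ-< 3 r<q) ⟩
        r * ((M + N) + q) + 3 * q         ∎)
        where
        open ℕ.≤-Reasoning
        eq₁ : ∀ q r → 3 * (q * r) ≡ r * (q + q + q)
        eq₁ = ℕ-solve-∀
        eq₂ : ∀ r M N q → r * (1 + M + (2 + N) + q) ≡ r * ((M + N) + q) + 3 * r
        eq₂ = ℕ-solve-∀

      short-outside : ∀ {f} K {m} → f ∈ Sfam → length K ≤ r ∸ m → m ≤ r → m ≤ length (pts r f ∖ K)
      short-outside {f} K {m} f∈ le m≤r = ℕ.+-cancelˡ-≤ (r ∸ m) _ _ (begin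
        r ∸ m + m                              ≡⟨ ℕ.m∸n+n≡m m≤r ⟩
        r                                      ≡⟨ sym (length-pts r f) ⟩
        length (pts r f)                       ≤⟨ length-∖-≥ (pts-unique r f (short≥1 f∈)) ⟩
        length K + length (pts r f ∖ K)        ≤⟨ ℕ.+-monoˡ-≤ _ le ⟩
        r ∸ m + length (pts r f ∖ K)           ∎)
        where open ℕ.≤-Reasoning

      short-determined : ∀ {f A x y c} → f ∈ Sfam → x ∈ pts r f → y ∈ pts r f → x ≢ y → x ∈ A → y ∈ A →
        c ∈ pts r f → c ∈ spanⁿ 1 (depth q) A
      short-determined {f} f∈ x∈ y∈ ne x∈A y∈A c∈ = determined {h = 0} {e = f} x∈A y∈A ne
        (online f (short⊆long f x∈)) (online f (short⊆long f y∈)) (online f (short⊆long f c∈))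

      two-outside-or-two-inside : ∀ {f} → f ∈ Sfam → ∀ K → 2 ≤ length (pts r f ∖ K) ⊎
        ∃ λ u → ∃ λ v → u ∈ pts r f × v ∈ pts r f × u ∈ K × v ∈ K × u ≢ v
      two-outside-or-two-inside {f} f∈ K with 2 ℕ.≤? length (pts r f ∖ K)
      ... | yes two = inj₁ two
      ... | no ¬two with two∈ (Unique.filter⁺ (_∈? K) (pts-unique r f (short≥1 f∈))) inside
        where
        inside : 2 ≤ length (filter (_∈? K) (pts r f))
        inside = ℕ.+-cancelˡ-≤ 1 _ _ (ℕ.≤-trans 3≤r (ℕ.≤-trans (ℕ.≤-reflexive (trans (sym (length-pts r f))
          (sym (length-∖-filter (pts r f) K)))) (ℕ.+-monoˡ-≤ _ (ℕ.≤-pred (ℕ.≰⇒> ¬two)))))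
      ... | u , v , u∈ , v∈ , ne with Mem.∈-filter⁻ (_∈? K) {xs = pts r f} u∈ | Mem.∈-filter⁻ (_∈? K) {xs = pts r f} v∈
      ... | u∈f , u∈K | v∈f , v∈K = inj₂ (u , v , u∈f , v∈f , u∈K , v∈K , ne)

      -- The old vertex `w` lies on the rational line of `e` but perhaps not in `e`. This covers
      -- both an edge through an old vertex and an edge aligned with a short edge through one.
      module OneLine {A β e w u} (S : State A β) (nk : ¬ Kill A) (e∈ : e ∈ Lfam) (once : MeetsOnce (pts q e) A)
        (w∈A : w ∈ A) (ow : Online e w) (u∈e : u ∈ pts q e) (u∉A : u ∉ A) where

        open State S

        private ns = pts q e ∖ A

        on-line-spanned : ∀ {c} → Online e c → c ∈ spanⁿ 2 (depth q) (ns ++ A)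
        on-line-spanned oc = ⊆-span (determined {h = 0} {e = e} (Mem.∈-++⁺ʳ ns w∈A) (Mem.∈-++⁺ˡ (∈-∖⁺ u∈e u∉A))
                               (λ { refl → u∉A w∈A }) ow (online e u∈e) oc)

        -- One free vertex pays for `e`. Its line and `A` then determine `e′`, which loses at most
        -- one vertex to `A` and one to `e`.
        no-transversal : ∀ {e′ x z} → e′ ∈ Lfam → ¬ Share q e e′ → MeetsOnce (pts q e′) A →
          x ∈ pts q e′ → z ∈ pts q e′ → x ≢ z → Online e x ⊎ x ∈ A → Online e z ⊎ z ∈ A → ⊥
        no-transversal {e′} e′∈ ¬s once′ x∈ z∈ ne x∈′ z∈′ = nk (kill
          (Gen-++ (Gen-line₁ e w∈A ow (λ { p refl → proj₂ (∈-∖⁻ {pts q e} {A} p) w∈A })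
                    (λ p → online e (proj₁ (∈-∖⁻ {pts q e} {A} p))))
                  (Gen-line₀ e′ (spanned x∈′) (spanned z∈′) ne (online e′ x∈) (online e′ z∈)
                    (λ p → online e′ (proj₁ (∈-∖⁻ {pts q e′} {ns ++ A} p)))))
          (New-++ (new-edge e∈) (new-edge e′∈))
          (ℕ.<-≤-trans (light₂ (length-edge-∖ e∈ once) len′) (ℕ.≤-reflexive (cong (λ m → r * (m + q)) (sym (List.length-++ ns)))))
          (ℕ.≤-trans (ℕ.≤-reflexive (List.length-++ ns)) (ℕ.≤-trans (ℕ.+-mono-≤ (length-∖-pts e A)
            (ℕ.≤-trans (length-∖-pts e′ (ns ++ A)) (ℕ.m≤m+n q 0))) 2q≤size)))
          where
          spanned : ∀ {c} → Online e c ⊎ c ∈ A → c ∈ spanⁿ 2 (depth q) (ns ++ A)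
          spanned (inj₁ o) = on-line-spanned o
          spanned (inj₂ p) = base⊆spanⁿ 2 (Mem.∈-++⁺ʳ ns p)
          len′ : q ≤ 2 + length (pts q e′ ∖ (ns ++ A))
          len′ = subst (_≤ 2 + length (pts q e′ ∖ (ns ++ A))) (length-pts q e′)
            (length-∖-++ {K = A} {c = 1} (pts-unique q e′ (long≥1 e′∈))
              (length-∖-meetsOnce (pts-unique q e′ (long≥1 e′∈)) once′)
              {K′ = ns} λ a b c d → ¬share⇒meetsOnce (¬s ∘ share-sym) a (proj₁ (∈-∖⁻ {pts q e} {A} b)) c (proj₁ (∈-∖⁻ {pts q e} {A} d)))

        only-w : ∀ {x} → Online e x → x ∈ A → w ≢ x → ⊥
        only-w o x∈A ne = nk (kill-determined e∈ once (base⊆spanⁿ 2 w∈A) (base⊆spanⁿ 2 x∈A) ne ow o)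

        module Blue {es size} (Z : Hitting q es size) (es⊆ : ∀ {e′} → e′ ∈ es → e′ ∈ Parallel e) (w∉ : w ∉ Hitting.blues Z) where

          open Hitting Z

          blue-line : ∀ {c} → c ∈ blues → c ∈ line e
          blue-line b with covered b
          ... | e′ , e′∈ , c∈ with Mem.∈-filter⁻ (share? q e) (es⊆ e′∈)
          ... | e′∈L , s = ∈-line⁺ e′∈L s c∈

          private
            outside : ∀ {f} → pts r f ⊆ blues ++ β → ∀ {x} → x ∈ pts r f ∖ blues → x ∈ pts r f × x ∈ β
            outside {f} all p with ∈-∖⁻ {pts r f} {blues} p
            ... | x∈ , x∉ = x∈ , [ (λ b → ⊥-elim (x∉ b)) , id ]′ (Mem.∈-++⁻ blues (all x∈))

          -- The two vertices outside the new blue set are old and determine the line of `f`, hence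
          -- `c`. As `c` differs from `w`, both together determine `e` without a free vertex.
          noBlue₂ : ∀ {f c} → f ∈ Sfam → pts r f ⊆ blues ++ β → c ∈ pts r f → c ∈ blues →
            2 ≤ length (pts r f ∖ blues) → ⊥
          noBlue₂ {f} {c} f∈ all c∈ c∈b len with two∈ (∖-unique (pts-unique r f (short≥1 f∈))) len
          ... | x , z , x∈ , z∈ , ne with outside all x∈ | outside all z∈
          ... | x∈f , x∈β | z∈f , z∈β = nk (kill-determined e∈ once (base⊆spanⁿ 2 w∈A)
                  (⊆-span (short-determined f∈ x∈f z∈f ne (β⊆A x∈β) (β⊆A z∈β) c∈))
                  (λ { refl → w∉ c∈b }) ow (line-online (blue-line c∈b)))

          -- If fewer than two vertices lie outside, two lie inside, so `f` runs along the line of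
          -- `e`. An outside vertex is then an old vertex on this line, which can only be `w`; but
          -- `w` is not blue.
          noBlue₁ : w ∉ β → ∀ {f c} → f ∈ Sfam → pts r f ⊆ blues ++ β → c ∈ pts r f → c ∈ blues →
            1 ≤ length (pts r f ∖ blues) → ⊥
          noBlue₁ w∉β {f} f∈ all c∈ c∈b len with two-outside-or-two-inside f∈ blues
          ... | inj₁ two = noBlue₂ f∈ all c∈ c∈b two
          ... | inj₂ (u , v , u∈f , v∈f , u∈b , v∈b , ne) with one∈ len
          ... | x , x∈ with outside all x∈
          ... | x∈f , x∈β = only-w (online-ext f (short⊆long f u∈f) (short⊆long f v∈f) ne
                  (line-onLine (blue-line u∈b)) (line-onLine (blue-line v∈b)) (short⊆long f x∈f)) (β⊆A x∈β)
                  λ { refl → w∉β x∈β }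

      abstract

        extendLine : ∀ {A β y e} → State A β → ¬ Kill A → y ∈ A → e ∈ Lfam → y ∈ pts q e →
          ¬ (pts q e ⊆ A) → Extension A 1
        extendLine {A} {β} {y} {e} S nk y∈A e∈ y∈e e⊈A with ⊈⇒∃ e⊈A
        ... | u , u∈e , u∉A = record
          { xs = xs ; β = proj₁ coloured
          ; gen = Gen-line₁ e y∈A (online e y∈e) (λ { p refl → proj₂ (∈-∖⁻ {line e} {A} p) y∈A })
                    (λ p → line-online (proj₁ (∈-∖⁻ {line e} {A} p)))
          ; new = New-∖ (line-unique e) (line⊆V {e})
          ; light = light₁ (ℕ.≤-trans (length-edge-∖ e∈ once) (s≤s (unique-⊆⇒length≤
                      (∖-unique (pts-unique q e (long≥1 e∈)))
                      (λ p → ∈-∖⁺ (edge⊆line e∈ (proj₁ (∈-∖⁻ {pts q e} {A} p))) (proj₂ (∈-∖⁻ {pts q e} {A} p))))))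
          ; short = ℕ.≤-trans (length-∖-≤ (line e) A) (ℕ.≤-trans (length-line e) 2q≤size)
          ; state = proj₂ coloured
          }
          where
          open State S
          xs : List ℕ
          xs = line e ∖ A
          once : MeetsOnce (pts q e) A
          once = meetsOnce e∈ u∈e u∉A
          open OneLine S nk e∈ once y∈A (online e y∈e) u∈e u∉A
          line⊆ : line e ⊆ xs ++ A
          line⊆ {x} p with x ∈? A
          ... | yes x∈A = Mem.∈-++⁺ʳ xs x∈A
          ... | no x∉A  = Mem.∈-++⁺ˡ (∈-∖⁺ p x∉A)
          where-is : ∀ {c} → c ∈ xs ++ A → Online e c ⊎ c ∈ A
          where-is p with Mem.∈-++⁻ xs p
          ... | inj₂ c∈A = inj₂ c∈A
          ... | inj₁ c∈xs = inj₁ (line-online (proj₁ (∈-∖⁻ {line e} {A} c∈xs)))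
          two : ∀ {e′ x z} → e′ ∈ Lfam → x ∈ pts q e′ → z ∈ pts q e′ → x ≢ z → x ∈ xs ++ A → z ∈ xs ++ A →
            pts q e′ ⊆ A ⊎ Share q e e′
          two {e′} e′∈ x∈ z∈ ne x∈′ z∈′ with share? q e e′ | ⊆⊎∃∉ (pts q e′) A
          ... | yes s | _      = inj₂ s
          ... | no _  | inj₁ s = inj₁ s
          ... | no ¬s | inj₂ (v , v∈ , v∉) =
            ⊥-elim (no-transversal e′∈ ¬s (meetsOnce e′∈ v∈ v∉) x∈ z∈ ne (where-is x∈′) (where-is z∈′))
          coloured : ∃ λ β′ → State (xs ++ A) β′
          coloured with y ∈? β
          -- Edges through `y` are hit by `y`. The others are hit without using `y` by r - 2
          -- vertices, leaving two old vertices in any blue short edge.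
          ... | yes y∈β = _ , addLine S {size = r ∸ 2} (λ p → proj₂ (∈-∖⁻ {line e} {A} p)) line⊆ two Z es⊆ es⊇
                  λ f∈ all c∈ c∈b → noBlue₂ f∈ all c∈ c∈b (short-outside _ f∈ (Hitting.small Z) (ℕ.≤-trans (s≤s (s≤s z≤n)) 3≤r))
            where
            avoid? : ∀ e′ → Dec (y ∉ pts q e′)
            avoid? e′ = ¬? (y ∈? pts q e′)
            es : List Pts
            es = filter avoid? (Parallel e)
            es⊆ : ∀ {e′} → e′ ∈ es → e′ ∈ Parallel e
            es⊆ p = proj₁ (Mem.∈-filter⁻ avoid? p)
            es⊇ : ∀ {e′} → e′ ∈ Parallel e → e′ ∈ es ⊎ ∃ λ x → x ∈ pts q e′ × x ∈ β
            es⊇ {e′} p with y ∈? pts q e′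
            ... | yes y∈ = inj₂ (y , y∈ , y∈β)
            ... | no y∉  = inj₁ (Mem.∈-filter⁺ avoid? p y∉)
            Z : Hitting q es (r ∸ 2)
            Z = hitting q r 3≤r r<q es (λ p → long≥1 (proj₁ (Mem.∈-filter⁻ (share? q e) (es⊆ p))))
                  (λ p p′ → parallel-common {e} (es⊆ p) (es⊆ p′))
            y∉blues : y ∉ Hitting.blues Z
            y∉blues b = let e′ , e′∈ , y∈ = Hitting.covered Z b in proj₂ (Mem.∈-filter⁻ avoid? {xs = Parallel e} e′∈) y∈
            open Blue Z es⊆ y∉blues
          -- The old vertex `y` has to stay red. Avoiding it raises the hitting set to r - 1, so
          -- only one old vertex of a blue short edge is guaranteed; that `y` is red makes up for
          -- it.
          ... | no y∉β = _ , addLine S {size = r ∸ 1} (λ p → proj₂ (∈-∖⁻ {line e} {A} p)) line⊆ two Z id inj₁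
                  λ f∈ all c∈ c∈b → noBlue₁ y∉β f∈ all c∈ c∈b (short-outside _ f∈ (Hitting.small Z) 1≤r)
            where
            avoiding : Σ (Hitting q (Parallel e) (r ∸ 1)) λ Z → y ∉ Hitting.blues Z
            avoiding = hitting-avoiding q r 3≤r r<q (Parallel e) (λ p → long≥1 (proj₁ (Mem.∈-filter⁻ (share? q e) p)))
                         (parallel-common {e}) y
            Z : Hitting q (Parallel e) (r ∸ 1)
            Z = proj₁ avoiding
            open Blue Z id (proj₂ avoiding)

open Colourings

-- Short edges with two old vertices or aligned with a long edge.

module ShortEdges where

  module ShortSteps {q r : ℕ} (H : Hypergraph q r) (nsk : ¬ Geometry.StartKill H) where

    open Colouring H
    open Steps nsk

    -- The old vertices form a union of long edges, as far as long edges meet them, and the short edge f meets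
    -- them in v without being contained in them.
    module AtShort {A β f v} (S : State A β) (nk : ¬ Kill A)
      (saturated : ∀ {e x} → e ∈ Lfam → x ∈ pts q e → x ∈ A → pts q e ⊆ A)
      (v∈A : v ∈ A) (f∈ : f ∈ Sfam) (v∈f : v ∈ pts r f) (f⊈A : ¬ (pts r f ⊆ A)) where

      open State S

      fresh : List ℕ
      fresh = pts r f ∖ A

      fresh-unique : Unique fresh
      fresh-unique = ∖-unique (pts-unique r f (short≥1 f∈))

      fresh∈f : ∀ {z} → z ∈ fresh → z ∈ pts r f
      fresh∈f p = proj₁ (∈-∖⁻ {pts r f} {A} p)

      fresh∉A : ∀ {z} → z ∈ fresh → z ∉ A
      fresh∉A p = proj₂ (∈-∖⁻ {pts r f} {A} p)

      fresh-online : ∀ {z} → z ∈ fresh → Online f z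
      fresh-online p = online f (short⊆long f (fresh∈f p))

      fresh⊆V : fresh ⊆ V
      fresh⊆V p = let e , e∈ , x∈ = short⊆ f∈ (fresh∈f p) in long⊆V e∈ x∈

      fresh-new : New V A fresh
      fresh-new = mkNew fresh-unique fresh∉A fresh⊆V

      fresh≥1 : 1 ≤ length fresh
      fresh≥1 = let x , x∈ , x∉ = ⊈⇒∃ f⊈A in ℕ.≤-trans (s≤s z≤n) (Mem.∈-length (∈-∖⁺ x∈ x∉))

      length-fresh≤r : length fresh ≤ r
      length-fresh≤r = ℕ.≤-trans (length-∖-≤ (pts r f) A) (ℕ.≤-reflexive (length-pts r f))

      off : ∀ {e z} → e ∈ Lfam → z ∈ pts q e → z ∉ A → ∀ {x} → x ∈ pts q e → x ∉ A
      off e∈ z∈ z∉ x∈ x∈A = z∉ (saturated e∈ x∈ x∈A z∈)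

      off-once : ∀ {e z} → e ∈ Lfam → z ∈ pts q e → z ∉ A → MeetsOnce (pts q e) A
      off-once e∈ z∈ z∉ x∈ x∈A = ⊥-elim (off e∈ z∈ z∉ x∈ x∈A)

      line-off : ∀ {e z} → e ∈ Lfam → z ∈ pts q e → z ∉ A → ∀ {x} → x ∈ line e → x ∉ A
      line-off {e} e∈ z∈ z∉ x∈ x∈A with ∈-line⁻ {e} x∈
      ... | e′ , (e′∈ , y , _ , (y∈ , _) , (y∈′ , _) , _) , x∈′ =
        off e∈ z∈ z∉ y∈ (saturated e′∈ x∈′ x∈A y∈′)

      v≢fresh : ∀ {z} → z ∈ fresh → v ≢ z
      v≢fresh p refl = fresh∉A p v∈A

      case-old : ∀ {e x y} {xs : List ℕ} → e ∈ Lfam → x ∈ pts q e → y ∈ pts q e → x ∈ xs ++ A → y ∈ xs ++ A →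
        pts q e ⊆ A ⊎ (x ∈ xs × y ∈ xs × x ∉ A)
      case-old {x = x} {y} {xs} e∈ x∈ y∈ x∈′ y∈′ with x ∈? A | y ∈? A
      ... | yes p | _     = inj₁ (saturated e∈ x∈ p)
      ... | no _  | yes p = inj₁ (saturated e∈ y∈ p)
      ... | no a  | no b  = inj₂ ([ id , (λ k → ⊥-elim (a k)) ]′ (Mem.∈-++⁻ xs x∈′) ,
                                  [ id , (λ k → ⊥-elim (b k)) ]′ (Mem.∈-++⁻ xs y∈′) , a)

      abstract

        -- The remaining vertices of f are determined.
        extendShort : ∀ {y} → y ∈ pts r f → y ∈ A → v ≢ y → Extension A 0
        extendShort {y} y∈f y∈A v≢y = record
          { xs = fresh ; β = β
          ; gen = Gen-line₀ f (base⊆spanⁿ 2 v∈A) (base⊆spanⁿ 2 y∈A) v≢y (online f (short⊆long f v∈f)) (online f (short⊆long f y∈f)) fresh-online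
          ; new = fresh-new
          ; light = ℕ.*-mono-≤ 1≤r fresh≥1
          ; short = ℕ.≤-trans length-fresh≤r (ℕ.≤-trans (ℕ.<⇒≤ r<q) q≤size)
          ; state = record
            { closed = λ e∈ x∈ y∈ ne x∈′ y∈′ p → Mem.∈-++⁺ʳ fresh (two e∈ x∈ y∈ ne x∈′ y∈′ p)
            ; hit    = λ {e} e∈ sub → let x , z , x∈ , z∈ , ne = distinct q e (long≥1 e∈) 2≤q in
                         hit e∈ (two e∈ x∈ z∈ ne (sub x∈) (sub z∈))
            ; β⊆A    = λ p → Mem.∈-++⁺ʳ fresh (β⊆A p)
            ; noBlue = noBlue
            }
          }
          where
          spanned : ∀ {z} → z ∈ fresh → z ∈ spanⁿ 2 (depth q) A
          spanned z∈ = ⊆-span (short-determined f∈ v∈f y∈f v≢y v∈A y∈A (fresh∈f z∈))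
          two : ∀ {e x z} → e ∈ Lfam → x ∈ pts q e → z ∈ pts q e → x ≢ z → x ∈ fresh ++ A → z ∈ fresh ++ A → pts q e ⊆ A
          two {e} e∈ x∈ z∈ ne x∈′ z∈′ with case-old {e} e∈ x∈ z∈ x∈′ z∈′
          ... | inj₁ s = s
          ... | inj₂ (x∈f , z∈f , x∉) = ⊥-elim (nk (kill-determined e∈ (off-once e∈ x∈ x∉)
                  (spanned x∈f) (spanned z∈f) ne (online e x∈) (online e z∈)))

      Aligned : Set
      Aligned = ∃ λ e → ∃ λ z → ∃ λ z′ → e ∈ Lfam × (z ∈ fresh × z′ ∈ fresh) × z ≢ z′ × z ∈ pts q e × z′ ∈ line e

      aligned? : Dec Aligned
      aligned? = map′ to from (Any.any? (λ e → Any.any? (λ z → Any.any? (λ z′ →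
        ¬? (z ℕ.≟ z′) ×-dec (z ∈? pts q e ×-dec z′ ∈? line e)) fresh) fresh) Lfam)
        where
        to : Any (λ e → Any (λ z → Any (λ z′ → z ≢ z′ × z ∈ pts q e × z′ ∈ line e) fresh) fresh) Lfam → Aligned
        to p with find p
        ... | e , e∈ , p′ with find p′
        ... | z , z∈ , p″ with find p″
        ... | z′ , z′∈ , ne , a , b = e , z , z′ , e∈ , (z∈ , z′∈) , ne , a , b
        from : Aligned → Any (λ e → Any (λ z → Any (λ z′ → z ≢ z′ × z ∈ pts q e × z′ ∈ line e) fresh) fresh) Lfam
        from (e , z , z′ , e∈ , (z∈ , z′∈) , ne , a , b) = lose e∈ (lose z∈ (lose z′∈ (ne , a , b)))

      abstract

        -- Some long edge lies on the line of f: both are determined by one free vertex.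
        extendAligned : Aligned → Extension A 1
        extendAligned (e , z , z′ , e∈ , (z∈ , z′∈) , ne , z∈e , z′∈l) = record
          { xs = xs ; β = _
          ; gen = Gen-line₁ e v∈A (online-f v∈f) (λ { p refl → xs∉A p v∈A }) xs-online
          ; new = mkNew (Unique.++⁺ (∖-unique fresh-unique) (line-unique e) λ (p , p′) → proj₂ (∈-∖⁻ {fresh} {line e} p) p′)
                    xs∉A (λ p → [ (λ k → fresh⊆V (proj₁ (∈-∖⁻ {fresh} {line e} k))) , line⊆V {e} ]′ (Mem.∈-++⁻ (fresh ∖ line e) p))
          ; light = light₁ (ℕ.m≤n⇒m≤1+n (ℕ.≤-trans (ℕ.≤-trans (ℕ.≤-reflexive (sym (length-pts q e)))
                      (unique-⊆⇒length≤ (pts-unique q e (long≥1 e∈)) (edge⊆line e∈))) (List.length-++-≤ʳ (line e) {fresh ∖ line e})))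
          ; short = ℕ.≤-trans (ℕ.≤-reflexive (List.length-++ (fresh ∖ line e)))
                      (ℕ.≤-trans (ℕ.+-mono-≤ (ℕ.≤-trans (length-∖-≤ fresh (line e)) (ℕ.≤-trans length-fresh≤r (ℕ.<⇒≤ r<q))) (length-line e)) 3q≤size)
          ; state = addLine S xs∉A (λ p → Mem.∈-++⁺ˡ (Mem.∈-++⁺ʳ (fresh ∖ line e) p)) two Z id inj₁
                      λ g∈ all c∈ c∈b → noBlue₂ g∈ all c∈ c∈b (short-outside _ g∈ (Hitting.small Z) (ℕ.≤-trans (s≤s (s≤s z≤n)) 3≤r))
          }
          where
          z∉A : z ∉ A
          z∉A = fresh∉A z∈
          xs : List ℕ
          xs = fresh ∖ line e ++ line e
          online-f : ∀ {x} → x ∈ pts r f → Online e x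
          online-f p = online-ext f (short⊆long f (fresh∈f z∈)) (short⊆long f (fresh∈f z′∈)) ne
            (line-onLine (edge⊆line e∈ z∈e)) (line-onLine z′∈l) (short⊆long f p)
          xs-online : ∀ {x} → x ∈ xs → Online e x
          xs-online p = [ (λ k → online-f (fresh∈f (proj₁ (∈-∖⁻ {fresh} {line e} k)))) , line-online ]′ (Mem.∈-++⁻ (fresh ∖ line e) p)
          xs∉A : ∀ {x} → x ∈ xs → x ∉ A
          xs∉A p = [ (λ k → fresh∉A (proj₁ (∈-∖⁻ {fresh} {line e} k))) , line-off e∈ z∈e z∉A ]′ (Mem.∈-++⁻ (fresh ∖ line e) p)
          3q≤size : q + 2 * q ≤ size q r
          3q≤size = ℕ.*-mono-≤ {3} {4} (s≤s (s≤s (s≤s z≤n))) q≤rq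
          open OneLine S nk e∈ (off-once e∈ z∈e z∉A) v∈A (online-f v∈f) z∈e z∉A
          two : ∀ {e′ x y} → e′ ∈ Lfam → x ∈ pts q e′ → y ∈ pts q e′ → x ≢ y → x ∈ xs ++ A → y ∈ xs ++ A →
            pts q e′ ⊆ A ⊎ Share q e e′
          two {e′} e′∈ x∈ y∈ x≢y x∈′ y∈′ with case-old {e′} e′∈ x∈ y∈ x∈′ y∈′ | share? q e e′
          ... | inj₁ s | _ = inj₁ s
          ... | inj₂ _ | yes s = inj₂ s
          ... | inj₂ (x∈xs , y∈xs , x∉) | no ¬s = ⊥-elim (no-transversal e′∈ ¬s (off-once e′∈ x∈ x∉) x∈ y∈ x≢y
                  (inj₁ (xs-online x∈xs)) (inj₁ (xs-online y∈xs)))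
          -- The whole line of `e` avoids `A` by saturation, so `v` is not at risk of becoming blue
          -- and the smaller hitting set is available.
          Z : Hitting q (Parallel e) (r ∸ 2)
          Z = hitting q r 3≤r r<q (Parallel e) (λ p → long≥1 (proj₁ (Mem.∈-filter⁻ (share? q e) p))) (parallel-common {e})
          blue∉A : v ∉ Hitting.blues Z
          blue∉A b with Hitting.covered Z b
          ... | e′ , e′∈ , v∈′ with Mem.∈-filter⁻ (share? q e) e′∈
          ... | e′∈L , s = line-off e∈ z∈e z∉A (∈-line⁺ e′∈L s v∈′) v∈A
          open Blue Z id blue∉A

open ShortEdges

-- Long edges covering a generic short edge: counting and kills.

module CoverCounting where

  stack : ℕ → List Pts → List ℕ → List ℕ
  stack q es K = foldr (λ e K → pts q e ++ K) K es

  length-∖-stack : ∀ {q xs} es {K c} → Unique xs → (∀ {e} → e ∈ es → MeetsOnce xs (pts q e)) →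
    length xs ≤ c + length (xs ∖ K) → length xs ≤ (length es + c) + length (xs ∖ stack q es K)
  length-∖-stack []       u once le = le
  length-∖-stack {q} (e ∷ es) {K} {c} u once le =
    length-∖-++ {K = stack q es K} {c = length es + c} u (length-∖-stack es u (once ∘ there) le) (once (here refl))

  module RegularSteps {q r : ℕ} (H : Hypergraph q r) (nsk : ¬ Geometry.StartKill H) where

    open Colouring H
    open Steps nsk

    δ = q ∸ r

    r+δ : r + δ ≡ q
    r+δ = ℕ.m+[n∸m]≡n (ℕ.<⇒≤ r<q)

    δ≥1 : 1 ≤ δ
    δ≥1 = ℕ.m<n⇒0<n∸m r<q

    -- Every cover gains δ = q - r over its cost, so that r - j covers make up for a deficit of at most j.
    light-covers : ∀ G e j {X N f m} → f * cost q r + m * δ ≤ r * N → r ≤ j + m → r + G * q ≤ X + q + e →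
      e * r + j * δ < suc G * q → (suc G + f) * cost q r < r * (X + q + N)
    light-covers G e j {X} {N} {f} {m} hf hm hX slack = ℕ.+-cancelʳ-< (F * q + r * δ) _ _ (begin-strict
      (F + f) * c + (F * q + r * δ)                      ≤⟨ ℕ.+-monoʳ-≤ ((F + f) * c) (ℕ.+-monoʳ-≤ (F * q) (ℕ.*-monoˡ-≤ δ hm)) ⟩
      (F + f) * c + (F * q + (j + m) * δ)                ≡⟨ eq₁ F f c q j m δ ⟩
      (F * c + F * q) + ((f * c + m * δ) + j * δ)        ≤⟨ ℕ.+-mono-≤ (ℕ.≤-reflexive (cost-+ F {q} {r} 1≤r)) (ℕ.+-monoˡ-≤ (j * δ) hf) ⟩
      F * (q * r) + (r * N + j * δ)                      ≡⟨ eq₂ G q r N j δ ⟩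
      r * q + r * (G * q) + (r * N + j * δ)              ≡⟨ cong (λ k → r * k + r * (G * q) + (r * N + j * δ)) (sym r+δ) ⟩
      r * (r + δ) + r * (G * q) + (r * N + j * δ)        ≡⟨ eq₃ G q r N j δ ⟩
      r * (r + G * q) + (r * N + (j * δ + r * δ))        ≤⟨ ℕ.+-monoˡ-≤ _ (ℕ.*-monoʳ-≤ r hX) ⟩
      r * (X + q + e) + (r * N + (j * δ + r * δ))        ≡⟨ eq₄ X q r N j δ e ⟩
      r * (X + q + N) + ((e * r + j * δ) + r * δ)        <⟨ ℕ.+-monoʳ-< (r * (X + q + N)) (ℕ.+-monoˡ-< (r * δ) slack) ⟩
      r * (X + q + N) + (F * q + r * δ)                  ∎)
      where
      open ℕ.≤-Reasoning
      F = suc G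
      c = cost q r
      eq₁ : ∀ F f c q j m δ → (F + f) * c + (F * q + (j + m) * δ) ≡ (F * c + F * q) + ((f * c + m * δ) + j * δ)
      eq₁ = ℕ-solve-∀
      eq₂ : ∀ G q r N j δ → suc G * (q * r) + (r * N + j * δ) ≡ r * q + r * (G * q) + (r * N + j * δ)
      eq₂ = ℕ-solve-∀
      eq₃ : ∀ G q r N j δ → r * (r + δ) + r * (G * q) + (r * N + j * δ) ≡ r * (r + G * q) + (r * N + (j * δ + r * δ))
      eq₃ = ℕ-solve-∀
      eq₄ : ∀ X q r N j δ e → r * (X + q + e) + (r * N + (j * δ + r * δ)) ≡ r * (X + q + N) + ((e * r + j * δ) + r * δ)
      eq₄ = ℕ-solve-∀

    -- By q = r + δ the terms are compared separately. In the kills below, F counts free vertices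
    -- other than those of the remaining covers, including 2 for the start; e counts vertices lost
    -- to overlaps, and j the vertices of the short edge without a remaining cover. The triples (F,
    -- e, j) are (4, 4, 3), (3, 2, 2) and (5, 5, 3).
    slack-≤ : ∀ {e j F} → e ≤ F → j < F → e * r + j * δ < F * q
    slack-≤ {e} {j} {F} e≤F j<F = subst (λ k → e * r + j * δ < F * k) r+δ
      (ℕ.<-≤-trans (ℕ.+-mono-≤-< (ℕ.*-monoˡ-≤ r e≤F) (ℕ.*-monoˡ-< δ {{ℕ.>-nonZero δ≥1}} j<F))
        (ℕ.≤-reflexive (sym (ℕ.*-distribˡ-+ F r δ))))

    module AtShort {A β f v} (S : State A β) (nk : ¬ Kill A)
      (saturated : ∀ {e x} → e ∈ Lfam → x ∈ pts q e → x ∈ A → pts q e ⊆ A)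
      (v∈A : v ∈ A) (f∈ : f ∈ Sfam) (v∈f : v ∈ pts r f) (f⊈A : ¬ (pts r f ⊆ A))
      (only-v : ∀ {x} → x ∈ pts r f → x ∈ A → v ≡ x)
      (unaligned : ¬ ShortSteps.AtShort.Aligned H nsk S nk saturated v∈A f∈ v∈f f⊈A) where

      open State S
      open ShortSteps.AtShort H nsk S nk saturated v∈A f∈ v∈f f⊈A

      fresh<r : suc (length fresh) ≤ r
      fresh<r = ℕ.≤-trans (unique-⊆⇒length≤ {v ∷ fresh} {pts r f} (All.tabulate v≢fresh ∷ fresh-unique)
          (λ { (here refl) → v∈f ; (there p) → fresh∈f p })) (ℕ.≤-reflexive (length-pts r f))

      r≤fresh : r ≤ suc (length fresh)
      r≤fresh = subst (_≤ suc (length fresh)) (length-pts r f) (length-∖-meetsOnce (pts-unique r f (short≥1 f∈))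
        λ a b c d → trans (sym (only-v a b)) (only-v c d))

      abstract

        cover : ℕ → Pts
        cover z with Any.any? (λ e → z ∈? pts q e) Lfam
        ... | yes p = proj₁ (find p)
        -- A default outside the short edge; every fresh vertex lies on some long edge.
        ... | no _  = 0 , 0

        cover-ok : ∀ {z} → z ∈ fresh → cover z ∈ Lfam × z ∈ pts q (cover z)
        cover-ok {z} z∈ with Any.any? (λ e → z ∈? pts q e) Lfam
        ... | yes p = let e , e∈ , z∈e = find p in e∈ , z∈e
        ... | no ¬p = let e , e∈ , z∈e = short⊆ f∈ (fresh∈f z∈) in ⊥-elim (¬p (lose e∈ z∈e))

      edge : ℕ → List ℕ
      edge z = pts q (cover z)

      cover∈ : ∀ {z} → z ∈ fresh → cover z ∈ Lfam
      cover∈ = proj₁ ∘ cover-ok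

      ∈cover : ∀ {z} → z ∈ fresh → z ∈ edge z
      ∈cover = proj₂ ∘ cover-ok

      edge-unique : ∀ {z} → z ∈ fresh → Unique (edge z)
      edge-unique z∈ = pts-unique q _ (long≥1 (cover∈ z∈))

      edge-off : ∀ {z x} → z ∈ fresh → x ∈ edge z → x ∉ A
      edge-off z∈ = off (cover∈ z∈) (∈cover z∈) (fresh∉A z∈)

      apart : ∀ {e z z′} → e ∈ Lfam → z ∈ fresh → z′ ∈ fresh → z ≢ z′ → z ∈ pts q e → z′ ∉ line e
      apart e∈ z∈ z′∈ ne a b = unaligned (_ , _ , _ , e∈ , (z∈ , z′∈) , ne , a , b)

      edge-fresh : ∀ {z z′} → z ∈ fresh → z′ ∈ fresh → z′ ∈ edge z → z ≡ z′
      edge-fresh {z} {z′} z∈ z′∈ p with z ℕ.≟ z′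
      ... | yes eq = eq
      ... | no ne  = ⊥-elim (apart (cover∈ z∈) z∈ z′∈ ne (∈cover z∈) (edge⊆line (cover∈ z∈) p))

      ¬share : ∀ {z z′} → z ∈ fresh → z′ ∈ fresh → z ≢ z′ → ¬ Share q (cover z) (cover z′)
      ¬share z∈ z′∈ ne s = apart (cover∈ z∈) z∈ z′∈ ne (∈cover z∈) (∈-line⁺ (cover∈ z′∈) s (∈cover z′∈))

      edges-once : ∀ {z z′} → z ∈ fresh → z′ ∈ fresh → z ≢ z′ → MeetsOnce (edge z) (edge z′)
      edges-once z∈ z′∈ ne = ¬share⇒meetsOnce (¬share z∈ z′∈ ne)

      -- `light` registers a gain of δ for each cover, be it free or determined, so kills can
      -- include all remaining covers without knowing how these overlap.
      record Covers (K zs : List ℕ) : Set where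
        field
          {free#} : ℕ
          {ys}    : List ℕ
          gen     : Gen (depth q) K free# ys
          new     : New V K ys
          light   : free# * cost q r + length zs * δ ≤ r * length ys
          short   : length ys ≤ length zs * q
          from    : ∀ {y} → y ∈ ys → ∃ λ z → z ∈ zs × y ∈ edge z
          all     : ∀ {z} → z ∈ zs → edge z ⊆ ys ++ K

      private
        -- With exactly q - 1 new vertices this is an equality, r(q - 1) = q(r - 1) + (q - r).
        light-free : ∀ {N} → q ≤ suc N → 1 * cost q r + δ ≤ r * N
        light-free {N} le = ℕ.+-cancelʳ-≤ r _ _ (begin
          1 * c + δ + r          ≡⟨ eq₁ c δ r ⟩
          1 * c + 1 * (r + δ)    ≡⟨ cong (λ k → 1 * c + 1 * k) r+δ ⟩
          1 * c + 1 * q          ≡⟨ cost-+ 1 {q} {r} 1≤r ⟩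
          1 * (q * r)            ≡⟨ eq₂ q r ⟩
          r * q                  ≤⟨ ℕ.*-monoʳ-≤ r le ⟩
          r * suc N              ≡⟨ eq₃ r N ⟩
          r * N + r              ∎)
          where
          open ℕ.≤-Reasoning
          c = cost q r
          eq₁ : ∀ c δ r → 1 * c + δ + r ≡ 1 * c + 1 * (r + δ)
          eq₁ = ℕ-solve-∀
          eq₂ : ∀ q r → 1 * (q * r) ≡ r * q
          eq₂ = ℕ-solve-∀
          eq₃ : ∀ r N → r * suc N ≡ r * N + r
          eq₃ = ℕ-solve-∀

        -- A determined cover may lose up to r vertices to overlaps. The q - r that remain are a
        -- gain of at least δ, since nothing is paid for them.
        light-det : ∀ {N k} → suc k ≤ r → q ≤ suc k + N → 0 * cost q r + δ ≤ r * N
        light-det {N} {k} k<r le = ℕ.≤-trans (ℕ.+-cancelˡ-≤ r δ N (ℕ.≤-trans (ℕ.≤-reflexive r+δ)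
          (ℕ.≤-trans le (ℕ.+-monoˡ-≤ N k<r)))) (ℕ.m≤n*m N r {{ℕ.>-nonZero 1≤r}})

        light-∷ : ∀ {g c f m N M} → g * c + δ ≤ r * N → f * c + m * δ ≤ r * M →
          (g + f) * c + suc m * δ ≤ r * (N + M)
        light-∷ {g} {c} {f} {m} {N} {M} h k = begin
          (g + f) * c + suc m * δ              ≡⟨ eq g c f m δ ⟩
          (g * c + δ) + (f * c + m * δ)        ≤⟨ ℕ.+-mono-≤ h k ⟩
          r * N + r * M                        ≡⟨ sym (ℕ.*-distribˡ-+ r N M) ⟩
          r * (N + M)                          ∎
          where
          open ℕ.≤-Reasoning
          eq : ∀ g c f m δ → (g + f) * c + suc m * δ ≡ (g * c + δ) + (f * c + m * δ)
          eq = ℕ-solve-∀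

      -- A new cover loses only its own vertex of the short edge and at most one vertex to each edge
      -- in `es`. The bound on the lengths keeps this loss at most r. It is determined as soon as it
      -- meets `K` a second time, and takes one free vertex otherwise.
      covers : ∀ zs es K → Unique zs → zs ⊆ fresh →
        (∀ {x} → x ∈ K → x ∈ A ⊎ x ∈ fresh ⊎ ∃ λ e → e ∈ es × x ∈ pts q e) → A ⊆ K → fresh ⊆ K →
        (∀ {z e} → z ∈ zs → e ∈ es → MeetsOnce (edge z) (pts q e)) → length es + length zs ≤ r → Covers K zs
      covers [] es K u zs⊆ split A⊆ fr⊆ once bound = record
        { free# = 0 ; gen = done ; new = New-[] ; light = z≤n ; short = z≤n ; from = λ () ; all = λ () }
      covers (z ∷ zs) es K (z∉ ∷ u) zs⊆ split A⊆ fr⊆ once bound = assemble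
        (Any.any? (λ y → ¬? (z ℕ.≟ y) ×-dec y ∈? K) (edge z))
        where
        z∈ : z ∈ fresh
        z∈ = zs⊆ (here refl)
        ns = edge z ∖ K
        ns-new : New V K ns
        ns-new = New-∖ (edge-unique z∈) (long⊆V (cover∈ z∈))
        rest : Covers (ns ++ K) zs
        rest = covers zs (cover z ∷ es) (ns ++ K) u (zs⊆ ∘ there) split′
          (λ p → Mem.∈-++⁺ʳ ns (A⊆ p)) (λ p → Mem.∈-++⁺ʳ ns (fr⊆ p)) once′
          (ℕ.≤-trans (ℕ.≤-reflexive (sym (ℕ.+-suc (length es) (length zs)))) bound)
          where
          split′ : ∀ {x} → x ∈ ns ++ K → x ∈ A ⊎ x ∈ fresh ⊎ ∃ λ e → e ∈ cover z ∷ es × x ∈ pts q e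
          split′ p with Mem.∈-++⁻ ns p
          ... | inj₁ a = inj₂ (inj₂ (cover z , here refl , proj₁ (∈-∖⁻ {edge z} {K} a)))
          ... | inj₂ b with split b
          ... | inj₁ c = inj₁ c
          ... | inj₂ (inj₁ c) = inj₂ (inj₁ c)
          ... | inj₂ (inj₂ (e , e∈ , c)) = inj₂ (inj₂ (e , there e∈ , c))
          once′ : ∀ {z′ e} → z′ ∈ zs → e ∈ cover z ∷ es → MeetsOnce (edge z′) (pts q e)
          once′ z′∈ (here refl) = edges-once (zs⊆ (there z′∈)) z∈ λ eq → All.lookup z∉ z′∈ (sym eq)
          once′ z′∈ (there e∈)  = once (there z′∈) e∈
        len : q ≤ suc (length es) + length ns
        len = ℕ.≤-trans (subst₂ _≤_ (length-pts q (cover z)) (cong (_+ length (edge z ∖ stack q es (A ++ fresh))) (ℕ.+-comm (length es) 1))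
                (length-∖-stack es {A ++ fresh} {1} (edge-unique z∈) (once (here refl))
                  (length-∖-disjoint {K = fresh} {c = 1} (edge-unique z∈) (length-∖-meetsOnce (edge-unique z∈)
                    λ a b c d → trans (sym (edge-fresh z∈ b a)) (edge-fresh z∈ d c)) (edge-off z∈))))
              (ℕ.+-monoʳ-≤ (suc (length es)) (unique-⊆⇒length≤ (∖-unique (edge-unique z∈)) λ p →
                let x∈ , x∉ = ∈-∖⁻ {edge z} {stack q es (A ++ fresh)} p in ∈-∖⁺ x∈ λ x∈K → x∉ (to-stack (split x∈K))))
          where
          base⊆stack : ∀ {x} es {K} → x ∈ K → x ∈ stack q es K
          base⊆stack []       p = p
          base⊆stack (e ∷ es) p = Mem.∈-++⁺ʳ (pts q e) (base⊆stack es p)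
          edge⊆stack : ∀ {x e} {es : List Pts} {K} → e ∈ es → x ∈ pts q e → x ∈ stack q es K
          edge⊆stack (here refl) p = Mem.∈-++⁺ˡ p
          edge⊆stack {es = e ∷ es} (there m) p = Mem.∈-++⁺ʳ (pts q e) (edge⊆stack m p)
          to-stack : ∀ {x} → x ∈ A ⊎ x ∈ fresh ⊎ ∃ (λ e → e ∈ es × x ∈ pts q e) → x ∈ stack q es (A ++ fresh)
          to-stack (inj₁ a) = base⊆stack es (Mem.∈-++⁺ˡ a)
          to-stack (inj₂ (inj₁ b)) = base⊆stack es (Mem.∈-++⁺ʳ A b)
          to-stack (inj₂ (inj₂ (e , e∈ , c))) = edge⊆stack e∈ c
        add : ∀ {g} → Gen (depth q) K g ns → g * cost q r + δ ≤ r * length ns → Covers K (z ∷ zs)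
        add {g} G h = record
          { free# = g + C.free# ; ys = ns ++ C.ys
          ; gen = Gen-++ G C.gen
          ; new = New-++ ns-new C.new
          ; light = ℕ.≤-trans (light-∷ {g} {cost q r} {C.free#} {length zs} h C.light) (ℕ.≤-reflexive (cong (r *_) (sym (List.length-++ ns))))
          ; short = ℕ.≤-trans (ℕ.≤-reflexive (List.length-++ ns)) (ℕ.+-mono-≤ (length-∖-pts (cover z) K) C.short)
          ; from = λ p → [ (λ a → z , here refl , proj₁ (∈-∖⁻ {edge z} {K} a)) ,
                           (λ b → let z′ , z′∈ , y∈ = C.from b in z′ , there z′∈ , y∈) ]′ (Mem.∈-++⁻ ns p)
          ; all = all′
          }
          where
          module C = Covers rest
          all′ : ∀ {z′} → z′ ∈ z ∷ zs → edge z′ ⊆ (ns ++ C.ys) ++ K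
          all′ (here refl) {x} p with x ∈? K
          ... | yes x∈K = Mem.∈-++⁺ʳ (ns ++ C.ys) x∈K
          ... | no x∉K  = Mem.∈-++⁺ˡ (Mem.∈-++⁺ˡ (∈-∖⁺ p x∉K))
          all′ (there z′∈) p with Mem.∈-++⁻ C.ys (C.all z′∈ p)
          ... | inj₁ a = Mem.∈-++⁺ˡ (Mem.∈-++⁺ʳ ns a)
          ... | inj₂ b with Mem.∈-++⁻ ns b
          ... | inj₁ c = Mem.∈-++⁺ˡ (Mem.∈-++⁺ˡ c)
          ... | inj₂ d = Mem.∈-++⁺ʳ (ns ++ C.ys) d
        assemble : Dec (Any (λ y → z ≢ y × y ∈ K) (edge z)) → Covers K (z ∷ zs)
        assemble (yes p) = let y , y∈ , ne , y∈K = find p in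
          add (Gen-line₀ (cover z) (base⊆spanⁿ 2 (fr⊆ z∈)) (base⊆spanⁿ 2 y∈K) ne (online (cover z) (∈cover z∈))
                (online (cover z) y∈) (λ a → online (cover z) (proj₁ (∈-∖⁻ {edge z} {K} a))))
              (light-det (ℕ.≤-trans (ℕ.≤-trans (ℕ.m≤m+n (suc (length es)) (length zs)) (ℕ.≤-reflexive (sym (ℕ.+-suc (length es) (length zs))))) bound) len)
        assemble (no ¬p) =
          add (Gen-line₁ (cover z) (fr⊆ z∈) (online (cover z) (∈cover z∈)) (λ { a refl → proj₂ (∈-∖⁻ {edge z} {K} a) (fr⊆ z∈) })
                (λ a → online (cover z) (proj₁ (∈-∖⁻ {edge z} {K} a))))
              (light-free (length-edge-∖ (cover∈ z∈) λ a b c d → trans (sym (only a b)) (only c d)))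
          where
          only : ∀ {x} → x ∈ edge z → x ∈ K → z ≡ x
          only {x} x∈ x∈K with z ℕ.≟ x
          ... | yes eq = eq
          ... | no ne  = ⊥-elim (¬p (lose x∈ (ne , x∈K)))

      others : List ℕ → List ℕ
      others zs = fresh ∖ zs

      others⊆ : ∀ zs → others zs ⊆ fresh
      others⊆ zs p = proj₁ (∈-∖⁻ {fresh} {zs} p)

      ∈-others : ∀ {z zs} → z ∈ others zs → ∀ {z′} → z′ ∈ zs → z ≢ z′
      ∈-others {zs = zs} p q refl = proj₂ (∈-∖⁻ {fresh} {zs} p) q

      others-≤ : ∀ {zs} → Unique zs → zs ⊆ fresh → suc (length zs) + length (others zs) ≤ r
      others-≤ {zs} u s = ℕ.≤-trans (s≤s (ℕ.≤-trans (ℕ.≤-reflexive (sym (List.length-++ zs)))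
        (unique-⊆⇒length≤ (Unique.++⁺ u (∖-unique fresh-unique) λ (a , b) → ∈-others {zs = zs} b a refl)
          λ p → [ s , others⊆ zs ]′ (Mem.∈-++⁻ zs p)))) fresh<r

      others-≥ : ∀ zs → r ≤ suc (length zs) + length (others zs)
      others-≥ zs = ℕ.≤-trans r≤fresh (s≤s (length-∖-≥ {fresh} {zs} fresh-unique))

      private
        K₁ = fresh ++ A

        gen-fresh : Gen (depth q) A 1 fresh
        gen-fresh = Gen-line₁ f v∈A (online f (short⊆long f v∈f)) v≢fresh fresh-online

        fresh-size : ∀ {N} → N ≤ 3 * (r * q) → length fresh + N ≤ size q r
        fresh-size {N} le = ℕ.≤-trans (ℕ.+-mono-≤ (ℕ.≤-trans length-fresh≤r (ℕ.m≤m*n r q {{ℕ.>-nonZero 1≤q}})) le)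
          (ℕ.≤-reflexive (eq (r * q)))
          where
          eq : ∀ n → n + 3 * n ≡ 4 * n
          eq = ℕ-solve-∀

        rest-size : ∀ {m N} → m ≤ r → N ≤ m * q → N ≤ r * q
        rest-size {m} m≤r le = ℕ.≤-trans le (ℕ.*-monoˡ-≤ q m≤r)

        others≤r : ∀ zs → length (others zs) ≤ r
        others≤r zs = ℕ.≤-trans (length-∖-≤ fresh zs) length-fresh≤r

        cover-∖ : ∀ z K → List ℕ
        cover-∖ z K = edge z ∖ K

        gen-cover₁ : ∀ {z K} → z ∈ fresh → z ∈ K → Gen (depth q) K 1 (cover-∖ z K)
        gen-cover₁ {z} {K} z∈ z∈K = Gen-line₁ (cover z) z∈K (online (cover z) (∈cover z∈))
          (λ { a refl → proj₂ (∈-∖⁻ {edge z} {K} a) z∈K }) (λ a → online (cover z) (proj₁ (∈-∖⁻ {edge z} {K} a)))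

        gen-cover₀ : ∀ {z c K} → z ∈ fresh → z ∈ K → c ∈ spanⁿ 2 (depth q) K → z ≢ c → Online (cover z) c →
          Gen (depth q) K 0 (cover-∖ z K)
        gen-cover₀ {z} {c} {K} z∈ z∈K c∈ ne oc = Gen-line₀ (cover z) (base⊆spanⁿ 2 z∈K) c∈ ne
          (online (cover z) (∈cover z∈)) oc (λ a → online (cover z) (proj₁ (∈-∖⁻ {edge z} {K} a)))

        new-cover : ∀ {z K} → z ∈ fresh → New V K (cover-∖ z K)
        new-cover z∈ = new-edge (cover∈ z∈)

        size-cover : ∀ z K → length (cover-∖ z K) ≤ r * q
        size-cover z K = ℕ.≤-trans (length-∖-pts (cover z) K) q≤rq

        size-++₃ : ∀ {a b c n} → a ≤ n → b ≤ n → c ≤ n → a + (b + c) ≤ 3 * n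
        size-++₃ {n = n} h k l = ℕ.≤-trans (ℕ.+-mono-≤ h (ℕ.+-mono-≤ k l)) (ℕ.≤-reflexive (eq n))
          where
          eq : ∀ n → n + (n + n) ≡ 3 * n
          eq = ℕ-solve-∀

      -- The meeting point is pinned down by one cover, so the other one costs no second free vertex.
      crossing : ∀ {z₁ z₂ y} → z₁ ∈ fresh → z₂ ∈ fresh → z₁ ≢ z₂ → y ∈ edge z₁ → y ∈ edge z₂ → ⊥
      crossing {z₁} {z₂} {y} z₁∈ z₂∈ ne y₁ y₂ = nk (kill
        (Gen-++ gen-fresh (Gen-++ (gen-cover₁ z₁∈ (Mem.∈-++⁺ˡ z₁∈)) (Gen-++ gen₂ C.gen)))
        (New-++ fresh-new (New-++ (new-cover z₁∈) (New-++ (new-cover z₂∈) C.new)))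
        (subst₂ (λ F N → F * cost q r < r * (N + q)) (frees C.free#) lengths
          (subst (λ k → (4 + C.free#) * cost q r < r * k) (reorder s M₁ M₂ N q)
          (light-covers 3 4 3 {s + M₁ + M₂} {N} {C.free#} {length zs} C.light (others-≥ (z₁ ∷ z₂ ∷ [])) bound (slack-≤ (ℕ.≤-refl {4}) (ℕ.≤-refl {4})))))
        (ℕ.≤-trans (ℕ.≤-reflexive (sym lengths′)) (fresh-size (size-++₃ (size-cover z₁ K₁) (size-cover z₂ K₂) (rest-size (others≤r (z₁ ∷ z₂ ∷ [])) C.short)))))
        where
        E₁ = cover-∖ z₁ K₁
        K₂ = E₁ ++ K₁
        E₂ = cover-∖ z₂ K₂
        K₃ = E₂ ++ K₂
        zs = others (z₁ ∷ z₂ ∷ [])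
        y∈K₂ : y ∈ K₂
        y∈K₂ with y ∈? K₁
        ... | yes p = Mem.∈-++⁺ʳ E₁ p
        ... | no ¬p = Mem.∈-++⁺ˡ (∈-∖⁺ y₁ ¬p)
        gen₂ : Gen (depth q) K₂ 0 E₂
        gen₂ = gen-cover₀ z₂∈ (Mem.∈-++⁺ʳ E₁ (Mem.∈-++⁺ˡ z₂∈)) (base⊆spanⁿ 2 y∈K₂)
          (λ { refl → ne (edge-fresh z₁∈ z₂∈ y₁) }) (online (cover z₂) y₂)
        split : ∀ {x} → x ∈ K₃ → x ∈ A ⊎ x ∈ fresh ⊎ ∃ λ e → e ∈ cover z₂ ∷ cover z₁ ∷ [] × x ∈ pts q e
        split p with Mem.∈-++⁻ E₂ p
        ... | inj₁ a = inj₂ (inj₂ (_ , here refl , proj₁ (∈-∖⁻ {edge z₂} {K₂} a)))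
        ... | inj₂ b with Mem.∈-++⁻ E₁ b
        ... | inj₁ c = inj₂ (inj₂ (_ , there (here refl) , proj₁ (∈-∖⁻ {edge z₁} {K₁} c)))
        ... | inj₂ d with Mem.∈-++⁻ fresh d
        ... | inj₁ g = inj₂ (inj₁ g)
        ... | inj₂ h = inj₁ h
        C = covers zs (cover z₂ ∷ cover z₁ ∷ []) K₃ (∖-unique fresh-unique) (others⊆ (z₁ ∷ z₂ ∷ [])) split
          (λ p → Mem.∈-++⁺ʳ E₂ (Mem.∈-++⁺ʳ E₁ (Mem.∈-++⁺ʳ fresh p)))
          (λ p → Mem.∈-++⁺ʳ E₂ (Mem.∈-++⁺ʳ E₁ (Mem.∈-++⁺ˡ p)))
          (λ { p (here refl) → edges-once (others⊆ (z₁ ∷ z₂ ∷ []) p) z₂∈ (∈-others p (there (here refl)))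
             ; p (there (here refl)) → edges-once (others⊆ (z₁ ∷ z₂ ∷ []) p) z₁∈ (∈-others p (here refl)) })
          (ℕ.≤-trans (ℕ.n≤1+n _) (others-≤ ((ne ∷ []) ∷ [] ∷ []) λ { (here refl) → z₁∈ ; (there (here refl)) → z₂∈ }))
        module C = Covers C
        s = length fresh
        M₁ = length E₁
        M₂ = length E₂
        N = length C.ys
        q≤M₁ : q ≤ suc M₁
        q≤M₁ = length-edge-∖ (cover∈ z₁∈) λ a b c d → trans (sym (own a b)) (own c d)
          where
          own : ∀ {x} → x ∈ edge z₁ → x ∈ K₁ → z₁ ≡ x
          own a b with Mem.∈-++⁻ fresh b
          ... | inj₁ g = edge-fresh z₁∈ g a
          ... | inj₂ h = ⊥-elim (edge-off z₁∈ a h)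
        q≤M₂ : q ≤ 2 + M₂
        q≤M₂ = subst (_≤ 2 + M₂) (length-pts q (cover z₂)) (length-∖-++ {K = K₁} {c = 1} (edge-unique z₂∈)
          (length-∖-meetsOnce (edge-unique z₂∈) λ a b c d → trans (sym (own a b)) (own c d)) {K′ = E₁}
          λ a b c d → edges-once z₂∈ z₁∈ (ne ∘ sym) a (proj₁ (∈-∖⁻ {edge z₁} {K₁} b)) c (proj₁ (∈-∖⁻ {edge z₁} {K₁} d)))
          where
          own : ∀ {x} → x ∈ edge z₂ → x ∈ K₁ → z₂ ≡ x
          own a b with Mem.∈-++⁻ fresh b
          ... | inj₁ g = edge-fresh z₂∈ g a
          ... | inj₂ h = ⊥-elim (edge-off z₂∈ a h)
        bound : r + 3 * q ≤ s + M₁ + M₂ + q + 4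
        bound = ℕ.≤-trans (ℕ.≤-trans (ℕ.≤-reflexive (eq₁ r q)) (ℕ.+-mono-≤ (ℕ.+-mono-≤ (ℕ.+-mono-≤ r≤fresh q≤M₁) q≤M₂) (ℕ.≤-refl {q})))
                  (ℕ.≤-reflexive (eq₂ s M₁ M₂ q))
          where
          eq₁ : ∀ r q → r + 3 * q ≡ r + q + q + q
          eq₁ = ℕ-solve-∀
          eq₂ : ∀ s a b q → suc s + suc a + (2 + b) + q ≡ s + a + b + q + 4
          eq₂ = ℕ-solve-∀
        frees : ∀ f → 4 + f ≡ (1 + (1 + (0 + f))) + 2
        frees = ℕ-solve-∀
        reorder : ∀ s a b n q → s + a + b + q + n ≡ (s + (a + (b + n))) + q
        reorder = ℕ-solve-∀
        lengths′ : s + (M₁ + (M₂ + N)) ≡ length (fresh ++ E₁ ++ E₂ ++ C.ys)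
        lengths′ = sym (trans (List.length-++ fresh) (cong (λ k → s + k) (trans (List.length-++ E₁) (cong (λ k → M₁ + k) (List.length-++ E₂)))))
        lengths : s + (M₁ + (M₂ + N)) ≡ length (fresh ++ E₁ ++ E₂ ++ C.ys)
        lengths = lengths′

      -- The cover of `z` is listed last: once the other covers are present, `z` and `c` determine
      -- it. By `crossing` it meets none of them, so it loses only `z` and its q - 1 other vertices
      -- come without a free one.
      pinned : ∀ {z c} → z ∈ fresh → z ≢ c → Online (cover z) c →
        (∀ {K} → A ⊆ K → (∀ {z′} → z′ ∈ fresh → z′ ≢ z → edge z′ ⊆ K) → c ∈ spanⁿ 2 (depth q) K) → ⊥
      pinned {z} {c} z∈ ne oc c∈ = nk (kill
        (Gen-++ gen-fresh (Gen-++ C.gen gen-z))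
        (New-++ fresh-new (New-++ C.new (new-cover z∈)))
        (subst₂ (λ F N → F * cost q r < r * (N + q)) (frees C.free#) lengths
          (subst (λ k → (3 + C.free#) * cost q r < r * k) (reorder s M N q)
          (light-covers 2 2 2 {s + M} {N} {C.free#} {length zs} C.light (others-≥ [ z ]) bound (slack-≤ {2} {2} {3} (ℕ.n≤1+n 2) (ℕ.≤-refl {3})))))
        (ℕ.≤-trans (ℕ.≤-reflexive (sym lengths)) (fresh-size (ℕ.≤-trans (ℕ.+-mono-≤ (rest-size (others≤r [ z ]) C.short) (size-cover z K₂))
          (ℕ.≤-trans (ℕ.≤-reflexive (sym (cong (λ k → r * q + k) (ℕ.+-identityʳ (r * q))))) (ℕ.*-monoˡ-≤ (r * q) {2} {3} (ℕ.n≤1+n 2)))))))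
        where
        zs = others [ z ]
        C = covers zs [] K₁ (∖-unique fresh-unique) (others⊆ [ z ])
          (λ p → [ (λ g → inj₂ (inj₁ g)) , inj₁ ]′ (Mem.∈-++⁻ fresh p))
          (Mem.∈-++⁺ʳ fresh) Mem.∈-++⁺ˡ (λ _ ()) (others≤r [ z ])
        module C = Covers C
        K₂ = C.ys ++ K₁
        E = cover-∖ z K₂
        gen-z : Gen (depth q) K₂ 0 E
        gen-z = gen-cover₀ z∈ (Mem.∈-++⁺ʳ C.ys (Mem.∈-++⁺ˡ z∈))
          (c∈ (λ p → Mem.∈-++⁺ʳ C.ys (Mem.∈-++⁺ʳ fresh p)) (λ z′∈ z′≢ → C.all (∈-∖⁺ z′∈ λ { (here eq) → z′≢ eq }))) ne oc
        s = length fresh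
        M = length E
        N = length C.ys
        q≤M : q ≤ suc M
        q≤M = length-edge-∖ (cover∈ z∈) λ a b c d → trans (sym (own a b)) (own c d)
          where
          own : ∀ {x} → x ∈ edge z → x ∈ K₂ → z ≡ x
          own a b with Mem.∈-++⁻ C.ys b
          ... | inj₁ g = let z′ , z′∈ , x∈ = C.from g in
                  ⊥-elim (crossing z∈ (others⊆ [ z ] z′∈) (λ eq → ∈-others z′∈ (here refl) (sym eq)) a x∈)
          ... | inj₂ h with Mem.∈-++⁻ fresh h
          ... | inj₁ g = edge-fresh z∈ g a
          ... | inj₂ k = ⊥-elim (edge-off z∈ a k)
        bound : r + 2 * q ≤ s + M + q + 2
        bound = ℕ.≤-trans (ℕ.≤-trans (ℕ.≤-reflexive (eq₁ r q)) (ℕ.+-mono-≤ (ℕ.+-mono-≤ r≤fresh q≤M) (ℕ.≤-refl {q})))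
                  (ℕ.≤-reflexive (eq₂ s M q))
          where
          eq₁ : ∀ r q → r + 2 * q ≡ r + q + q
          eq₁ = ℕ-solve-∀
          eq₂ : ∀ s a q → suc s + suc a + q ≡ s + a + q + 2
          eq₂ = ℕ-solve-∀
        frees : ∀ f → 3 + f ≡ (1 + (f + 0)) + 2
        frees = ℕ-solve-∀
        reorder : ∀ s a n q → s + a + q + n ≡ (s + (n + a)) + q
        reorder = ℕ-solve-∀
        lengths : s + (N + M) ≡ length (fresh ++ C.ys ++ E)
        lengths = sym (trans (List.length-++ fresh) (cong (λ k → s + k) (List.length-++ C.ys)))

      -- Two covers determine two points of `e`, hence all of it, and `e` loses at most one vertex
      -- to each of them. The last hypothesis ensures that a fresh vertex on `e` is already among
      -- these losses.
      transversal : ∀ {e z₁ z₂ x y} → e ∈ Lfam → z₁ ∈ fresh → z₂ ∈ fresh → z₁ ≢ z₂ →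
        x ∈ pts q e → y ∈ pts q e → x ≢ y →
        Online (cover z₁) x ⊎ Online (cover z₂) x → Online (cover z₁) y ⊎ Online (cover z₂) y →
        (∀ {z} → z ∈ fresh → ¬ Share q (cover z) e) → (∀ {x} → x ∈ pts q e → x ∉ A) →
        (∀ {x} → x ∈ pts q e → x ∈ fresh → x ∈ edge z₁) → ⊥
      transversal {e} {z₁} {z₂} {x} {y} e∈ z₁∈ z₂∈ ne x∈ y∈ x≢y ox oy ¬s e-off e-fresh = nk (kill
        (Gen-++ gen-fresh (Gen-++ (gen-cover₁ z₁∈ (Mem.∈-++⁺ˡ z₁∈)) (Gen-++ (gen-cover₁ z₂∈ (Mem.∈-++⁺ʳ E₁ (Mem.∈-++⁺ˡ z₂∈)))
          (Gen-++ gen-e C.gen))))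
        (New-++ fresh-new (New-++ (new-cover z₁∈) (New-++ (new-cover z₂∈) (New-++ (new-edge e∈) C.new))))
        (subst₂ (λ F N → F * cost q r < r * (N + q)) (frees C.free#) lengths
          (subst (λ k → (5 + C.free#) * cost q r < r * k) (reorder s M₁ M₂ M₃ N q)
          (light-covers 4 5 3 {s + M₁ + M₂ + M₃} {N} {C.free#} {length zs} C.light (others-≥ (z₁ ∷ z₂ ∷ [])) bound (slack-≤ {5} {3} {5} ℕ.≤-refl (ℕ.n≤1+n 4)))))
        (ℕ.≤-trans (ℕ.≤-reflexive (sym lengths)) (fresh-size (ℕ.≤-trans (ℕ.≤-reflexive (pack M₁ M₂ M₃ N))
          (ℕ.≤-trans (ℕ.+-mono-≤ 3q≤ (rest-size (others≤r (z₁ ∷ z₂ ∷ [])) C.short))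
            (ℕ.≤-trans (ℕ.≤-reflexive (cong (λ k → r * q + k) (sym (ℕ.+-identityʳ (r * q))))) (ℕ.*-monoˡ-≤ (r * q) {2} {3} (ℕ.n≤1+n 2))))))))
        where
        E₁ = cover-∖ z₁ K₁
        K₂ = E₁ ++ K₁
        E₂ = cover-∖ z₂ K₂
        K₃ = E₂ ++ K₂
        E₃ = pts q e ∖ K₃
        K₄ = E₃ ++ K₃
        zs = others (z₁ ∷ z₂ ∷ [])
        ∈K₂ : edge z₁ ⊆ K₂
        ∈K₂ {u} p with u ∈? K₁
        ... | yes k = Mem.∈-++⁺ʳ E₁ k
        ... | no k  = Mem.∈-++⁺ˡ (∈-∖⁺ p k)
        ∈K₃ : edge z₂ ⊆ K₃
        ∈K₃ {u} p with u ∈? K₂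
        ... | yes k = Mem.∈-++⁺ʳ E₂ k
        ... | no k  = Mem.∈-++⁺ˡ (∈-∖⁺ p k)
        spanned : ∀ {u} → Online (cover z₁) u ⊎ Online (cover z₂) u → u ∈ spanⁿ 2 (depth q) K₃
        spanned (inj₁ o) = let a , b , a∈ , b∈ , a≢b = distinct q (cover z₁) (long≥1 (cover∈ z₁∈)) 2≤q in
          ⊆-span (determined {h = 0} {e = cover z₁} (Mem.∈-++⁺ʳ E₂ (∈K₂ a∈)) (Mem.∈-++⁺ʳ E₂ (∈K₂ b∈)) a≢b (online (cover z₁) a∈) (online (cover z₁) b∈) o)
        spanned (inj₂ o) = let a , b , a∈ , b∈ , a≢b = distinct q (cover z₂) (long≥1 (cover∈ z₂∈)) 2≤q in
          ⊆-span (determined {h = 0} {e = cover z₂} (∈K₃ a∈) (∈K₃ b∈) a≢b (online (cover z₂) a∈) (online (cover z₂) b∈) o)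
        gen-e : Gen (depth q) K₃ 0 E₃
        gen-e = Gen-line₀ e (spanned ox) (spanned oy) x≢y (online e x∈) (online e y∈)
          (λ a → online e (proj₁ (∈-∖⁻ {pts q e} {K₃} a)))
        split₃ : ∀ {x} → x ∈ K₃ → x ∈ A ⊎ x ∈ fresh ⊎ ∃ λ e → e ∈ cover z₂ ∷ cover z₁ ∷ [] × x ∈ pts q e
        split₃ p with Mem.∈-++⁻ E₂ p
        ... | inj₁ a = inj₂ (inj₂ (_ , here refl , proj₁ (∈-∖⁻ {edge z₂} {K₂} a)))
        ... | inj₂ b with Mem.∈-++⁻ E₁ b
        ... | inj₁ c = inj₂ (inj₂ (_ , there (here refl) , proj₁ (∈-∖⁻ {edge z₁} {K₁} c)))
        ... | inj₂ d with Mem.∈-++⁻ fresh d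
        ... | inj₁ g = inj₂ (inj₁ g)
        ... | inj₂ h = inj₁ h
        split : ∀ {x} → x ∈ K₄ → x ∈ A ⊎ x ∈ fresh ⊎ ∃ λ e′ → e′ ∈ e ∷ cover z₂ ∷ cover z₁ ∷ [] × x ∈ pts q e′
        split p with Mem.∈-++⁻ E₃ p
        ... | inj₁ a = inj₂ (inj₂ (_ , here refl , proj₁ (∈-∖⁻ {pts q e} {K₃} a)))
        ... | inj₂ b with split₃ b
        ... | inj₁ c = inj₁ c
        ... | inj₂ (inj₁ c) = inj₂ (inj₁ c)
        ... | inj₂ (inj₂ (e′ , e′∈ , c)) = inj₂ (inj₂ (e′ , there e′∈ , c))
        C = covers zs (e ∷ cover z₂ ∷ cover z₁ ∷ []) K₄ (∖-unique fresh-unique) (others⊆ (z₁ ∷ z₂ ∷ [])) split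
          (λ p → Mem.∈-++⁺ʳ E₃ (Mem.∈-++⁺ʳ E₂ (Mem.∈-++⁺ʳ E₁ (Mem.∈-++⁺ʳ fresh p))))
          (λ p → Mem.∈-++⁺ʳ E₃ (Mem.∈-++⁺ʳ E₂ (Mem.∈-++⁺ʳ E₁ (Mem.∈-++⁺ˡ p))))
          (λ { p (here refl) → ¬share⇒meetsOnce (¬s (others⊆ (z₁ ∷ z₂ ∷ []) p))
             ; p (there (here refl)) → edges-once (others⊆ (z₁ ∷ z₂ ∷ []) p) z₂∈ (∈-others p (there (here refl)))
             ; p (there (there (here refl))) → edges-once (others⊆ (z₁ ∷ z₂ ∷ []) p) z₁∈ (∈-others p (here refl)) })
          (others-≤ ((ne ∷ []) ∷ [] ∷ []) λ { (here refl) → z₁∈ ; (there (here refl)) → z₂∈ })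
        module C = Covers C
        s = length fresh
        M₁ = length E₁
        M₂ = length E₂
        M₃ = length E₃
        N = length C.ys
        own₁ : ∀ {z u} → z ∈ fresh → u ∈ edge z → u ∈ K₁ → z ≡ u
        own₁ z∈ a b with Mem.∈-++⁻ fresh b
        ... | inj₁ g = edge-fresh z∈ g a
        ... | inj₂ h = ⊥-elim (edge-off z∈ a h)
        q≤M₁ : q ≤ suc M₁
        q≤M₁ = length-edge-∖ (cover∈ z₁∈) λ a b c d → trans (sym (own₁ z₁∈ a b)) (own₁ z₁∈ c d)
        q≤M₂ : q ≤ suc M₂
        q≤M₂ = length-edge-∖ (cover∈ z₂∈) λ a b c d → trans (sym (own a b)) (own c d)
          where
          own : ∀ {u} → u ∈ edge z₂ → u ∈ K₂ → z₂ ≡ u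
          own a b with Mem.∈-++⁻ E₁ b
          ... | inj₁ g = ⊥-elim (crossing z₂∈ z₁∈ (ne ∘ sym) a (proj₁ (∈-∖⁻ {edge z₁} {K₁} g)))
          ... | inj₂ h = own₁ z₂∈ a h
        q≤M₃ : q ≤ 2 + M₃
        q≤M₃ = ℕ.≤-trans (subst (_≤ 2 + length (pts q e ∖ stack q (cover z₂ ∷ cover z₁ ∷ []) A)) (length-pts q e)
            (length-∖-stack (cover z₂ ∷ cover z₁ ∷ []) {A} {0} e-unique
              (λ { (here refl) → ¬share⇒meetsOnce (¬s z₂∈ ∘ share-sym) ; (there (here refl)) → ¬share⇒meetsOnce (¬s z₁∈ ∘ share-sym) })
              (ℕ.≤-reflexive (cong length (sym (∖-all (pts q e) e-off))))))
          (ℕ.+-monoʳ-≤ 2 (unique-⊆⇒length≤ (∖-unique e-unique) λ p →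
            let u∈ , u∉ = ∈-∖⁻ {pts q e} {stack q (cover z₂ ∷ cover z₁ ∷ []) A} p in ∈-∖⁺ u∈ λ k → u∉ (to-stack u∈ (split₃ k))))
          where
          e-unique = pts-unique q e (long≥1 e∈)
          to-stack : ∀ {u} → u ∈ pts q e → u ∈ A ⊎ u ∈ fresh ⊎ ∃ (λ e → e ∈ cover z₂ ∷ cover z₁ ∷ [] × u ∈ pts q e) →
            u ∈ stack q (cover z₂ ∷ cover z₁ ∷ []) A
          to-stack u∈ (inj₁ a) = Mem.∈-++⁺ʳ (edge z₂) (Mem.∈-++⁺ʳ (edge z₁) a)
          to-stack u∈ (inj₂ (inj₁ b)) = Mem.∈-++⁺ʳ (edge z₂) (Mem.∈-++⁺ˡ (e-fresh u∈ b))
          to-stack u∈ (inj₂ (inj₂ (_ , here refl , c))) = Mem.∈-++⁺ˡ c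
          to-stack u∈ (inj₂ (inj₂ (_ , there (here refl) , c))) = Mem.∈-++⁺ʳ (edge z₂) (Mem.∈-++⁺ˡ c)
        bound : r + 4 * q ≤ s + M₁ + M₂ + M₃ + q + 5
        bound = ℕ.≤-trans (ℕ.≤-trans (ℕ.≤-reflexive (eq₁ r q)) (ℕ.+-mono-≤ (ℕ.+-mono-≤ (ℕ.+-mono-≤ (ℕ.+-mono-≤ r≤fresh q≤M₁) q≤M₂) q≤M₃) (ℕ.≤-refl {q})))
                  (ℕ.≤-reflexive (eq₂ s M₁ M₂ M₃ q))
          where
          eq₁ : ∀ r q → r + 4 * q ≡ r + q + q + q + q
          eq₁ = ℕ-solve-∀
          eq₂ : ∀ s a b c q → suc s + suc a + suc b + (2 + c) + q ≡ s + a + b + c + q + 5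
          eq₂ = ℕ-solve-∀
        3q≤ : M₁ + M₂ + M₃ ≤ r * q
        3q≤ = ℕ.≤-trans (ℕ.+-mono-≤ (ℕ.+-mono-≤ (length-∖-pts (cover z₁) K₁) (length-∖-pts (cover z₂) K₂)) (length-∖-pts e K₃))
                (ℕ.≤-trans (ℕ.≤-reflexive (eq q)) (ℕ.*-monoˡ-≤ q 3≤r))
          where
          eq : ∀ q → q + q + q ≡ 3 * q
          eq = ℕ-solve-∀
        pack : ∀ a b c n → a + (b + (c + n)) ≡ a + b + c + n
        pack = ℕ-solve-∀
        frees : ∀ f → 5 + f ≡ (1 + (1 + (1 + (0 + f)))) + 2
        frees = ℕ-solve-∀
        reorder : ∀ s a b c n q → s + a + b + c + q + n ≡ (s + (a + (b + (c + n)))) + q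
        reorder = ℕ-solve-∀
        lengths : s + (M₁ + (M₂ + (M₃ + N))) ≡ length (fresh ++ E₁ ++ E₂ ++ E₃ ++ C.ys)
        lengths = sym (trans (List.length-++ fresh) (cong (λ k → s + k) (trans (List.length-++ E₁) (cong (λ k → M₁ + k)
          (trans (List.length-++ E₂) (cong (λ k → M₂ + k) (List.length-++ E₃)))))))

open CoverCounting

-- The regular step.

module RegularExtensions where

  module _ {q r : ℕ} (H : Hypergraph q r) where

    open Colouring H

    record Regular (A : List ℕ) (v : ℕ) : Set where
      field
        xs    : List ℕ
        β     : List ℕ
        -- Generated from `v` alone: determined vertices then have boundedly many candidates,
        -- whereas candidates from all of `A` would add a factor growing with n that the constant c
        -- could not offset.
        gen   : Gen (depth q) [ v ] r xs
        new   : New V A xs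
        many  : cost q r ≤ length xs
        short : length xs ≤ size q r
        state : State (xs ++ A) β

  module _ {q r : ℕ} (H : Hypergraph q r) (nsk : ¬ Geometry.StartKill H) where

    open Colouring H
    open Steps nsk

    module Generic {A β f v} (S : State A β) (nk : ¬ Kill A)
      (saturated : ∀ {e x} → e ∈ Lfam → x ∈ pts q e → x ∈ A → pts q e ⊆ A)
      (v∈A : v ∈ A) (f∈ : f ∈ Sfam) (v∈f : v ∈ pts r f) (f⊈A : ¬ (pts r f ⊆ A))
      (only-v : ∀ {x} → x ∈ pts r f → x ∈ A → v ≡ x)
      (unaligned : ¬ ShortSteps.AtShort.Aligned H nsk S nk saturated v∈A f∈ v∈f f⊈A) where

      open State S
      open ShortSteps.AtShort H nsk S nk saturated v∈A f∈ v∈f f⊈A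
      open RegularSteps.AtShort H nsk S nk saturated v∈A f∈ v∈f f⊈A only-v unaligned

      -- Generation and freshness refer to different sets: `G` leaves out the explored vertices, and
      -- `K` includes them.
      record Lines (G K zs : List ℕ) : Set where
        field
          {ys}  : List ℕ
          gen   : Gen (depth q) G (length zs) ys
          new   : New V K ys
          short : length ys ≤ length zs * (2 * q)
          from  : ∀ {y} → y ∈ ys → ∃ λ z → z ∈ zs × y ∈ line (cover z)
          all   : ∀ {z} → z ∈ zs → line (cover z) ⊆ ys ++ K

      lines : ∀ G K zs → zs ⊆ fresh → zs ⊆ G → zs ⊆ K → Lines G K zs
      lines G K [] _ _ _ = record { gen = done ; new = New-[] ; short = z≤n ; from = λ () ; all = λ () }
      lines G K (z ∷ zs) zs⊆ zs⊆G zs⊆K = record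
        { gen = Gen-++ (Gen-line₁ (cover z) (zs⊆G (here refl)) (online (cover z) (∈cover z∈))
                  (λ { p refl → proj₂ (∈-∖⁻ {line (cover z)} {K} p) (zs⊆K (here refl)) })
                  (λ p → line-online (proj₁ (∈-∖⁻ {line (cover z)} {K} p)))) R.gen
        ; new = New-++ (New-∖ (line-unique (cover z)) (line⊆V {cover z})) R.new
        ; short = ℕ.≤-trans (ℕ.≤-reflexive (List.length-++ ns))
            (ℕ.+-mono-≤ (ℕ.≤-trans (length-∖-≤ (line (cover z)) K) (length-line (cover z))) R.short)
        ; from = λ p → [ (λ a → z , here refl , proj₁ (∈-∖⁻ {line (cover z)} {K} a)) ,
                         (λ b → let z′ , z′∈ , y∈ = R.from b in z′ , there z′∈ , y∈) ]′ (Mem.∈-++⁻ ns p)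
        ; all = all′
        }
        where
        z∈ = zs⊆ (here refl)
        ns = line (cover z) ∖ K
        module R = Lines (lines (ns ++ G) (ns ++ K) zs (zs⊆ ∘ there)
          (λ p → Mem.∈-++⁺ʳ ns (zs⊆G (there p))) (λ p → Mem.∈-++⁺ʳ ns (zs⊆K (there p))))
        all′ : ∀ {z′} → z′ ∈ z ∷ zs → line (cover z′) ⊆ (ns ++ R.ys) ++ K
        all′ (here refl) {x} p with x ∈? K
        ... | yes x∈K = Mem.∈-++⁺ʳ (ns ++ R.ys) x∈K
        ... | no x∉K  = Mem.∈-++⁺ˡ (Mem.∈-++⁺ˡ (∈-∖⁺ p x∉K))
        all′ (there z′∈) p with Mem.∈-++⁻ R.ys (R.all z′∈ p)
        ... | inj₁ a = Mem.∈-++⁺ˡ (Mem.∈-++⁺ʳ ns a)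
        ... | inj₂ b with Mem.∈-++⁻ ns b
        ... | inj₁ c = Mem.∈-++⁺ˡ (Mem.∈-++⁺ˡ c)
        ... | inj₂ d = Mem.∈-++⁺ʳ (ns ++ R.ys) d

      -- The lines and hitting sets are kept as parameters so that they are not unfolded.
      module WithLines (all-lines : Lines (fresh ++ [ v ]) (fresh ++ A) fresh)
        (avoiding : ∀ z → Σ (Hitting q (Parallel (cover z)) (r ∸ 1)) λ Z → z ∉ Hitting.blues Z) where

        module All-lines = Lines all-lines
        xs = fresh ++ All-lines.ys

        in-line : ∀ {z} → z ∈ fresh → line (cover z) ⊆ xs
        in-line z∈ p with Mem.∈-++⁻ All-lines.ys (All-lines.all z∈ p)
        ... | inj₁ a = Mem.∈-++⁺ʳ fresh a
        ... | inj₂ b with Mem.∈-++⁻ fresh b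
        ... | inj₁ c = Mem.∈-++⁺ˡ c
        ... | inj₂ d = ⊥-elim (line-off (cover∈ z∈) (∈cover z∈) (fresh∉A z∈) p d)

        from-line : ∀ {x} → x ∈ xs → ∃ λ z → z ∈ fresh × x ∈ line (cover z)
        from-line p with Mem.∈-++⁻ fresh p
        ... | inj₁ a = _ , a , edge⊆line (cover∈ a) (∈cover a)
        ... | inj₂ b = All-lines.from b

        edges-unique : ∀ zs → Unique zs → zs ⊆ fresh → Unique (concatMap edge zs)
        edges-unique [] _ _ = []
        edges-unique (z ∷ zs) (z∉ ∷ u) s = Unique.++⁺ (edge-unique (s (here refl))) (edges-unique zs u (s ∘ there)) disjoint
          where
          disjoint : ∀ {x} → x ∈ edge z × x ∈ concatMap edge zs → ⊥
          disjoint (a , b) with find (Mem.∈-concatMap⁻ edge {xs = zs} b)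
          ... | z′ , z′∈ , c = crossing (s (here refl)) (s (there z′∈)) (All.lookup z∉ z′∈) a c

        length-edges : ∀ zs → length (concatMap edge zs) ≡ length zs * q
        length-edges [] = refl
        length-edges (z ∷ zs) = trans (List.length-++ (edge z)) (cong₂ _+_ (length-pts q (cover z)) (length-edges zs))

        another : ∀ {z} → z ∈ fresh → ∃ λ z′ → z′ ∈ fresh × z ≢ z′
        another {z} z∈ with two∈ fresh-unique (ℕ.+-cancelˡ-≤ 1 _ _ (ℕ.≤-trans 3≤r r≤fresh))
        ... | a , b , a∈ , b∈ , a≢b with z ℕ.≟ a
        ... | yes refl = b , b∈ , a≢b
        ... | no ne    = a , a∈ , ne

        -- An edge sharing two vertices with no cover would be a transversal. If it contains a fresh
        -- vertex, that vertex is taken as one of the two points and its cover as the first one, so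
        -- that no other fresh vertex of `e` escapes the count.
        two : ∀ {e x y} → e ∈ Lfam → x ∈ pts q e → y ∈ pts q e → x ≢ y → x ∈ xs ++ A → y ∈ xs ++ A →
          pts q e ⊆ A ⊎ ∃ λ z → z ∈ fresh × Share q (cover z) e
        two {e} {x} {y} e∈ x∈ y∈ x≢y x∈′ y∈′ with case-old {e} e∈ x∈ y∈ x∈′ y∈′ | Any.any? (λ z → share? q (cover z) e) fresh
        ... | inj₁ s | _ = inj₁ s
        ... | inj₂ _ | yes p = inj₂ (find p)
        ... | inj₂ (x∈xs , y∈xs , x∉) | no ¬p = ⊥-elim (contradiction (Any.any? (_∈? pts q e) fresh))
          where
          ¬s : ∀ {z} → z ∈ fresh → ¬ Share q (cover z) e
          ¬s z∈ s = ¬p (lose z∈ s)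
          go : ∀ {z₁ z₂ u w} → z₁ ∈ fresh → z₂ ∈ fresh → u ∈ pts q e → w ∈ pts q e → u ≢ w →
            u ∈ line (cover z₁) → w ∈ line (cover z₂) → (∀ {x} → x ∈ pts q e → x ∈ fresh → x ∈ edge z₁) → ⊥
          go {z₁} {z₂} z₁∈ z₂∈ u∈ w∈ ne ul wl cond with z₁ ℕ.≟ z₂
          ... | no z≢ = transversal e∈ z₁∈ z₂∈ z≢ u∈ w∈ ne (inj₁ (line-online ul)) (inj₂ (line-online wl)) ¬s (off e∈ x∈ x∉) cond
          -- Both points lie on the line of one cover; an arbitrary second cover completes the
          -- configuration.
          ... | yes refl = let z₃ , z₃∈ , z≢ = another z₁∈ in
            transversal e∈ z₁∈ z₃∈ z≢ u∈ w∈ ne (inj₁ (line-online ul)) (inj₁ (line-online wl)) ¬s (off e∈ x∈ x∉) cond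
          contradiction : Dec (Any (_∈ pts q e) fresh) → ⊥
          contradiction (no ¬m) = let z₁ , z₁∈ , xl = from-line x∈xs ; z₂ , z₂∈ , yl = from-line y∈xs in
            go z₁∈ z₂∈ x∈ y∈ x≢y xl yl λ u∈ u∈f → ⊥-elim (¬m (lose u∈f u∈))
          contradiction (yes m) with find m
          ... | z , z∈ , z∈e with z ℕ.≟ x
          ... | no z≢x = let z₂ , z₂∈ , xl = from-line x∈xs in
            go z∈ z₂∈ z∈e x∈ z≢x (edge⊆line (cover∈ z∈) (∈cover z∈)) xl only-z
            where
            only-z : ∀ {u} → u ∈ pts q e → u ∈ fresh → u ∈ edge z
            only-z {u} u∈ u∈f with z ℕ.≟ u
            ... | yes refl = ∈cover z∈
            ... | no ne = ⊥-elim (apart e∈ z∈ u∈f ne z∈e (edge⊆line e∈ u∈))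
          ... | yes refl = let z₂ , z₂∈ , yl = from-line y∈xs in
            go z∈ z₂∈ z∈e y∈ x≢y (edge⊆line (cover∈ z∈) (∈cover z∈)) yl only-z
            where
            only-z : ∀ {u} → u ∈ pts q e → u ∈ fresh → u ∈ edge z
            only-z {u} u∈ u∈f with z ℕ.≟ u
            ... | yes refl = ∈cover z∈
            ... | no ne = ⊥-elim (apart e∈ z∈ u∈f ne z∈e (edge⊆line e∈ u∈))

        module Z (z : ℕ) = Hitting (proj₁ (avoiding z))

        blue-line : ∀ {z c} → c ∈ Z.blues z → c ∈ line (cover z)
        blue-line {z} b with Z.covered z b
        ... | e , e∈ , c∈ with Mem.∈-filter⁻ (share? q (cover z)) e∈
        ... | e∈L , s = ∈-line⁺ e∈L s c∈

        new-blues = concatMap Z.blues fresh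

        new-blue⁻ : ∀ {c} → c ∈ new-blues → ∃ λ z → z ∈ fresh × c ∈ Z.blues z
        new-blue⁻ p = find (Mem.∈-concatMap⁻ Z.blues {xs = fresh} p)

        -- If two vertices of `g` lie outside the blue set of `z`, they come from `A` or from other
        -- covers and determine `c` on the line of the cover of `z`. Otherwise `g` runs along this
        -- line, and a vertex outside the blue set, which exists because that set has at most r - 1
        -- elements, takes the place of `c`. Both cases are excluded by `pinned`.
        no-blue : ∀ {g z c} → g ∈ Sfam → pts r g ⊆ new-blues ++ β → z ∈ fresh → c ∈ pts r g → c ∈ Z.blues z → ⊥
        no-blue {g} {z} {c} g∈ all z∈ c∈ c∈b with two-outside-or-two-inside g∈ (Z.blues z)
        ... | inj₁ len with two∈ (∖-unique (pts-unique r g (short≥1 g∈))) len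
        ... | x , y , x∈ , y∈ , x≢y with ∈-∖⁻ {pts r g} {Z.blues z} x∈ | ∈-∖⁻ {pts r g} {Z.blues z} y∈
        ... | x∈g , x∉ | y∈g , y∉ = pinned z∈ (λ { refl → proj₂ (avoiding z) c∈b }) (line-online (blue-line c∈b))
                λ A⊆ edges⊆ → determined {h = 1} {e = g} (spanned x∈g x∉ A⊆ edges⊆) (spanned y∈g y∉ A⊆ edges⊆) x≢y
                  (online g (short⊆long g x∈g)) (online g (short⊆long g y∈g)) (online g (short⊆long g c∈))
          where
          spanned : ∀ {x} → x ∈ pts r g → x ∉ Z.blues z → ∀ {K} → A ⊆ K → (∀ {z′} → z′ ∈ fresh → z′ ≢ z → edge z′ ⊆ K) →
            x ∈ spanⁿ 1 (depth q) K
          spanned x∈g x∉ A⊆ edges⊆ with Mem.∈-++⁻ new-blues (all x∈g)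
          ... | inj₂ x∈β = ⊆-span (A⊆ (β⊆A x∈β))
          ... | inj₁ x∈b with new-blue⁻ x∈b
          ... | z′ , z′∈ , x∈Z with distinct q (cover z′) (long≥1 (cover∈ z′∈)) 2≤q
          ... | a , b , a∈ , b∈ , a≢b = determined {h = 0} {e = cover z′} (edges⊆ z′∈ (λ { refl → x∉ x∈Z }) a∈)
                  (edges⊆ z′∈ (λ { refl → x∉ x∈Z }) b∈) a≢b (online (cover z′) a∈) (online (cover z′) b∈) (line-online (blue-line x∈Z))
        no-blue {g} {z} {c} g∈ all z∈ c∈ c∈b | inj₂ (u , w , u∈g , w∈g , u∈b , w∈b , u≢w)
          with one∈ (short-outside (Z.blues z) g∈ (Z.small z) 1≤r)
        ... | x , x∈ with ∈-∖⁻ {pts r g} {Z.blues z} x∈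
        ... | x∈g , x∉ with Mem.∈-++⁻ new-blues (all x∈g)
        ... | inj₂ x∈β = pinned z∈ (λ { refl → fresh∉A z∈ (β⊆A x∈β) }) on λ A⊆ _ → base⊆spanⁿ 2 (A⊆ (β⊆A x∈β))
          where
          on = online-ext g (short⊆long g u∈g) (short⊆long g w∈g) u≢w (line-onLine (blue-line u∈b)) (line-onLine (blue-line w∈b)) (short⊆long g x∈g)
        ... | inj₁ x∈b with new-blue⁻ x∈b
        ... | z′ , z′∈ , x∈Z with distinct q (cover z′) (long≥1 (cover∈ z′∈)) 2≤q
        ... | a , b , a∈ , b∈ , a≢b = pinned z∈ z≢x on λ A⊆ edges⊆ → ⊆-span (determined {h = 0} {e = cover z′} (edges⊆ z′∈ z′≢z a∈)
                  (edges⊆ z′∈ z′≢z b∈) a≢b (online (cover z′) a∈) (online (cover z′) b∈) (line-online (blue-line x∈Z)))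
          where
          on = online-ext g (short⊆long g u∈g) (short⊆long g w∈g) u≢w (line-onLine (blue-line u∈b)) (line-onLine (blue-line w∈b)) (short⊆long g x∈g)
          z′≢z : z′ ≢ z
          z′≢z refl = x∉ x∈Z
          z≢x : z ≢ x
          z≢x refl = apart (cover∈ z′∈) z′∈ z∈ z′≢z (∈cover z′∈) (blue-line x∈Z)

        regular : Regular H A v
        regular = record
          { xs = xs
          ; β = new-blues ++ β
          ; gen = Gen-weaken fresh<r (Gen-++ {f = 1} (Gen-line₁ f (here refl) (online f (short⊆long f v∈f)) v≢fresh fresh-online) All-lines.gen)
          ; new = New-++ fresh-new All-lines.new
          ; many = ℕ.≤-trans (ℕ.≤-trans (ℕ.≤-reflexive (ℕ.*-comm q (r ∸ 1)))
              (ℕ.*-monoˡ-≤ q (ℕ.∸-monoˡ-≤ 1 r≤fresh)))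
              (ℕ.≤-trans (ℕ.≤-reflexive (sym (length-edges fresh))) (unique-⊆⇒length≤ (edges-unique fresh fresh-unique id) λ p →
                let z , z∈ , x∈ = find (Mem.∈-concatMap⁻ edge {xs = fresh} p) in in-line z∈ (edge⊆line (cover∈ z∈) x∈)))
          ; short = ℕ.≤-trans (ℕ.≤-reflexive (List.length-++ fresh)) (ℕ.≤-trans (ℕ.+-mono-≤
              (ℕ.≤-trans length-fresh≤r (ℕ.m≤m*n r q {{ℕ.>-nonZero 1≤q}})) (ℕ.≤-trans All-lines.short (ℕ.*-monoˡ-≤ (2 * q) length-fresh≤r)))
              (ℕ.≤-trans (ℕ.≤-reflexive (arith r q)) (ℕ.*-monoˡ-≤ (r * q) (ℕ.n≤1+n 3))))
          ; state = record
            { closed = λ e∈ x∈ y∈ ne x∈′ y∈′ p → case two e∈ x∈ y∈ ne x∈′ y∈′ of λ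
                { (inj₁ s) → Mem.∈-++⁺ʳ xs (s p)
                ; (inj₂ (z , z∈ , sh)) → Mem.∈-++⁺ˡ (in-line z∈ (∈-line⁺ e∈ sh p)) }
            ; hit = hit′
            ; β⊆A = λ p → [ (λ b → let z , z∈ , c∈ = new-blue⁻ b in Mem.∈-++⁺ˡ (in-line z∈ (blue-line c∈))) ,
                            (λ b → Mem.∈-++⁺ʳ xs (β⊆A b)) ]′ (Mem.∈-++⁻ new-blues p)
            ; noBlue = λ {g} g∈ all → case Any.any? (_∈? new-blues) (pts r g) of λ
                { (yes p) → let c , c∈ , c∈b = find p ; z , z∈ , c∈Z = new-blue⁻ c∈b in no-blue g∈ all z∈ c∈ c∈Z
                ; (no ¬p) → noBlue g∈ λ x∈ → [ (λ b → ⊥-elim (¬p (lose x∈ b))) , id ]′ (Mem.∈-++⁻ new-blues (all x∈)) }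
            }
          }
          where
          arith : ∀ r q → r * q + r * (2 * q) ≡ 3 * (r * q)
          arith = ℕ-solve-∀
          hit′ : ∀ {e} → e ∈ Lfam → pts q e ⊆ xs ++ A → ∃ λ x → x ∈ pts q e × x ∈ new-blues ++ β
          hit′ {e} e∈ sub with distinct q e (long≥1 e∈) 2≤q
          ... | x , y , x∈ , y∈ , ne with two e∈ x∈ y∈ ne (sub x∈) (sub y∈)
          ... | inj₁ s = let w , w∈ , w∈β = hit e∈ s in w , w∈ , Mem.∈-++⁺ʳ new-blues w∈β
          ... | inj₂ (z , z∈ , sh) = let w , w∈ , w∈b = Z.hits z (Mem.∈-filter⁺ (share? q (cover z)) e∈ sh) in
                  w , w∈ , Mem.∈-++⁺ˡ (Mem.∈-concatMap⁺ Z.blues (lose z∈ w∈b))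

      abstract

        regular : Regular H A v
        regular = WithLines.regular (lines (fresh ++ [ v ]) (fresh ++ A) fresh id Mem.∈-++⁺ˡ Mem.∈-++⁺ˡ)
          λ z → hitting-avoiding q r 3≤r r<q (Parallel (cover z))
            (λ p → long≥1 (proj₁ (Mem.∈-filter⁻ (share? q (cover z)) p))) (parallel-common {cover z}) z

    abstract

      extendAtShort : ∀ {A β f v} → State A β → ¬ Kill A →
        (∀ {e x} → e ∈ Lfam → x ∈ pts q e → x ∈ A → pts q e ⊆ A) →
        v ∈ A → f ∈ Sfam → v ∈ pts r f → ¬ (pts r f ⊆ A) → (∃ λ m → Extension A m) ⊎ Regular H A v
      extendAtShort {A} {f = f} {v} S nk sat v∈A f∈ v∈f f⊈A
        with Any.any? (λ y → ¬? (v ℕ.≟ y) ×-dec y ∈? A) (pts r f)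
      ... | yes p = let y , y∈ , ne , y∈A = find p in inj₁ (0 , extendShort y∈ y∈A ne)
        where open ShortSteps.AtShort H nsk S nk sat v∈A f∈ v∈f f⊈A
      ... | no ¬p with ShortSteps.AtShort.aligned? H nsk S nk sat v∈A f∈ v∈f f⊈A
      ... | yes al = inj₁ (1 , ShortSteps.AtShort.extendAligned H nsk S nk sat v∈A f∈ v∈f f⊈A al)
      ... | no ¬al = inj₂ (Generic.regular S nk sat v∈A f∈ v∈f f⊈A only-v ¬al)
        where
        only-v : ∀ {x} → x ∈ pts r f → x ∈ A → v ≡ x
        only-v {x} x∈ x∈A with v ℕ.≟ x
        ... | yes eq = eq
        ... | no ne  = ⊥-elim (¬p (lose x∈ (ne , x∈A)))

open RegularExtensions

-- Enumeration of the possible runs.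

module Witnesses where

  generated : ℕ → ℕ → List ℕ → ℕ → ℕ → List (List ℕ)
  generated n Q A f       zero    = [] ∷ []
  generated n Q A zero    (suc N) = concatMap (λ x → map (x ∷_) (generated n Q (x ∷ A) zero N)) (spanⁿ 3 Q A)
  generated n Q A (suc f) (suc N) =
    concatMap (λ x → map (x ∷_) (generated n Q (x ∷ A) f N)) (applyUpTo suc n) ++
    concatMap (λ x → map (x ∷_) (generated n Q (x ∷ A) (suc f) N)) (spanⁿ 3 Q A)

  ∈-applyUpTo-suc : ∀ {n x} → 1 ≤ x → x ≤ n → x ∈ applyUpTo suc n
  ∈-applyUpTo-suc {x = suc x} _ x≤n = Mem.∈-applyUpTo⁺ suc x≤n

  ∈-generated : ∀ {n Q A f xs} → Gen Q A f xs → (∀ {x} → x ∈ xs → 1 ≤ x × x ≤ n) → xs ∈ generated n Q A f (length xs)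
  ∈-generated done _ = here refl
  ∈-generated {n} {Q} {A} (free {f} {x} {xs} G) h = Mem.∈-++⁺ˡ (Mem.∈-concatMap⁺ _
    (lose (let 1≤x , x≤n = h (here refl) in ∈-applyUpTo-suc 1≤x x≤n) (Mem.∈-map⁺ (x ∷_) (∈-generated G (h ∘ there)))))
  ∈-generated {n} {Q} {A} (det {zero} {x} {xs} p G) h =
    Mem.∈-concatMap⁺ (λ x → map (x ∷_) (generated n Q (x ∷ A) zero (length xs)))
      (lose p (Mem.∈-map⁺ (x ∷_) (∈-generated G (h ∘ there))))
  ∈-generated {n} {Q} {A} (det {suc f} {x} {xs} p G) h =
    Mem.∈-++⁺ʳ (concatMap (λ x → map (x ∷_) (generated n Q (x ∷ A) f (length xs))) (applyUpTo suc n))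
      (Mem.∈-concatMap⁺ (λ x → map (x ∷_) (generated n Q (x ∷ A) (suc f) (length xs)))
        (lose p (Mem.∈-map⁺ (x ∷_) (∈-generated G (h ∘ there)))))

  family : ℕ → ℕ → List ℕ → List (ℕ × ℕ) → List (List ℕ)
  family n Q A = concatMap λ (f , N) → generated n Q A f N

  ∈-family : ∀ {n Q A f xs shapes} → Gen Q A f xs → (∀ {x} → x ∈ xs → 1 ≤ x × x ≤ n) → (f , length xs) ∈ shapes →
    xs ∈ family n Q A shapes
  ∈-family {n} {Q} {A} G h p = Mem.∈-concatMap⁺ (λ (f , N) → generated n Q A f N) (lose p (∈-generated G h))

  module Shapes (q r : ℕ) where

    -- All shapes that can be light: as `cost` is at least 1, a light inequality with N at most
    -- `size` bounds the number of free vertices.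
    box : List (ℕ × ℕ)
    box = cartesianProduct (upTo (r * (size q r + q))) (upTo (suc (size q r)))

    kill? : ∀ s → Dec ((proj₁ s + 2) * cost q r < r * (proj₂ s + q))
    kill? (f , N) = (f + 2) * cost q r ℕ.<? r * (N + q)

    light? : ∀ s → Dec (proj₁ s * cost q r < r * proj₂ s)
    light? (f , N) = f * cost q r ℕ.<? r * N

    killShapes lightShapes regularShapes startKillShapes startShapes : List (ℕ × ℕ)
    killShapes      = filter kill? box
    lightShapes     = filter light? box
    regularShapes   = map (r ,_) (filter (cost q r ℕ.≤?_) (upTo (suc (size q r))))
    startKillShapes = map (2 ,_) (filter (λ N → light? (2 , N)) (upTo (suc (size q r))))
    startShapes     = map (2 ,_) (filter (q ℕ.≤?_) (upTo (suc (size q r))))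

    extensions : ℕ → List ℕ → ℕ → List (List ℕ)
    extensions n A v = family n (depth q) A lightShapes ++ family n (depth q) [ v ] regularShapes

    kills : ℕ → List ℕ → List (List ℕ)
    kills n A = family n (depth q) A killShapes

    -- The lists of new vertices that a run of the exploration can add to A before it meets a kill or makes t
    -- extensions. E and F are the vertices whose long, resp. short, edges have not been processed.
    explore : ℕ → ℕ → List ℕ → List ℕ → List ℕ → List (List ℕ)
    explore n zero    A E F = [] ∷ []
    explore n (suc t) A [] [] = kills n A
    explore n (suc t) A (y ∷ E) F = kills n A ++ explore n (suc t) A E F ++
      -- `y` stays in the queue, as further long edges through it may be unprocessed. Short edges
      -- wait until the long queue is empty, so that the explored set is then saturated.
      concatMap (λ xs → map (xs ++_) (explore n t (xs ++ A) (xs ++ y ∷ E) (xs ++ F))) (extensions n A y)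
    explore n (suc t) A [] (v ∷ F) = kills n A ++ explore n (suc t) A [] F ++
      concatMap (λ xs → map (xs ++_) (explore n t (xs ++ A) xs (xs ++ v ∷ F))) (extensions n A v)

    witnesses : ℕ → ℕ → List (List ℕ)
    witnesses n t = family n (depth q) [] startKillShapes ++
      concatMap (λ xs → map (xs ++_) (explore n t xs xs xs)) (family n (depth q) [] startShapes)

open Witnesses

-- The exploration and the colouring it produces.

module Explorations where

  module Exploration {q r : ℕ} (H : Hypergraph q r) (n : ℕ)
    (bounded : ∀ {x} → x ∈ Hypergraph.V H → 1 ≤ x × x ≤ n) where

    open Colouring H
    open Shapes q r

    Avoids : List ℕ → List (List ℕ) → Set
    Avoids A ws = ∀ {w} → w ∈ ws → ¬ New V A w

    record Closed (A : List ℕ) : Set where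
      field
        A⁺ β    : List ℕ
        A⊆A⁺    : A ⊆ A⁺
        state   : State A⁺ β
        closedL : ∀ {e x} → e ∈ Lfam → x ∈ pts q e → x ∈ A⁺ → pts q e ⊆ A⁺
        closedS : ∀ {f x} → f ∈ Sfam → x ∈ pts r f → x ∈ A⁺ → pts r f ⊆ A⁺

    private
      cost≥1 : 1 ≤ cost q r
      cost≥1 = ℕ.*-mono-≤ 1≤q (ℕ.∸-monoˡ-≤ {2} {r} 1 (ℕ.≤-trans (ℕ.n≤1+n 2) 3≤r))

      f-bound : ∀ {f N} → f * cost q r < r * (N + q) → N ≤ size q r → f < r * (size q r + q)
      f-bound {f} lt le = ℕ.≤-<-trans (ℕ.m≤m*n f (cost q r) {{ℕ.>-nonZero cost≥1}})
        (ℕ.<-≤-trans lt (ℕ.*-monoʳ-≤ r (ℕ.+-monoˡ-≤ q le)))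

      ∈-box : ∀ {f N} → f * cost q r < r * (N + q) → N ≤ size q r → (f , N) ∈ box
      ∈-box {f} {N} lt le = Mem.∈-cartesianProduct⁺ (Mem.∈-upTo⁺ (f-bound {f} {N} lt le)) (Mem.∈-upTo⁺ (s≤s le))

    ∈-kills : ∀ {A} (K : Kill A) → Kill.xs K ∈ kills n A
    ∈-kills K = ∈-family gen (bounded ∘ New.inV new)
        (Mem.∈-filter⁺ kill? (∈-box {f} (ℕ.≤-<-trans (ℕ.*-monoˡ-≤ (cost q r) (ℕ.m≤m+n f 2)) light) short) light)
      where open Kill K

    ∈-extensions : ∀ {A f v} (X : Extension A f) → Extension.xs X ∈ extensions n A v
    ∈-extensions {A} {f} X = Mem.∈-++⁺ˡ (∈-family gen (bounded ∘ New.inV new)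
        (Mem.∈-filter⁺ light? (∈-box {f} (ℕ.<-≤-trans light (ℕ.*-monoʳ-≤ r (ℕ.m≤m+n _ q))) short) light))
      where open Extension X

    ∈-extensions-regular : ∀ {A v} (X : Regular H A v) → Regular.xs X ∈ extensions n A v
    ∈-extensions-regular {A} X = Mem.∈-++⁺ʳ (family n (depth q) A lightShapes) (∈-family gen (bounded ∘ New.inV new)
        (Mem.∈-map⁺ (r ,_) (Mem.∈-filter⁺ (cost q r ℕ.≤?_) (Mem.∈-upTo⁺ (s≤s short)) many)))
      where open Regular X

    module Run (nsk : ¬ StartKill) where

      open Steps nsk

      PendingL PendingS : List ℕ → List ℕ → Set
      PendingL A E = ∀ {x} → x ∈ A → x ∈ E ⊎ (∀ {e} → e ∈ Lfam → x ∈ pts q e → pts q e ⊆ A)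
      PendingS A F = ∀ {x} → x ∈ A → x ∈ F ⊎ (∀ {f} → f ∈ Sfam → x ∈ pts r f → pts r f ⊆ A)

      private
        ⊆? : ∀ xs A → Dec (xs ⊆ A)
        ⊆? xs A = map′ All.lookup All.tabulate (All.all? (_∈? A) xs)

        extendL : ∀ {A E xs} → PendingL A E → PendingL (xs ++ A) (xs ++ E)
        extendL {xs = xs} P p with Mem.∈-++⁻ xs p
        ... | inj₁ a = inj₁ (Mem.∈-++⁺ˡ a)
        ... | inj₂ b with P b
        ... | inj₁ c = inj₁ (Mem.∈-++⁺ʳ xs c)
        ... | inj₂ h = inj₂ λ e∈ x∈ y∈ → Mem.∈-++⁺ʳ xs (h e∈ x∈ y∈)

        extendS : ∀ {A F xs} → PendingS A F → PendingS (xs ++ A) (xs ++ F)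
        extendS {xs = xs} P p with Mem.∈-++⁻ xs p
        ... | inj₁ a = inj₁ (Mem.∈-++⁺ˡ a)
        ... | inj₂ b with P b
        ... | inj₁ c = inj₁ (Mem.∈-++⁺ʳ xs c)
        ... | inj₂ h = inj₂ λ f∈ x∈ y∈ → Mem.∈-++⁺ʳ xs (h f∈ x∈ y∈)

        extend⊆ : ∀ {A E : List ℕ} xs → E ⊆ A → xs ++ E ⊆ xs ++ A
        extend⊆ xs s p with Mem.∈-++⁻ xs p
        ... | inj₁ a = Mem.∈-++⁺ˡ a
        ... | inj₂ b = Mem.∈-++⁺ʳ xs (s b)

        ∷⁻ : ∀ {x y : ℕ} {E} → x ∈ y ∷ E → x ≢ y → x ∈ E
        ∷⁻ (here eq) ne = ⊥-elim (ne eq)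
        ∷⁻ (there p) ne = p

        continue : ∀ {A xs} {ws : List (List ℕ)} → New V A xs → (∀ {w} → w ∈ map (xs ++_) ws → ¬ New V A w) → Avoids (xs ++ A) ws
        continue {xs = xs} nx av w∈ nw = av (Mem.∈-map⁺ (xs ++_) w∈) (New-++ nx nw)

        widen : ∀ {A xs} → Closed (xs ++ A) → Closed A
        widen {A} {xs} C = record { A⁺ = A⁺ ; β = β ; A⊆A⁺ = λ p → A⊆A⁺ (Mem.∈-++⁺ʳ xs p) ; state = state
                                  ; closedL = closedL ; closedS = closedS }
          where open Closed C

      Runs : ℕ → Set
      Runs t = ∀ A E F β → State A β → E ⊆ A → F ⊆ A → PendingL A E → PendingS A F → Avoids A (explore n t A E F) → Closed A

      run-short : ∀ t → Runs t → ∀ A F β → State A β → F ⊆ A → PendingL A [] → PendingS A F →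
        Avoids A (explore n (suc t) A [] F) → Closed A
      run-short t rec A [] β S F⊆ PL PS av = record
        { A⁺ = A ; β = β ; A⊆A⁺ = id ; state = S
        ; closedL = λ e∈ x∈ x∈A → case PL x∈A of λ { (inj₂ h) → h e∈ x∈ }
        ; closedS = λ f∈ x∈ x∈A → case PS x∈A of λ { (inj₂ h) → h f∈ x∈ } }
      run-short t rec A (v ∷ F) β S F⊆ PL PS av
        with Any.any? (λ f → v ∈? pts r f ×-dec ¬? (⊆? (pts r f) A)) Sfam
      ... | no ¬p = run-short t rec A F β S (F⊆ ∘ there) PL PS′
              (λ w∈ → av (Mem.∈-++⁺ʳ (kills n A) (Mem.∈-++⁺ˡ w∈)))
        where
        done-v : ∀ {f} → f ∈ Sfam → v ∈ pts r f → pts r f ⊆ A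
        done-v {f} f∈ v∈ with ⊆? (pts r f) A
        ... | yes s = s
        ... | no ¬s = ⊥-elim (¬p (lose f∈ (v∈ , ¬s)))
        PS′ : PendingS A F
        PS′ {x} x∈A with x ℕ.≟ v | PS x∈A
        ... | yes refl | _      = inj₂ done-v
        ... | no ne    | inj₁ p = inj₁ (∷⁻ p ne)
        ... | no _     | inj₂ h = inj₂ h
      ... | yes p with find p
      ... | f , f∈ , v∈ , f⊈ = either
            (extendAtShort H nsk S (λ K → av (Mem.∈-++⁺ˡ (∈-kills K)) (Kill.new K)) saturated (F⊆ (here refl)) f∈ v∈ f⊈)
        where
        saturated : ∀ {e x} → e ∈ Lfam → x ∈ pts q e → x ∈ A → pts q e ⊆ A
        saturated e∈ x∈ x∈A = case PL x∈A of λ { (inj₂ h) → h e∈ x∈ }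
        go : ∀ xs γ → New V A xs → xs ∈ extensions n A v → State (xs ++ A) γ → Closed A
        go xs γ nx xs∈ S′ = widen (rec (xs ++ A) xs (xs ++ v ∷ F) γ S′ Mem.∈-++⁺ˡ (extend⊆ xs F⊆)
          (subst (PendingL (xs ++ A)) (List.++-identityʳ xs) (extendL PL)) (extendS PS)
          (continue nx λ w∈ → av (Mem.∈-++⁺ʳ (kills n A) (Mem.∈-++⁺ʳ (explore n (suc t) A [] F)
            (Mem.∈-concatMap⁺ (λ xs → map (xs ++_) (explore n t (xs ++ A) xs (xs ++ v ∷ F))) (lose xs∈ w∈))))))
        either : (∃ λ m → Extension A m) ⊎ Regular H A v → Closed A
        either (inj₁ (m , X)) = go (Extension.xs X) (Extension.β X) (Extension.new X) (∈-extensions X) (Extension.state X)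
        either (inj₂ X)       = go (Regular.xs X) (Regular.β X) (Regular.new X) (∈-extensions-regular X) (Regular.state X)

      run-long : ∀ t → Runs t → Runs (suc t)
      run-long t rec A [] F β S E⊆ F⊆ PL PS av = run-short t rec A F β S F⊆ PL PS av
      run-long t rec A (y ∷ E) F β S E⊆ F⊆ PL PS av
        with Any.any? (λ e → y ∈? pts q e ×-dec ¬? (⊆? (pts q e) A)) Lfam
      ... | no ¬p = run-long t rec A E F β S (E⊆ ∘ there) F⊆ PL′ PS
              (λ w∈ → av (Mem.∈-++⁺ʳ (kills n A) (Mem.∈-++⁺ˡ w∈)))
        where
        done-y : ∀ {e} → e ∈ Lfam → y ∈ pts q e → pts q e ⊆ A
        done-y {e} e∈ y∈ with ⊆? (pts q e) A
        ... | yes s = s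
        ... | no ¬s = ⊥-elim (¬p (lose e∈ (y∈ , ¬s)))
        PL′ : PendingL A E
        PL′ {x} x∈A with x ℕ.≟ y | PL x∈A
        ... | yes refl | _      = inj₂ done-y
        ... | no ne    | inj₁ p = inj₁ (∷⁻ p ne)
        ... | no _     | inj₂ h = inj₂ h
      ... | yes p with find p
      ... | e , e∈ , y∈ , e⊈ = widen (rec (xs ++ A) (xs ++ y ∷ E) (xs ++ F) X.β X.state (extend⊆ xs E⊆) (extend⊆ xs F⊆)
              (extendL PL) (extendS PS) (continue X.new λ w∈ → av (Mem.∈-++⁺ʳ (kills n A) (Mem.∈-++⁺ʳ (explore n (suc t) A E F)
                (Mem.∈-concatMap⁺ (λ xs → map (xs ++_) (explore n t (xs ++ A) (xs ++ y ∷ E) (xs ++ F))) (lose (∈-extensions X) w∈))))))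
        where
        X = extendLine S (λ K → av (Mem.∈-++⁺ˡ (∈-kills K)) (Kill.new K)) (E⊆ (here refl)) e∈ y∈ e⊈
        module X = Extension X
        xs = X.xs
      run : ∀ t → Runs t
      -- Once all extensions are used up, the empty list is a witness, and it is always new.
      run zero A E F β S E⊆ F⊆ PL PS av = ⊥-elim (av (here refl) New-[])
      run (suc t) = run-long t (run t)

      abstract

        emptyState : State [] []
        emptyState = record
          { closed = λ _ _ _ _ ()
          ; hit    = λ {e} e∈ sub → case sub (∈-pts⁺ {i = 0} e 1≤q) of λ ()
          ; β⊆A    = λ ()
          ; noBlue = λ {f} _ sub → case sub (∈-pts⁺ {i = 0} f 1≤r) of λ ()
          }

        -- With no old blue vertices, a set of r - 2 blue ones is too small to contain a short edge.
        -- A long edge with two vertices on the line but not two in `e` would give 2q - 1 vertices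
        -- from 2 free ones, a start kill.
        startState : ∀ {e} → e ∈ Lfam → ∃ λ β → State (line e ++ []) β
        startState {e} e∈ = _ , addLine emptyState {size = r ∸ 2} (λ _ ()) Mem.∈-++⁺ˡ two Z id inj₁ noBlue
          where
          Z : Hitting q (Parallel e) (r ∸ 2)
          Z = hitting q r 3≤r r<q (Parallel e) (λ p → long≥1 (proj₁ (Mem.∈-filter⁻ (share? q e) p))) (parallel-common {e})
          noBlue : ∀ {f c} → f ∈ Sfam → pts r f ⊆ Hitting.blues Z ++ [] → c ∈ pts r f → c ∈ Hitting.blues Z → ⊥
          noBlue {f} f∈ all _ _ = ℕ.<⇒≱ {r ∸ 2} {r} (ℕ.∸-monoʳ-< {r} {2} {0} (s≤s z≤n) (ℕ.≤-trans (ℕ.n≤1+n 2) 3≤r)) (ℕ.≤-trans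
            (ℕ.≤-trans (ℕ.≤-reflexive (sym (length-pts r f))) (unique-⊆⇒length≤ (pts-unique r f (short≥1 f∈))
              λ p → subst (_ ∈_) (List.++-identityʳ (Hitting.blues Z)) (all p))) (Hitting.small Z))
          two : ∀ {e′ x y} → e′ ∈ Lfam → x ∈ pts q e′ → y ∈ pts q e′ → x ≢ y → x ∈ line e ++ [] → y ∈ line e ++ [] →
            pts q e′ ⊆ [] ⊎ Share q e e′
          two {e′} {x} {y} e′∈ x∈ y∈ ne x∈′ y∈′ with share? q e e′
          ... | yes s = inj₂ s
          ... | no ¬s = ⊥-elim (nsk (startKill
              (Gen-++ (Gen-line₂ e (pts-unique q e (long≥1 e∈)) (online e))
                      (Gen-line₀ e′ {xs = ns} (spanned x∈′) (spanned y∈′) ne (online e′ x∈) (online e′ y∈)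
                        λ p → online e′ (proj₁ (∈-∖⁻ {pts q e′} {pts q e ++ []} p))))
              (New-++ (mkNew (pts-unique q e (long≥1 e∈)) (λ _ ()) (long⊆V e∈)) (new-edge e′∈))
              (ℕ.<-≤-trans light (ℕ.≤-reflexive (cong (r *_) (sym (trans (List.length-++ (pts q e)) (cong (_+ length ns) (length-pts q e)))))))
              (ℕ.≤-trans (ℕ.≤-reflexive (List.length-++ (pts q e))) (ℕ.≤-trans (ℕ.+-mono-≤ (ℕ.≤-reflexive (length-pts q e))
                (ℕ.≤-trans (length-∖-pts e′ (pts q e ++ [])) (ℕ.m≤m+n q 0))) 2q≤size))))
            where
            ns : List ℕ
            ns = pts q e′ ∖ (pts q e ++ [])
            spanned : ∀ {u} → u ∈ line e ++ [] → u ∈ spanⁿ 2 (depth q) (pts q e ++ [])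
            spanned p = let a , b , a∈ , b∈ , a≢b = distinct q e (long≥1 e∈) 2≤q in
              ⊆-span (determined {h = 0} {e = e} (Mem.∈-++⁺ˡ a∈) (Mem.∈-++⁺ˡ b∈) a≢b (online e a∈) (online e b∈)
                (line-online (subst (_ ∈_) (List.++-identityʳ (line e)) p)))
            len : q ≤ suc (length ns)
            len = length-edge-∖ e′∈ λ a b c d → ¬share⇒meetsOnce (¬s ∘ share-sym) a
              (subst (_ ∈_) (List.++-identityʳ (pts q e)) b) c (subst (_ ∈_) (List.++-identityʳ (pts q e)) d)
            light : 2 * cost q r < r * (q + length ns)
            light = cost-< 2 {q} {r} 1≤r (begin-strict
              2 * (q * r)                          ≡⟨ eq₁ q r ⟩
              r * (q + q)                          ≤⟨ ℕ.*-monoʳ-≤ r (ℕ.+-monoʳ-≤ q len) ⟩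
              r * (q + suc (length ns))            ≡⟨ eq₂ r q (length ns) ⟩
              r * (q + length ns) + r              <⟨ ℕ.+-monoʳ-< (r * (q + length ns)) (ℕ.<-≤-trans r<q (ℕ.m≤m+n q _)) ⟩
              r * (q + length ns) + 2 * q          ∎)
              where
              open ℕ.≤-Reasoning
              eq₁ : ∀ q r → 2 * (q * r) ≡ r * (q + q)
              eq₁ = ℕ-solve-∀
              eq₂ : ∀ r q N → r * (q + suc N) ≡ r * (q + N) + r
              eq₂ = ℕ-solve-∀

      abstract

        component : ∀ t {e} → e ∈ Lfam →
          Avoids [] (concatMap (λ xs → map (xs ++_) (explore n t xs xs xs)) (family n (depth q) [] startShapes)) →
          Closed (line e)
        component t {e} e∈ av = run t L L L (proj₁ start) (subst (λ A → State A (proj₁ start)) (List.++-identityʳ L) (proj₂ start))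
            id id inj₁ inj₁ λ w∈ nw → av (Mem.∈-concatMap⁺ (λ xs → map (xs ++_) (explore n t xs xs xs))
              (lose L∈ (Mem.∈-map⁺ (L ++_) w∈))) (New-++ newL (New-cong (λ p → subst (_ ∈_) (List.++-identityʳ L) p) nw))
          where
          L : List ℕ
          L = line e
          start : ∃ λ β → State (line e ++ []) β
          start = startState e∈
          newL : New V [] L
          newL = mkNew (line-unique e) (λ _ ()) (line⊆V {e})
          L∈ : L ∈ family n (depth q) [] startShapes
          L∈ = ∈-family (Gen-line₂ e (line-unique e) line-online) (bounded ∘ line⊆V {e}) (Mem.∈-map⁺ (2 ,_)
            (Mem.∈-filter⁺ (q ℕ.≤?_) (Mem.∈-upTo⁺ (s≤s (ℕ.≤-trans (length-line e) 2q≤size)))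
              (ℕ.≤-trans (ℕ.≤-reflexive (sym (length-pts q e))) (unique-⊆⇒length≤ (pts-unique q e (long≥1 e∈)) (edge⊆line e∈)))))

    -- Components may overlap: the colours of earlier components take precedence.
    module _ (t : ℕ) (av : Avoids [] (witnesses n t)) where

      private
        nsk : ¬ StartKill
        nsk K = av (Mem.∈-++⁺ˡ (∈-family gen (bounded ∘ New.inV new) (Mem.∈-map⁺ (2 ,_)
                  (Mem.∈-filter⁺ (λ N → light? (2 , N)) (Mem.∈-upTo⁺ (s≤s short)) light)))) new
          where open StartKill K

      record Good (es : List Pts) : Set where
        field
          D β     : List ℕ
          β⊆D     : β ⊆ D
          covered : ∀ {e} → e ∈ es → pts q e ⊆ D
          closedL : ∀ {e x} → e ∈ Lfam → x ∈ pts q e → x ∈ D → pts q e ⊆ D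
          closedS : ∀ {f x} → f ∈ Sfam → x ∈ pts r f → x ∈ D → pts r f ⊆ D
          hit     : ∀ {e} → e ∈ Lfam → pts q e ⊆ D → ∃ λ x → x ∈ pts q e × x ∈ β
          noBlue  : ∀ {f} → f ∈ Sfam → ¬ (pts r f ⊆ β)

      good : ∀ es → es ⊆ Lfam → Good es
      good [] _ = record { D = [] ; β = [] ; β⊆D = id ; covered = λ () ; closedL = λ _ _ () ; closedS = λ _ _ ()
        ; hit = λ {e} e∈ sub → case sub (∈-pts⁺ {i = 0} e 1≤q) of λ ()
        ; noBlue = λ {f} _ sub → case sub (∈-pts⁺ {i = 0} f 1≤r) of λ () }
      good (e ∷ es) s = record
        { D = G.D ++ C.A⁺
        ; β = β′
        ; β⊆D = λ p → [ (λ a → Mem.∈-++⁺ˡ (G.β⊆D a)) , (λ b → Mem.∈-++⁺ʳ G.D (S.β⊆A (proj₁ (∈-∖⁻ {C.β} {G.D} b)))) ]′ (Mem.∈-++⁻ G.β p)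
        ; covered = λ { (here refl) p → Mem.∈-++⁺ʳ G.D (C.A⊆A⁺ (edge⊆line (s (here refl)) p)) ; (there m) p → Mem.∈-++⁺ˡ (G.covered m p) }
        ; closedL = λ e∈ x∈ x∈D p → [ (λ a → Mem.∈-++⁺ˡ (G.closedL e∈ x∈ a p)) , (λ b → Mem.∈-++⁺ʳ G.D (C.closedL e∈ x∈ b p)) ]′ (Mem.∈-++⁻ G.D x∈D)
        ; closedS = λ f∈ x∈ x∈D p → [ (λ a → Mem.∈-++⁺ˡ (G.closedS f∈ x∈ a p)) , (λ b → Mem.∈-++⁺ʳ G.D (C.closedS f∈ x∈ b p)) ]′ (Mem.∈-++⁻ G.D x∈D)
        ; hit = hit′
        ; noBlue = noBlue′
        }
        where
        module G = Good (good es (s ∘ there))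
        C = Run.component nsk t (s (here refl)) λ w∈ → av (Mem.∈-++⁺ʳ (family n (depth q) [] startKillShapes) w∈)
        module C = Closed C
        module S = State C.state
        β′ = G.β ++ (C.β ∖ G.D)
        hit′ : ∀ {e} → e ∈ Lfam → pts q e ⊆ G.D ++ C.A⁺ → ∃ λ x → x ∈ pts q e × x ∈ β′
        hit′ {e} e∈ sub with Any.any? (_∈? G.D) (pts q e)
        ... | yes p = let x , x∈ , x∈D = find p ; y , y∈ , y∈β = G.hit e∈ (G.closedL e∈ x∈ x∈D) in y , y∈ , Mem.∈-++⁺ˡ y∈β
        ... | no ¬p = let y , y∈ , y∈β = S.hit e∈ (λ u∈ → [ (λ a → ⊥-elim (¬p (lose u∈ a))) , id ]′ (Mem.∈-++⁻ G.D (sub u∈))) in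
                y , y∈ , Mem.∈-++⁺ʳ G.β (∈-∖⁺ y∈β λ a → ¬p (lose y∈ a))
        noBlue′ : ∀ {f} → f ∈ Sfam → ¬ (pts r f ⊆ β′)
        noBlue′ {f} f∈ sub with Any.any? (_∈? G.D) (pts r f)
        ... | yes p = let x , x∈ , x∈D = find p in G.noBlue f∈ λ u∈ →
                [ id , (λ b → ⊥-elim (proj₂ (∈-∖⁻ {C.β} {G.D} b) (G.closedS f∈ x∈ x∈D u∈))) ]′ (Mem.∈-++⁻ G.β (sub u∈))
        ... | no ¬p = S.noBlue f∈ λ u∈ → [ (λ a → ⊥-elim (¬p (lose u∈ (G.β⊆D a)))) , (λ b → proj₁ (∈-∖⁻ {C.β} {G.D} b)) ]′ (Mem.∈-++⁻ G.β (sub u∈))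

      colouring : ∃ λ β → (∀ {e} → e ∈ Lfam → ∃ λ x → x ∈ pts q e × x ∈ β) × (∀ {f} → f ∈ Sfam → ¬ (pts r f ⊆ β))
      colouring = β , (λ e∈ → hit e∈ (covered e∈)) , noBlue
        where open Good (good Lfam id)

open Explorations

-- Random subsets and the union bound.

module RandomSubsets where

  infixl 7 _*⁺_

  *-mono-≤⁺ : ∀ {a b c d} → 0ℚ ℚ.≤ a → 0ℚ ℚ.≤ d → a ℚ.≤ b → c ℚ.≤ d → a ℚ.* c ℚ.≤ b ℚ.* d
  *-mono-≤⁺ {a} {b} {c} {d} 0≤a 0≤d a≤b c≤d =
    ℚ.≤-trans (ℚ.*-monoˡ-≤-nonNeg a {{ℚ.nonNegative 0≤a}} c≤d) (ℚ.*-monoʳ-≤-nonNeg d {{ℚ.nonNegative 0≤d}} a≤b)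

  _*⁺_ : ∀ {a b} → 0ℚ ℚ.≤ a → 0ℚ ℚ.≤ b → 0ℚ ℚ.≤ a ℚ.* b
  _*⁺_ {a} {b} 0≤a 0≤b = subst (ℚ._≤ a ℚ.* b) (ℚ.*-zeroʳ a) (ℚ.*-monoˡ-≤-nonNeg a {{ℚ.nonNegative 0≤a}} 0≤b)

  +⁺ : ∀ {a b} → 0ℚ ℚ.≤ a → 0ℚ ℚ.≤ b → 0ℚ ℚ.≤ a ℚ.+ b
  +⁺ {a} {b} 0≤a 0≤b = subst (ℚ._≤ a ℚ.+ b) (ℚ.+-identityˡ 0ℚ) (ℚ.+-mono-≤ 0≤a 0≤b)

  0≤1 : 0ℚ ℚ.≤ 1ℚ
  0≤1 = ℚ.nonNegative⁻¹ 1ℚ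

  ^-nonNeg : ∀ {x} → 0ℚ ℚ.≤ x → ∀ k → 0ℚ ℚ.≤ x ^ℚ k
  ^-nonNeg 0≤x zero    = 0≤1
  ^-nonNeg 0≤x (suc k) = 0≤x *⁺ ^-nonNeg 0≤x k

  ^-+ : ∀ x j k → x ^ℚ (j + k) ≡ (x ^ℚ j) ℚ.* (x ^ℚ k)
  ^-+ x zero    k = sym (ℚ.*-identityˡ (x ^ℚ k))
  ^-+ x (suc j) k = trans (cong (x ℚ.*_) (^-+ x j k)) (sym (ℚ.*-assoc x (x ^ℚ j) (x ^ℚ k)))

  ^-anti : ∀ {x j k} → 0ℚ ℚ.≤ x → x ℚ.≤ 1ℚ → j ≤ k → x ^ℚ k ℚ.≤ x ^ℚ j
  ^-anti {x} {zero} {zero} 0≤x x≤1 _ = ℚ.≤-refl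
  ^-anti {x} {zero} {suc k} 0≤x x≤1 _ = subst (x ^ℚ suc k ℚ.≤_) (ℚ.*-identityˡ 1ℚ)
    (*-mono-≤⁺ 0≤x 0≤1 x≤1 (^-anti {x} {zero} {k} 0≤x x≤1 z≤n))
  ^-anti {x} {suc j} {suc k} 0≤x x≤1 (s≤s le) = ℚ.*-monoˡ-≤-nonNeg x {{ℚ.nonNegative 0≤x}} (^-anti 0≤x x≤1 le)

  sumℚ-++ : ∀ xs ys → sumℚ (xs ++ ys) ≡ sumℚ xs ℚ.+ sumℚ ys
  sumℚ-++ []       ys = sym (ℚ.+-identityˡ (sumℚ ys))
  sumℚ-++ (x ∷ xs) ys = trans (cong (x ℚ.+_) (sumℚ-++ xs ys)) (sym (ℚ.+-assoc x (sumℚ xs) (sumℚ ys)))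

  sumℚ-* : ∀ c xs → sumℚ (map (c ℚ.*_) xs) ≡ c ℚ.* sumℚ xs
  sumℚ-* c []       = sym (ℚ.*-zeroʳ c)
  sumℚ-* c (x ∷ xs) = trans (cong (c ℚ.* x ℚ.+_) (sumℚ-* c xs)) (sym (ℚ.*-distribˡ-+ c x (sumℚ xs)))

  sumℚ-nonNeg : ∀ {A : Set} {g : A → ℚ} (xs : List A) → (∀ x → 0ℚ ℚ.≤ g x) → 0ℚ ℚ.≤ sumℚ (map g xs)
  sumℚ-nonNeg []       h = ℚ.≤-refl
  sumℚ-nonNeg (x ∷ xs) h = +⁺ (h x) (sumℚ-nonNeg xs h)

  subsets : ∀ n → List (Vec Bool n)
  subsets zero    = Vec.[] ∷ []
  subsets (suc n) = map (true Vec.∷_) (subsets n) ++ map (false Vec.∷_) (subsets n)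

  subsets-unique : ∀ n → Unique (subsets n)
  subsets-unique zero    = [] ∷ []
  subsets-unique (suc n) = Unique.++⁺ (Unique.map⁺ (cong Vec.tail) (subsets-unique n)) (Unique.map⁺ (cong Vec.tail) (subsets-unique n))
    λ (a , b) → disjoint a b
    where
    disjoint : ∀ {S} → S ∈ map (true Vec.∷_) (subsets n) → S ∈ map (false Vec.∷_) (subsets n) → ⊥
    disjoint a b with Mem.∈-map⁻ _ a | Mem.∈-map⁻ _ b
    ... | _ , _ , refl | _ , _ , ()

  card≤ : ∀ {n} (S : Vec Bool n) → card S ≤ n
  card≤ Vec.[]          = z≤n
  card≤ (true Vec.∷ S)  = s≤s (card≤ S)
  card≤ (false Vec.∷ S) = ℕ.m≤n⇒m≤1+n (card≤ S)

  indicator : Bool → ℚ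
  indicator b = if b then 1ℚ else 0ℚ

  indicator-nonNeg : ∀ b → 0ℚ ℚ.≤ indicator b
  indicator-nonNeg true  = 0≤1
  indicator-nonNeg false = ℚ.≤-refl

  has : ℕ → ∀ {n} → Vec Bool n → Bool
  has k       Vec.[]       = false
  has zero    (b Vec.∷ S)  = b
  has (suc k) (b Vec.∷ S)  = has k S

  hasAll : ∀ {n} → List ℕ → Vec Bool n → Bool
  hasAll []      S = true
  hasAll (k ∷ u) S = has k S ∧ hasAll u S

  -- Deletes 0 and shifts. It serves both to pass to the tail of a subset and to turn vertices into
  -- positions.
  down : List ℕ → List ℕ
  down []          = []
  down (zero ∷ u)  = down u
  down (suc k ∷ u) = k ∷ down u

  ∈-down⁻ : ∀ {k} u → k ∈ down u → suc k ∈ u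
  ∈-down⁻ (zero ∷ u)  p           = there (∈-down⁻ u p)
  ∈-down⁻ (suc k ∷ u) (here refl) = here refl
  ∈-down⁻ (suc k ∷ u) (there p)   = there (∈-down⁻ u p)

  down-unique : ∀ {u} → Unique u → Unique (down u)
  down-unique {[]}        _         = []
  down-unique {zero ∷ u}  (_ ∷ un)  = down-unique un
  down-unique {suc k ∷ u} (k∉ ∷ un) = All.tabulate (λ p eq → All.lookup k∉ (∈-down⁻ u p) (cong suc eq)) ∷ down-unique un

  length-down : ∀ {u} → 0 ∉ u → length (down u) ≡ length u
  length-down {[]} _ = refl
  length-down {zero ∷ u} h = ⊥-elim (h (here refl))
  length-down {suc k ∷ u} h = cong suc (length-down (h ∘ there))

  length-down-suc : ∀ {u} → Unique u → length u ≤ suc (length (down u))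
  length-down-suc {[]} _ = z≤n
  length-down-suc {zero ∷ u} (0∉ ∷ un) = s≤s (ℕ.≤-reflexive (sym (length-down λ p → All.lookup 0∉ p refl)))
  length-down-suc {suc k ∷ u} (_ ∷ un) = s≤s (length-down-suc un)

  hasAll-false : ∀ {n} u (S : Vec Bool n) → 0 ∈ u → hasAll u (false Vec.∷ S) ≡ false
  hasAll-false (zero ∷ u)  S _ = refl
  hasAll-false (suc k ∷ u) S (there p) with has k S
  ... | true  = hasAll-false u S p
  ... | false = refl

  hasAll-down : ∀ {n} b u (S : Vec Bool n) → indicator (hasAll u (b Vec.∷ S)) ℚ.≤ indicator (hasAll (down u) S)
  hasAll-down b [] S = ℚ.≤-refl
  hasAll-down true  (zero ∷ u) S = hasAll-down true u S
  hasAll-down false (zero ∷ u) S = indicator-nonNeg (hasAll (down u) S)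
  hasAll-down b (suc k ∷ u) S with has k S
  ... | true  = hasAll-down b u S
  ... | false = ℚ.≤-refl

  -- Vertices are numbered from 1, positions from 0.
  contains : ∀ {n} → List ℕ → Vec Bool n → Bool
  contains w S = hasAll (down w) S

  Proper : List ℕ → Set
  Proper w = Unique w × 0 ∉ w

  abstract

    proper? : ∀ w → Dec (Proper w)
    proper? w = DecUniq.unique? ℕ._≟_ w ×-dec ¬? (0 ∈? w)

  avoids : ∀ {n} → List (List ℕ) → Vec Bool n → Bool
  avoids []       S = true
  avoids (w ∷ ws) S = not (contains w S) ∧ avoids ws S

  module Measure (p : ℚ) (0≤p : 0ℚ ℚ.≤ p) (p≤1 : p ℚ.≤ 1ℚ) where

    q̄ : ℚ
    q̄ = 1ℚ ℚ.- p

    0≤q̄ : 0ℚ ℚ.≤ q̄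
    0≤q̄ = subst (ℚ._≤ q̄) (ℚ.+-inverseʳ p) (ℚ.+-monoˡ-≤ (ℚ.- p) p≤1)

    p+q̄ : ∀ x → p ℚ.* x ℚ.+ q̄ ℚ.* x ≡ x
    p+q̄ x = solve 2 (λ p x → p :* x :+ (con 1ℚ :- p) :* x := x) refl p x
      where open +-*-Solver

    -- The expectation, with the elements revealed one at a time, so that independence is built into
    -- the recursion.
    𝔼 : ∀ n → (Vec Bool n → ℚ) → ℚ
    𝔼 zero    g = g Vec.[]
    𝔼 (suc n) g = p ℚ.* 𝔼 n (λ S → g (true Vec.∷ S)) ℚ.+ q̄ ℚ.* 𝔼 n (λ S → g (false Vec.∷ S))

    𝔼-mono : ∀ n {g h} → (∀ S → g S ℚ.≤ h S) → 𝔼 n g ℚ.≤ 𝔼 n h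
    𝔼-mono zero    le = le Vec.[]
    𝔼-mono (suc n) le = ℚ.+-mono-≤ (ℚ.*-monoˡ-≤-nonNeg p {{ℚ.nonNegative 0≤p}} (𝔼-mono n λ S → le (true Vec.∷ S)))
                                   (ℚ.*-monoˡ-≤-nonNeg q̄ {{ℚ.nonNegative 0≤q̄}} (𝔼-mono n λ S → le (false Vec.∷ S)))

    𝔼-const : ∀ n c → 𝔼 n (λ _ → c) ≡ c
    𝔼-const zero    c = refl
    𝔼-const (suc n) c = trans (cong₂ (λ a b → p ℚ.* a ℚ.+ q̄ ℚ.* b) (𝔼-const n c) (𝔼-const n c)) (p+q̄ c)

    𝔼-+ : ∀ n g h → 𝔼 n (λ S → g S ℚ.+ h S) ≡ 𝔼 n g ℚ.+ 𝔼 n h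
    𝔼-+ zero    g h = refl
    𝔼-+ (suc n) g h = trans (cong₂ (λ a b → p ℚ.* a ℚ.+ q̄ ℚ.* b) (𝔼-+ n _ _) (𝔼-+ n _ _))
      (solve 6 (λ p q a b c d → p :* (a :+ b) :+ q :* (c :+ d) := (p :* a :+ q :* c) :+ (p :* b :+ q :* d)) refl
        p q̄ _ _ _ _)
      where open +-*-Solver

    weight-true : ∀ {n} (S : Vec Bool n) → weight p (true Vec.∷ S) ≡ p ℚ.* weight p S
    weight-true S = ℚ.*-assoc p _ _

    weight-false : ∀ {n} (S : Vec Bool n) → weight p (false Vec.∷ S) ≡ q̄ ℚ.* weight p S
    weight-false {n} S = trans (cong (λ m → (p ^ℚ card S) ℚ.* (q̄ ^ℚ m)) (ℕ.+-∸-assoc 1 (card≤ S)))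
      (solve 3 (λ a q b → a :* (q :* b) := q :* (a :* b)) refl (p ^ℚ card S) q̄ (q̄ ^ℚ (n ∸ card S)))
      where open +-*-Solver

    private
      branch : ∀ {n} (b : Bool) c (g : Vec Bool (suc n) → ℚ) → (∀ S → weight p (b Vec.∷ S) ≡ c ℚ.* weight p S) → ∀ xs →
        sumℚ (map (λ S → weight p S ℚ.* g S) (map (b Vec.∷_) xs)) ≡
        c ℚ.* sumℚ (map (λ S → weight p S ℚ.* g (b Vec.∷ S)) xs)
      branch b c g h []       = sym (ℚ.*-zeroʳ c)
      branch b c g h (S ∷ xs) = trans (cong₂ ℚ._+_ (trans (cong (ℚ._* g (b Vec.∷ S)) (h S)) (ℚ.*-assoc c _ _)) (branch b c g h xs))
        (sym (ℚ.*-distribˡ-+ c _ _))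

    sum-subsets : ∀ n g → sumℚ (map (λ S → weight p S ℚ.* g S) (subsets n)) ≡ 𝔼 n g
    sum-subsets zero    g = trans (ℚ.+-identityʳ _) (trans (cong (ℚ._* g Vec.[]) (ℚ.*-identityˡ 1ℚ)) (ℚ.*-identityˡ _))
    sum-subsets (suc n) g = trans (cong sumℚ (List.map-++ (λ S → weight p S ℚ.* g S) (map (true Vec.∷_) (subsets n)) _))
      (trans (sumℚ-++ (map (λ S → weight p S ℚ.* g S) (map (true Vec.∷_) (subsets n))) _)
        (cong₂ ℚ._+_ (trans (branch true p g weight-true (subsets n)) (cong (p ℚ.*_) (sum-subsets n _)))
                     (trans (branch false q̄ g weight-false (subsets n)) (cong (q̄ ℚ.*_) (sum-subsets n _)))))

    sum-filter : ∀ {n} (good : Vec Bool n → Bool) xs →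
      sumℚ (map (weight p) (filterᵇ good xs)) ≡ sumℚ (map (λ S → weight p S ℚ.* indicator (good S)) xs)
    sum-filter good [] = refl
    sum-filter good (S ∷ xs) with good S
    ... | true  = cong₂ ℚ._+_ (sym (ℚ.*-identityʳ (weight p S))) (sum-filter good xs)
    ... | false = trans (sum-filter good xs) (trans (sym (ℚ.+-identityˡ _)) (cong (ℚ._+ _) (sym (ℚ.*-zeroʳ (weight p S)))))

    𝔼-hasAll : ∀ n u → Unique u → 𝔼 n (λ S → indicator (hasAll u S)) ℚ.≤ p ^ℚ length u
    𝔼-hasAll zero []      _ = ℚ.≤-refl
    𝔼-hasAll zero (k ∷ u) _ = ^-nonNeg 0≤p (suc (length u))
    𝔼-hasAll (suc n) u un with 0 ∈? u
    ... | no 0∉ = ℚ.≤-trans (ℚ.≤-trans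
            (ℚ.+-mono-≤ (ℚ.*-monoˡ-≤-nonNeg p {{ℚ.nonNegative 0≤p}} (𝔼-mono n (hasAll-down true u)))
                        (ℚ.*-monoˡ-≤-nonNeg q̄ {{ℚ.nonNegative 0≤q̄}} (𝔼-mono n (hasAll-down false u))))
            (ℚ.≤-reflexive (p+q̄ _)))
          (subst (λ m → 𝔼 n (λ S → indicator (hasAll (down u) S)) ℚ.≤ p ^ℚ m) (length-down 0∉) (𝔼-hasAll n (down u) (down-unique un)))
    ... | yes 0∈ = begin
        p ℚ.* 𝔼 n (λ S → indicator (hasAll u (true Vec.∷ S))) ℚ.+ q̄ ℚ.* 𝔼 n (λ S → indicator (hasAll u (false Vec.∷ S)))
          ≤⟨ ℚ.+-mono-≤ (ℚ.*-monoˡ-≤-nonNeg p {{ℚ.nonNegative 0≤p}} (ℚ.≤-trans (𝔼-mono n (hasAll-down true u)) (𝔼-hasAll n (down u) (down-unique un))))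
                        (ℚ.*-monoˡ-≤-nonNeg q̄ {{ℚ.nonNegative 0≤q̄}} (𝔼-mono n {h = λ _ → 0ℚ} λ S → ℚ.≤-reflexive (cong indicator (hasAll-false u S 0∈)))) ⟩
        p ℚ.* (p ^ℚ length (down u)) ℚ.+ q̄ ℚ.* 𝔼 n (λ _ → 0ℚ)
          ≡⟨ cong (λ k → p ℚ.* (p ^ℚ length (down u)) ℚ.+ k) (trans (cong (q̄ ℚ.*_) (𝔼-const n 0ℚ)) (ℚ.*-zeroʳ q̄)) ⟩
        p ℚ.* (p ^ℚ length (down u)) ℚ.+ 0ℚ
          ≡⟨ ℚ.+-identityʳ _ ⟩
        p ^ℚ suc (length (down u))
          ≤⟨ ^-anti 0≤p p≤1 (length-down-suc un) ⟩
        p ^ℚ length u ∎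
      where open ℚ.≤-Reasoning

    total : List (List ℕ) → ℚ
    total ws = sumℚ (map (λ w → p ^ℚ length w) ws)

    -- Lists with repetitions or with 0 impose no condition but still contribute to `total`, which
    -- thus remains a plain sum over the enumeration.
    union-bound : ∀ n ws → 1ℚ ℚ.≤ 𝔼 n (λ S → indicator (avoids (filter proper? ws) S)) ℚ.+ total ws
    union-bound n [] = ℚ.≤-reflexive (sym (trans (ℚ.+-identityʳ _) (𝔼-const n 1ℚ)))
    union-bound n (w ∷ ws) with proper? w
    ... | no _ = ℚ.≤-trans (union-bound n ws) (ℚ.+-monoʳ-≤ (𝔼 n (λ S → indicator (avoids (filter proper? ws) S)))
            (subst (ℚ._≤ (p ^ℚ length w) ℚ.+ total ws) (ℚ.+-identityˡ (total ws)) (ℚ.+-monoˡ-≤ (total ws) (^-nonNeg 0≤p (length w)))))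
    ... | yes (un , 0∉) = begin
        1ℚ                                            ≤⟨ union-bound n ws ⟩
        𝔼 n g ℚ.+ total ws                            ≤⟨ ℚ.+-monoˡ-≤ (total ws) (𝔼-mono n split) ⟩
        𝔼 n (λ S → h S ℚ.+ c S) ℚ.+ total ws          ≡⟨ cong (ℚ._+ total ws) (𝔼-+ n h c) ⟩
        (𝔼 n h ℚ.+ 𝔼 n c) ℚ.+ total ws                ≡⟨ ℚ.+-assoc (𝔼 n h) (𝔼 n c) (total ws) ⟩
        𝔼 n h ℚ.+ (𝔼 n c ℚ.+ total ws)                ≤⟨ ℚ.+-monoʳ-≤ (𝔼 n h) (ℚ.+-monoˡ-≤ (total ws) bound) ⟩
        𝔼 n h ℚ.+ total (w ∷ ws)                      ∎
      where
      open ℚ.≤-Reasoning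
      g c h : Vec Bool n → ℚ
      g S = indicator (avoids (filter proper? ws) S)
      c S = indicator (contains w S)
      h S = indicator (not (contains w S) ∧ avoids (filter proper? ws) S)
      split : ∀ S → g S ℚ.≤ h S ℚ.+ c S
      split S with contains w S
      ... | false = ℚ.≤-reflexive (sym (ℚ.+-identityʳ (g S)))
      ... | true with avoids (filter proper? ws) S
      ... | true  = ℚ.≤-reflexive (sym (ℚ.+-identityˡ 1ℚ))
      ... | false = subst (0ℚ ℚ.≤_) (sym (ℚ.+-identityˡ 1ℚ)) 0≤1
      bound : 𝔼 n c ℚ.≤ p ^ℚ length w
      bound = subst (λ m → 𝔼 n c ℚ.≤ p ^ℚ m) (length-down 0∉) (𝔼-hasAll n (down w) (down-unique un))

    goodSubsets : ∀ n → List (List ℕ) → List (Vec Bool n)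
    goodSubsets n ws = filterᵇ (avoids (filter proper? ws)) (subsets n)

    goodSubsets-weight : ∀ n ws → 1ℚ ℚ.≤ sumℚ (map (weight p) (goodSubsets n ws)) ℚ.+ total ws
    goodSubsets-weight n ws = subst (λ s → 1ℚ ℚ.≤ s ℚ.+ total ws)
      (sym (trans (sum-filter (avoids (filter proper? ws)) (subsets n)) (sum-subsets n _))) (union-bound n ws)

open RandomSubsets

-- Naturals and powers in the rationals.

module NaturalsInRationals where

  private
    toℚᵘ-ℕ : ∀ m → ℚ.toℚᵘ (ℕ→ℚ m) ℚᵘ.≃ ℚᵘ.mkℚᵘ (+ m) 0
    toℚᵘ-ℕ m = ℚ.toℚᵘ-fromℚᵘ (ℚᵘ.mkℚᵘ (+ m) 0)

  abstract

    ℕ→ℚ-+ : ∀ m n → ℕ→ℚ (m + n) ≡ ℕ→ℚ m ℚ.+ ℕ→ℚ n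
    ℕ→ℚ-+ m n = ℚ.toℚᵘ-injective (ℚᵘ.≃-trans (toℚᵘ-ℕ (m + n)) (ℚᵘ.≃-trans (ℚᵘ.*≡* eq)
      (ℚᵘ.≃-sym (ℚᵘ.≃-trans (ℚ.toℚᵘ-homo-+ (ℕ→ℚ m) (ℕ→ℚ n)) (ℚᵘ.+-cong (toℚᵘ-ℕ m) (toℚᵘ-ℕ n))))))
      where
      ring : ∀ x y → (x ℤ.+ y) ℤ.* (+ 1) ≡ (x ℤ.* + 1 ℤ.+ y ℤ.* + 1) ℤ.* + 1
      ring = ℤ-solve-∀
      eq : + (m + n) ℤ.* (+ 1) ≡ (+ m ℤ.* + 1 ℤ.+ + n ℤ.* + 1) ℤ.* + 1
      eq = trans (cong (ℤ._* + 1) (ℤ.pos-+ m n)) (ring (+ m) (+ n))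

    ℕ→ℚ-* : ∀ m n → ℕ→ℚ (m * n) ≡ ℕ→ℚ m ℚ.* ℕ→ℚ n
    ℕ→ℚ-* m n = ℚ.toℚᵘ-injective (ℚᵘ.≃-trans (toℚᵘ-ℕ (m * n)) (ℚᵘ.≃-trans (ℚᵘ.*≡* (cong (ℤ._* + 1) (ℤ.pos-* m n)))
      (ℚᵘ.≃-sym (ℚᵘ.≃-trans (ℚ.toℚᵘ-homo-* (ℕ→ℚ m) (ℕ→ℚ n)) (ℚᵘ.*-cong (toℚᵘ-ℕ m) (toℚᵘ-ℕ n))))))

    ℕ→ℚ-mono : ∀ {m n} → m ≤ n → ℕ→ℚ m ℚ.≤ ℕ→ℚ n
    ℕ→ℚ-mono {m} {n} le = ℚ.toℚᵘ-cancel-≤ (ℚᵘ.≤-respˡ-≃ (ℚᵘ.≃-sym (toℚᵘ-ℕ m)) (ℚᵘ.≤-respʳ-≃ (ℚᵘ.≃-sym (toℚᵘ-ℕ n))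
      (ℚᵘ.*≤* (ℤ.*-monoʳ-≤-nonNeg (+ 1) (ℤ.+≤+ le)))))

    archimedean : ∀ ε → 0ℚ ℚ.< ε → ∃ λ D → 1ℚ ℚ.≤ ℕ→ℚ D ℚ.* ε
    archimedean ε@(ℚ.mkℚ (+ suc k) d _) 0<ε = suc d , ℚ.toℚᵘ-cancel-≤ (ℚᵘ.≤-respʳ-≃
        (ℚᵘ.≃-sym (ℚᵘ.≃-trans (ℚ.toℚᵘ-homo-* (ℕ→ℚ (suc d)) ε) (ℚᵘ.*-congʳ {ℚ.toℚᵘ ε} (toℚᵘ-ℕ (suc d)))))
        (ℚᵘ.*≤* (ℤ.+≤+ (ℕ.≤-trans (ℕ.≤-reflexive (eq₁ d)) (ℕ.≤-trans (ℕ.m≤m*n (suc d) (suc k)) (ℕ.≤-reflexive (eq₂ d k)))))))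
      where
      eq₁ : ∀ d → 1 * (1 * suc d) ≡ suc d
      eq₁ = ℕ-solve-∀
      eq₂ : ∀ d k → suc d * suc k ≡ suc d * suc k * 1
      eq₂ = ℕ-solve-∀
    archimedean (ℚ.mkℚ (+ zero) d c) (ℚ.*<* lt) = ⊥-elim (ℤ.<-irrefl refl lt)
    archimedean (ℚ.mkℚ (ℤ.-[1+ k ]) d c) (ℚ.*<* ())

  ℕ→ℚ-nonNeg : ∀ m → 0ℚ ℚ.≤ ℕ→ℚ m
  ℕ→ℚ-nonNeg m = ℕ→ℚ-mono {0} {m} z≤n

  ℕ→ℚ-≥1 : ∀ {m} → 1 ≤ m → 1ℚ ℚ.≤ ℕ→ℚ m
  ℕ→ℚ-≥1 = ℕ→ℚ-mono {1}

  ℕ→ℚ-^ : ∀ m k → ℕ→ℚ (m ^ k) ≡ ℕ→ℚ m ^ℚ k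
  ℕ→ℚ-^ m zero    = refl
  ℕ→ℚ-^ m (suc k) = trans (ℕ→ℚ-* m (m ^ k)) (cong (ℕ→ℚ m ℚ.*_) (ℕ→ℚ-^ m k))

  ^-distrib-* : ∀ x y k → (x ℚ.* y) ^ℚ k ≡ (x ^ℚ k) ℚ.* (y ^ℚ k)
  ^-distrib-* x y zero    = sym (ℚ.*-identityˡ 1ℚ)
  ^-distrib-* x y (suc k) = trans (cong (x ℚ.* y ℚ.*_) (^-distrib-* x y k))
    (solve 4 (λ x y a b → x :* y :* (a :* b) := x :* a :* (y :* b)) refl x y (x ^ℚ k) (y ^ℚ k))
    where open +-*-Solver

  1^ : ∀ k → 1ℚ ^ℚ k ≡ 1ℚ
  1^ zero    = refl
  1^ (suc k) = trans (ℚ.*-identityˡ _) (1^ k)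

  ^-* : ∀ x j k → x ^ℚ (j * k) ≡ (x ^ℚ j) ^ℚ k
  ^-* x zero    k = sym (1^ k)
  ^-* x (suc j) k = trans (^-+ x k (j * k)) (trans (cong ((x ^ℚ k) ℚ.*_) (^-* x j k)) (sym (^-distrib-* x (x ^ℚ j) k)))

  ^-mono : ∀ {x y} → 0ℚ ℚ.≤ x → x ℚ.≤ y → ∀ k → x ^ℚ k ℚ.≤ y ^ℚ k
  ^-mono 0≤x x≤y zero    = ℚ.≤-refl
  ^-mono 0≤x x≤y (suc k) = *-mono-≤⁺ 0≤x (^-nonNeg (ℚ.≤-trans 0≤x x≤y) k) x≤y (^-mono 0≤x x≤y k)

  ^-≤1 : ∀ {x} → 0ℚ ℚ.≤ x → x ℚ.≤ 1ℚ → ∀ k → x ^ℚ k ℚ.≤ 1ℚ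
  ^-≤1 {x} 0≤x x≤1 k = subst (x ^ℚ k ℚ.≤_) (1^ k) (^-mono 0≤x x≤1 k)

  ^-≥1 : ∀ {x} → 1ℚ ℚ.≤ x → ∀ k → 1ℚ ℚ.≤ x ^ℚ k
  ^-≥1 {x} 1≤x k = subst (ℚ._≤ x ^ℚ k) (1^ k) (^-mono 0≤1 1≤x k)

  ^-mono-exp : ∀ {x j k} → 1ℚ ℚ.≤ x → j ≤ k → x ^ℚ j ℚ.≤ x ^ℚ k
  ^-mono-exp {x} {zero}  {k}     1≤x _        = ^-≥1 1≤x k
  ^-mono-exp {x} {suc j} {suc k} 1≤x (s≤s le) = ℚ.*-monoˡ-≤-nonNeg x {{ℚ.nonNegative (ℚ.≤-trans 0≤1 1≤x)}} (^-mono-exp 1≤x le)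

  -- Stands in for extracting an a-th root, which would leave the rationals.
  root-≤1 : ∀ {x a} → 1 ≤ a → x ^ℚ a ℚ.≤ 1ℚ → x ℚ.≤ 1ℚ
  root-≤1 {x} {suc a} _ le with ℚ.≤-total x 1ℚ
  ... | inj₁ h = h
  ... | inj₂ 1≤x = ℚ.≤-trans (subst (ℚ._≤ x ^ℚ suc a) (ℚ.*-identityʳ x)
        (ℚ.*-monoˡ-≤-nonNeg x {{ℚ.nonNegative (ℚ.≤-trans 0≤1 1≤x)}} (^-≥1 1≤x a))) le

  sumℚ-≤ : ∀ {A : Set} (g : A → ℚ) b xs → (∀ {x} → x ∈ xs → g x ℚ.≤ b) → sumℚ (map g xs) ℚ.≤ ℕ→ℚ (length xs) ℚ.* b
  sumℚ-≤ g b []       h = ℚ.≤-reflexive (sym (ℚ.*-zeroˡ b))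
  sumℚ-≤ g b (x ∷ xs) h = ℚ.≤-trans (ℚ.+-mono-≤ (h (here refl)) (sumℚ-≤ g b xs (h ∘ there)))
    (ℚ.≤-reflexive (trans (cong (ℚ._+ ℕ→ℚ (length xs) ℚ.* b) (sym (ℚ.*-identityˡ b)))
      (trans (sym (ℚ.*-distribʳ-+ b 1ℚ (ℕ→ℚ (length xs)))) (cong (ℚ._* b) (sym (ℕ→ℚ-+ 1 (length xs)))))))

  sumℚ-mono : ∀ {A : Set} {g h : A → ℚ} xs → (∀ {x} → x ∈ xs → g x ℚ.≤ h x) → sumℚ (map g xs) ℚ.≤ sumℚ (map h xs)
  sumℚ-mono []       le = ℚ.≤-refl
  sumℚ-mono (x ∷ xs) le = ℚ.+-mono-≤ (le (here refl)) (sumℚ-mono xs (le ∘ there))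

open NaturalsInRationals

-- The first moment of a run.

module ExplorationWeights where

  spanBound : ℕ → ℕ → ℕ → ℕ
  spanBound zero    Q m = m
  spanBound (suc h) Q m = spanBound h Q m + spanBound h Q m * spanBound h Q m * interpSize Q

  length-spanⁿ : ∀ h {Q K m} → length K ≤ m → length (spanⁿ h Q K) ≤ spanBound h Q m
  length-spanⁿ zero    le = le
  length-spanⁿ (suc h) {Q} {K} le = ℕ.≤-trans (ℕ.≤-reflexive (length-span Q (spanⁿ h Q K)))
    (ℕ.+-mono-≤ ih (ℕ.*-monoˡ-≤ (interpSize Q) (ℕ.*-mono-≤ ih ih)))
    where ih = length-spanⁿ h {Q} {K} le

  module Totals (p : ℚ) (0≤p : 0ℚ ℚ.≤ p) (p≤1 : p ℚ.≤ 1ℚ) (n : ℕ) (1≤n : 1 ≤ n) where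

    open Measure p 0≤p p≤1 public

    ν : ℚ
    ν = ℕ→ℚ n

    1≤ν : 1ℚ ℚ.≤ ν
    1≤ν = ℕ→ℚ-≥1 1≤n

    0≤ν : 0ℚ ℚ.≤ ν
    0≤ν = ℚ.≤-trans 0≤1 1≤ν

    total-nonNeg : ∀ ws → 0ℚ ℚ.≤ total ws
    total-nonNeg ws = sumℚ-nonNeg ws λ w → ^-nonNeg 0≤p (length w)

    total-++ : ∀ ws vs → total (ws ++ vs) ≡ total ws ℚ.+ total vs
    total-++ ws vs = trans (cong sumℚ (List.map-++ (λ w → p ^ℚ length w) ws vs)) (sumℚ-++ (map (λ w → p ^ℚ length w) ws) (map (λ w → p ^ℚ length w) vs))

    total-map-++ : ∀ xs ws → total (map (xs ++_) ws) ≡ (p ^ℚ length xs) ℚ.* total ws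
    total-map-++ xs []       = sym (ℚ.*-zeroʳ (p ^ℚ length xs))
    total-map-++ xs (w ∷ ws) = trans (cong₂ ℚ._+_ (trans (cong (p ^ℚ_) (List.length-++ xs)) (^-+ p (length xs) (length w))) (total-map-++ xs ws))
      (sym (ℚ.*-distribˡ-+ (p ^ℚ length xs) (p ^ℚ length w) (total ws)))

    total-concatMap : ∀ {A : Set} (f : A → List (List ℕ)) xs → total (concatMap f xs) ≡ sumℚ (map (λ x → total (f x)) xs)
    total-concatMap f []       = refl
    total-concatMap f (x ∷ xs) = trans (total-++ (f x) (concatMap f xs)) (cong (total (f x) ℚ.+_) (total-concatMap f xs))

    module _ (Q m : ℕ) where

      private
        D = spanBound 3 Q m
        y = ℕ→ℚ (suc D) ℚ.* p

        0≤y : 0ℚ ℚ.≤ y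
        0≤y = ℕ→ℚ-nonNeg (suc D) *⁺ 0≤p

        y≡ : y ≡ p ℚ.+ ℕ→ℚ D ℚ.* p
        y≡ = trans (cong (ℚ._* p) (ℕ→ℚ-+ 1 D)) (trans (ℚ.*-distribʳ-+ p 1ℚ (ℕ→ℚ D)) (cong (ℚ._+ ℕ→ℚ D ℚ.* p) (ℚ.*-identityˡ p)))

        cons-total : ∀ {A b} xs (G : ℕ → List (List ℕ)) k → length xs ≤ k → 0ℚ ℚ.≤ b → (∀ {x} → x ∈ xs → total (G x) ℚ.≤ b) →
          A ≡ total (concatMap (λ x → map (x ∷_) (G x)) xs) → A ℚ.≤ ℕ→ℚ k ℚ.* (p ℚ.* b)
        cons-total {b = b} xs G k le 0≤b h refl = begin
          total (concatMap (λ x → map (x ∷_) (G x)) xs)           ≡⟨ total-concatMap (λ x → map (x ∷_) (G x)) xs ⟩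
          sumℚ (map (λ x → total (map (x ∷_) (G x))) xs)          ≤⟨ sumℚ-≤ _ (p ℚ.* b) xs (λ {x} x∈ → ℚ.≤-trans (ℚ.≤-reflexive
              (trans (total-map-++ (x ∷ []) (G x)) (cong (ℚ._* total (G x)) (ℚ.*-identityʳ p)))) (ℚ.*-monoˡ-≤-nonNeg p {{ℚ.nonNegative 0≤p}} (h x∈))) ⟩
          ℕ→ℚ (length xs) ℚ.* (p ℚ.* b)                           ≤⟨ ℚ.*-monoʳ-≤-nonNeg (p ℚ.* b) {{ℚ.nonNegative (0≤p *⁺ 0≤b)}} (ℕ→ℚ-mono le) ⟩
          ℕ→ℚ k ℚ.* (p ℚ.* b)                                     ∎
          where open ℚ.≤-Reasoning

        fits : ∀ {a N} → a + suc N ≤ m → suc a + N ≤ m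
        fits {a} {N} = ℕ.≤-trans (ℕ.≤-reflexive (sym (ℕ.+-suc a N)))

      -- Each position is either free, with n choices and one unit of `f` spent, or one of at most D
      -- determined points. Charging 1 + D at every position separates the two kinds; the capacity
      -- `m` makes D uniform over all intermediate lists.
      generated-total : ∀ N f A → length A + N ≤ m → total (generated n Q A f N) ℚ.≤ (ν ^ℚ f) ℚ.* (y ^ℚ N)
      generated-total zero f A le = subst (ℚ._≤ (ν ^ℚ f) ℚ.* 1ℚ) (sym (ℚ.+-identityʳ 1ℚ))
        (subst (1ℚ ℚ.≤_) (sym (ℚ.*-identityʳ (ν ^ℚ f))) (^-≥1 1≤ν f))
      generated-total (suc N) zero A le = ℚ.≤-trans
        (cons-total (spanⁿ 3 Q A) (λ x → generated n Q (x ∷ A) zero N) D (length-spanⁿ 3 {Q} {A} (ℕ.≤-trans (ℕ.m≤m+n _ _) le)) (^-nonNeg 0≤y N)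
          (λ {x} _ → subst (total (generated n Q (x ∷ A) zero N) ℚ.≤_) (ℚ.*-identityˡ (y ^ℚ N)) (generated-total N zero (x ∷ A) (fits {length A} le))) refl)
        (subst₂ ℚ._≤_ (ℚ.*-assoc (ℕ→ℚ D) p (y ^ℚ N)) (sym (ℚ.*-identityˡ (y ^ℚ suc N)))
          (ℚ.*-monoʳ-≤-nonNeg (y ^ℚ N) {{ℚ.nonNegative (^-nonNeg 0≤y N)}} (subst (ℕ→ℚ D ℚ.* p ℚ.≤_) (sym y≡)
            (subst (ℚ._≤ p ℚ.+ ℕ→ℚ D ℚ.* p) (ℚ.+-identityˡ (ℕ→ℚ D ℚ.* p)) (ℚ.+-monoˡ-≤ (ℕ→ℚ D ℚ.* p) 0≤p)))))
      generated-total (suc N) (suc f) A le = begin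
        total (generated n Q A (suc f) (suc N))
          ≡⟨ total-++ (concatMap (λ x → map (x ∷_) (generated n Q (x ∷ A) f N)) (applyUpTo suc n))
               (concatMap (λ x → map (x ∷_) (generated n Q (x ∷ A) (suc f) N)) (spanⁿ 3 Q A)) ⟩
        total (concatMap (λ x → map (x ∷_) (generated n Q (x ∷ A) f N)) (applyUpTo suc n)) ℚ.+
        total (concatMap (λ x → map (x ∷_) (generated n Q (x ∷ A) (suc f) N)) (spanⁿ 3 Q A))
          ≤⟨ ℚ.+-mono-≤
               (cons-total (applyUpTo suc n) (λ x → generated n Q (x ∷ A) f N) n (ℕ.≤-reflexive (List.length-applyUpTo suc n))
                 (^-nonNeg 0≤ν f *⁺ ^-nonNeg 0≤y N) (λ {x} _ → generated-total N f (x ∷ A) (fits {length A} le)) refl)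
               (cons-total (spanⁿ 3 Q A) (λ x → generated n Q (x ∷ A) (suc f) N) D (length-spanⁿ 3 {Q} {A} (ℕ.≤-trans (ℕ.m≤m+n _ _) le))
                 (^-nonNeg 0≤ν (suc f) *⁺ ^-nonNeg 0≤y N) (λ {x} _ → generated-total N (suc f) (x ∷ A) (fits {length A} le)) refl) ⟩
        ν ℚ.* (p ℚ.* ((ν ^ℚ f) ℚ.* (y ^ℚ N))) ℚ.+ ℕ→ℚ D ℚ.* (p ℚ.* (ν ℚ.* (ν ^ℚ f) ℚ.* (y ^ℚ N)))
          ≡⟨ solve 5 (λ v p a b d → v :* (p :* (a :* b)) :+ d :* (p :* (v :* a :* b)) := v :* a :* ((p :+ d :* p) :* b)) refl ν p (ν ^ℚ f) (y ^ℚ N) (ℕ→ℚ D) ⟩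
        ν ℚ.* (ν ^ℚ f) ℚ.* ((p ℚ.+ ℕ→ℚ D ℚ.* p) ℚ.* (y ^ℚ N))
          ≡⟨ cong (λ k → ν ℚ.* (ν ^ℚ f) ℚ.* (k ℚ.* (y ^ℚ N))) (sym y≡) ⟩
        (ν ^ℚ suc f) ℚ.* (y ^ℚ suc N) ∎
        where
        open ℚ.≤-Reasoning
        open +-*-Solver

      mass : List (ℕ × ℕ) → ℚ
      mass shapes = sumℚ (map (λ s → (ν ^ℚ proj₁ s) ℚ.* (p ^ℚ proj₂ s)) shapes)

      family-total : ∀ {s} A shapes → (∀ {x} → x ∈ shapes → proj₂ x ≤ s) → length A + s ≤ m →
        total (family n Q A shapes) ℚ.≤ ℕ→ℚ (suc D ^ s) ℚ.* mass shapes
      family-total {s} A shapes small le = begin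
        total (family n Q A shapes)                       ≡⟨ total-concatMap (λ x → generated n Q A (proj₁ x) (proj₂ x)) shapes ⟩
        sumℚ (map (λ x → total (generated n Q A (proj₁ x) (proj₂ x))) shapes)
                                                          ≤⟨ sumℚ-mono shapes bound ⟩
        sumℚ (map (λ x → g ℚ.* ((ν ^ℚ proj₁ x) ℚ.* (p ^ℚ proj₂ x))) shapes)
                                                          ≡⟨ cong sumℚ (List.map-∘ shapes) ⟩
        sumℚ (map (g ℚ.*_) (map (λ x → (ν ^ℚ proj₁ x) ℚ.* (p ^ℚ proj₂ x)) shapes))
                                                          ≡⟨ sumℚ-* g (map (λ x → (ν ^ℚ proj₁ x) ℚ.* (p ^ℚ proj₂ x)) shapes) ⟩
        g ℚ.* mass shapes ∎
        where
        open ℚ.≤-Reasoning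
        g = ℕ→ℚ (suc D ^ s)
        bound : ∀ {x} → x ∈ shapes → total (generated n Q A (proj₁ x) (proj₂ x)) ℚ.≤ g ℚ.* ((ν ^ℚ proj₁ x) ℚ.* (p ^ℚ proj₂ x))
        bound {f , N} x∈ = begin
          total (generated n Q A f N)                        ≤⟨ generated-total N f A (ℕ.≤-trans (ℕ.+-monoʳ-≤ (length A) (small x∈)) le) ⟩
          (ν ^ℚ f) ℚ.* (y ^ℚ N)                              ≡⟨ cong ((ν ^ℚ f) ℚ.*_) (^-distrib-* (ℕ→ℚ (suc D)) p N) ⟩
          (ν ^ℚ f) ℚ.* ((ℕ→ℚ (suc D) ^ℚ N) ℚ.* (p ^ℚ N))     ≤⟨ ℚ.*-monoˡ-≤-nonNeg (ν ^ℚ f) {{ℚ.nonNegative (^-nonNeg 0≤ν f)}}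
                                                                 (ℚ.*-monoʳ-≤-nonNeg (p ^ℚ N) {{ℚ.nonNegative (^-nonNeg 0≤p N)}}
                                                                   (ℚ.≤-trans (^-mono-exp (ℕ→ℚ-≥1 {suc D} (s≤s z≤n)) (small x∈)) (ℚ.≤-reflexive (sym (ℕ→ℚ-^ (suc D) s))))) ⟩
          (ν ^ℚ f) ℚ.* (g ℚ.* (p ^ℚ N))                      ≡⟨ solve 3 (λ a g b → a :* (g :* b) := g :* (a :* b)) refl (ν ^ℚ f) g (p ^ℚ N) ⟩
          g ℚ.* ((ν ^ℚ f) ℚ.* (p ^ℚ N))                      ∎
          where open +-*-Solver

    module Recursion (q r m : ℕ) (κ : ℚ) (0≤κ : 0ℚ ℚ.≤ κ) where

      open Shapes q r

      two half b : ℚ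
      two  = ℕ→ℚ 2
      half = ℚ.½
      b    = two ^ℚ (size q r + size q r)

      -- Every pending vertex carries a factor 2, and `b` is the largest factor by which one
      -- extension raises this through both queues. If extensions have total weight at most 1/(8b),
      -- then 4κ + 2^(-t) reproduces itself under the recursion, κ paying for kills and 2^(-t) for
      -- runs that exhaust their steps.
      bound : ℕ → ℚ
      bound t = ℕ→ℚ 4 ℚ.* κ ℚ.+ half ^ℚ t

      private
        0≤two : 0ℚ ℚ.≤ two
        0≤two = ℕ→ℚ-nonNeg 2

        1≤two : 1ℚ ℚ.≤ two
        1≤two = ℕ→ℚ-≥1 {2} (s≤s z≤n)

        0≤half : 0ℚ ℚ.≤ half
        0≤half = ℚ.nonNegative⁻¹ half

        0≤bound : ∀ t → 0ℚ ℚ.≤ bound t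
        0≤bound t = +⁺ (ℕ→ℚ-nonNeg 4 *⁺ 0≤κ) (^-nonNeg 0≤half t)

        κ≤bound : ∀ t → κ ℚ.≤ bound t
        κ≤bound t = begin
          κ                           ≡⟨ sym (ℚ.*-identityˡ κ) ⟩
          1ℚ ℚ.* κ                    ≤⟨ ℚ.*-monoʳ-≤-nonNeg κ {{ℚ.nonNegative 0≤κ}} (ℕ→ℚ-≥1 {4} (s≤s z≤n)) ⟩
          ℕ→ℚ 4 ℚ.* κ                 ≡⟨ sym (ℚ.+-identityʳ _) ⟩
          ℕ→ℚ 4 ℚ.* κ ℚ.+ 0ℚ          ≤⟨ ℚ.+-monoʳ-≤ (ℕ→ℚ 4 ℚ.* κ) (^-nonNeg 0≤half t) ⟩
          bound t                     ∎
          where open ℚ.≤-Reasoning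

        -- k: a kill now; w: the vertex is processed without extension; e: an extension is made.
        step : ∀ {t z k w e τ} → 1ℚ ℚ.≤ z → k ℚ.≤ κ → w ℚ.≤ bound (suc t) ℚ.* z → 0ℚ ℚ.≤ τ → ℕ→ℚ 8 ℚ.* τ ℚ.≤ 1ℚ →
          e ℚ.≤ τ ℚ.* (bound t ℚ.* (two ℚ.* z)) → k ℚ.+ (w ℚ.+ e) ℚ.≤ bound (suc t) ℚ.* (two ℚ.* z)
        step {t} {z} {k} {w} {e} {τ} 1≤z hk hw 0≤τ hτ he = begin
          k ℚ.+ (w ℚ.+ e)                                           ≤⟨ ℚ.+-mono-≤ (ℚ.≤-trans hk κ≤κz) (ℚ.+-mono-≤ hw (ℚ.≤-trans he e≤)) ⟩
          κ ℚ.* z ℚ.+ ((ℕ→ℚ 4 ℚ.* κ ℚ.+ h) ℚ.* z ℚ.+ (κ ℚ.* z ℚ.+ h ℚ.* z))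
                                                                    ≡⟨ solve 3 (λ k h z → k :* z :+ ((con (ℕ→ℚ 4) :* k :+ h) :* z :+ (k :* z :+ h :* z))
                                                                         := con (ℕ→ℚ 6) :* (k :* z) :+ con (ℕ→ℚ 2) :* (h :* z)) refl κ h z ⟩
          ℕ→ℚ 6 ℚ.* (κ ℚ.* z) ℚ.+ two ℚ.* (h ℚ.* z)                 ≤⟨ ℚ.+-monoˡ-≤ (two ℚ.* (h ℚ.* z)) (ℚ.*-monoʳ-≤-nonNeg (κ ℚ.* z) {{ℚ.nonNegative 0≤κz}} (ℕ→ℚ-mono {6} {8} (ℕ.m≤m+n 6 2))) ⟩
          ℕ→ℚ 8 ℚ.* (κ ℚ.* z) ℚ.+ two ℚ.* (h ℚ.* z)                 ≡⟨ solve 3 (λ k h z → con (ℕ→ℚ 8) :* (k :* z) :+ con (ℕ→ℚ 2) :* (h :* z)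
                                                                         := (con (ℕ→ℚ 4) :* k :+ h) :* (con (ℕ→ℚ 2) :* z)) refl κ h z ⟩
          bound (suc t) ℚ.* (two ℚ.* z)                             ∎
          where
          open ℚ.≤-Reasoning
          open +-*-Solver
          h = half ^ℚ suc t
          0≤z = ℚ.≤-trans 0≤1 1≤z
          0≤h = ^-nonNeg 0≤half (suc t)
          0≤κz = 0≤κ *⁺ 0≤z
          κ≤κz : κ ℚ.≤ κ ℚ.* z
          κ≤κz = subst (ℚ._≤ κ ℚ.* z) (ℚ.*-identityʳ κ) (ℚ.*-monoˡ-≤-nonNeg κ {{ℚ.nonNegative 0≤κ}} 1≤z)
          Y = κ ℚ.* z ℚ.+ h ℚ.* z
          0≤Y = +⁺ 0≤κz (0≤h *⁺ 0≤z)
          expand : bound t ℚ.* (two ℚ.* z) ℚ.≤ ℕ→ℚ 8 ℚ.* Y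
          expand = begin
            bound t ℚ.* (two ℚ.* z)                                  ≡⟨ cong (λ k → (ℕ→ℚ 4 ℚ.* κ ℚ.+ k) ℚ.* (two ℚ.* z)) (sym (trans (sym (ℚ.*-assoc two half (half ^ℚ t))) (ℚ.*-identityˡ (half ^ℚ t)))) ⟩
            (ℕ→ℚ 4 ℚ.* κ ℚ.+ two ℚ.* h) ℚ.* (two ℚ.* z)              ≡⟨ solve 3 (λ k h z → (con (ℕ→ℚ 4) :* k :+ con (ℕ→ℚ 2) :* h) :* (con (ℕ→ℚ 2) :* z)
                                                                           := con (ℕ→ℚ 8) :* (k :* z) :+ con (ℕ→ℚ 4) :* (h :* z)) refl κ h z ⟩
            ℕ→ℚ 8 ℚ.* (κ ℚ.* z) ℚ.+ ℕ→ℚ 4 ℚ.* (h ℚ.* z)              ≤⟨ ℚ.+-monoʳ-≤ (ℕ→ℚ 8 ℚ.* (κ ℚ.* z)) (ℚ.*-monoʳ-≤-nonNeg (h ℚ.* z) {{ℚ.nonNegative (0≤h *⁺ 0≤z)}} (ℕ→ℚ-mono {4} {8} (ℕ.m≤m+n 4 4))) ⟩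
            ℕ→ℚ 8 ℚ.* (κ ℚ.* z) ℚ.+ ℕ→ℚ 8 ℚ.* (h ℚ.* z)              ≡⟨ sym (ℚ.*-distribˡ-+ (ℕ→ℚ 8) (κ ℚ.* z) (h ℚ.* z)) ⟩
            ℕ→ℚ 8 ℚ.* Y                                              ∎
          e≤ : τ ℚ.* (bound t ℚ.* (two ℚ.* z)) ℚ.≤ Y
          e≤ = begin
            τ ℚ.* (bound t ℚ.* (two ℚ.* z))     ≤⟨ ℚ.*-monoˡ-≤-nonNeg τ {{ℚ.nonNegative 0≤τ}} expand ⟩
            τ ℚ.* (ℕ→ℚ 8 ℚ.* Y)                 ≡⟨ solve 3 (λ a b c → a :* (b :* c) := (b :* a) :* c) refl τ (ℕ→ℚ 8) Y ⟩
            ℕ→ℚ 8 ℚ.* τ ℚ.* Y                   ≤⟨ ℚ.*-monoʳ-≤-nonNeg Y {{ℚ.nonNegative 0≤Y}} hτ ⟩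
            1ℚ ℚ.* Y                            ≡⟨ ℚ.*-identityˡ Y ⟩
            Y                                   ∎

      module _
        (kills≤ : ∀ A → length A + size q r ≤ m → total (kills n A) ℚ.≤ κ)
        (extensions-short : ∀ A v {xs} → xs ∈ extensions n A v → length xs ≤ size q r)
        (extensions≤ : ∀ A v → length A + size q r ≤ m → ℕ→ℚ 8 ℚ.* (total (extensions n A v) ℚ.* b) ℚ.≤ 1ℚ) where

        branches : ∀ {t ℓ} A v (W : List ℕ → List (List ℕ)) →
          (∀ xs → length xs ≤ size q r → total (W xs) ℚ.≤ bound t ℚ.* (two ^ℚ (size q r + size q r + ℓ))) →
          total (concatMap (λ xs → map (xs ++_) (W xs)) (extensions n A v)) ℚ.≤
          total (extensions n A v) ℚ.* b ℚ.* (bound t ℚ.* (two ^ℚ ℓ))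
        branches {t} {ℓ} A v W h = begin
          total (concatMap (λ xs → map (xs ++_) (W xs)) (extensions n A v))
            ≡⟨ total-concatMap (λ xs → map (xs ++_) (W xs)) (extensions n A v) ⟩
          sumℚ (map (λ xs → total (map (xs ++_) (W xs))) (extensions n A v))
            ≤⟨ sumℚ-mono (extensions n A v) (λ {xs} xs∈ → ℚ.≤-trans (ℚ.≤-reflexive (total-map-++ xs (W xs)))
                 (ℚ.≤-trans (ℚ.*-monoˡ-≤-nonNeg (p ^ℚ length xs) {{ℚ.nonNegative (^-nonNeg 0≤p (length xs))}} (h xs (extensions-short A v xs∈)))
                   (ℚ.≤-reflexive (ℚ.*-comm (p ^ℚ length xs) c)))) ⟩
          sumℚ (map (λ xs → c ℚ.* (p ^ℚ length xs)) (extensions n A v))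
            ≡⟨ cong sumℚ (List.map-∘ (extensions n A v)) ⟩
          sumℚ (map (c ℚ.*_) (map (λ xs → p ^ℚ length xs) (extensions n A v)))
            ≡⟨ sumℚ-* c (map (λ xs → p ^ℚ length xs) (extensions n A v)) ⟩
          c ℚ.* total (extensions n A v)
            ≡⟨ cong (λ k → bound t ℚ.* k ℚ.* total (extensions n A v)) (^-+ two (size q r + size q r) ℓ) ⟩
          bound t ℚ.* (b ℚ.* (two ^ℚ ℓ)) ℚ.* total (extensions n A v)
            ≡⟨ solve 4 (λ x b z e → x :* (b :* z) :* e := e :* b :* (x :* z)) refl (bound t) b (two ^ℚ ℓ) (total (extensions n A v)) ⟩
          total (extensions n A v) ℚ.* b ℚ.* (bound t ℚ.* (two ^ℚ ℓ)) ∎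
          where
          open ℚ.≤-Reasoning
          open +-*-Solver
          c = bound t ℚ.* (two ^ℚ (size q r + size q r + ℓ))

        room : ∀ {a t} → a + suc (suc t) * size q r ≤ m → a + size q r ≤ m
        room {a} {t} le = ℕ.≤-trans (ℕ.+-monoʳ-≤ a (ℕ.m≤m+n (size q r) (suc t * size q r))) le

        room′ : ∀ {a t} xs (A : List ℕ) → a ≡ length A → length xs ≤ size q r → a + suc (suc t) * size q r ≤ m →
          length (xs ++ A) + suc t * size q r ≤ m
        room′ {t = t} xs A refl short le = begin
          length (xs ++ A) + suc t * s          ≡⟨ cong (_+ suc t * s) (List.length-++ xs) ⟩
          length xs + length A + suc t * s      ≤⟨ ℕ.+-monoˡ-≤ (suc t * s) (ℕ.+-monoˡ-≤ (length A) short) ⟩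
          s + length A + suc t * s              ≡⟨ eq s (length A) t ⟩
          length A + suc (suc t) * s            ≤⟨ le ⟩
          m                                     ∎
          where
          open ℕ.≤-Reasoning
          s = size q r
          eq : ∀ s a t → s + a + suc t * s ≡ a + suc (suc t) * s
          eq = ℕ-solve-∀

        -- Induction on t and, for fixed t, on the queues. The hypothesis reserves room for t more
        -- extensions and one last kill, each of at most `size` vertices.
        explore-total : ∀ t A E F → length A + suc t * size q r ≤ m →
          total (explore n t A E F) ℚ.≤ bound t ℚ.* (two ^ℚ (length E + length F))
        explore-total zero A E F le = begin
          1ℚ ℚ.+ 0ℚ                                            ≡⟨ ℚ.+-identityʳ 1ℚ ⟩
          1ℚ                                                   ≡⟨ sym (ℚ.*-identityˡ 1ℚ) ⟩
          1ℚ ℚ.* 1ℚ                                            ≤⟨ *-mono-≤⁺ 0≤1 (^-nonNeg 0≤two (length E + length F))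
                                                                    (subst (ℚ._≤ bound 0) (ℚ.+-identityˡ 1ℚ) (ℚ.+-monoˡ-≤ 1ℚ (ℕ→ℚ-nonNeg 4 *⁺ 0≤κ))) (^-≥1 1≤two (length E + length F)) ⟩
          bound 0 ℚ.* (two ^ℚ (length E + length F))           ∎
          where open ℚ.≤-Reasoning
        explore-total (suc t) A [] [] le = ℚ.≤-trans (kills≤ A (room {length A} {t} le))
          (subst (κ ℚ.≤_) (sym (ℚ.*-identityʳ (bound (suc t)))) (κ≤bound (suc t)))
        explore-total (suc t) A [] (v ∷ F) le = subst (ℚ._≤ bound (suc t) ℚ.* (two ^ℚ suc (length F)))
          (sym (trans (total-++ (kills n A) (explore n (suc t) A [] F ++ concatMap (λ xs → map (xs ++_) (explore n t (xs ++ A) xs (xs ++ v ∷ F))) (extensions n A v))) (cong (total (kills n A) ℚ.+_) (total-++ (explore n (suc t) A [] F) (concatMap (λ xs → map (xs ++_) (explore n t (xs ++ A) xs (xs ++ v ∷ F))) (extensions n A v))))))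
          (step {t} (^-≥1 1≤two (length F)) (kills≤ A (room {length A} {t} le)) (explore-total (suc t) A [] F le)
            (total-nonNeg (extensions n A v) *⁺ ^-nonNeg 0≤two (size q r + size q r)) (extensions≤ A v (room {length A} {t} le))
            (branches {t} {suc (length F)} A v (λ xs → explore n t (xs ++ A) xs (xs ++ v ∷ F)) λ xs short → ℚ.≤-trans
              (explore-total t (xs ++ A) xs (xs ++ v ∷ F) (room′ {t = t} xs A refl short le))
              (ℚ.*-monoˡ-≤-nonNeg (bound t) {{ℚ.nonNegative (0≤bound t)}} (^-mono-exp 1≤two (queue xs short)))))
          where
          queue : ∀ xs → length xs ≤ size q r → length xs + length (xs ++ v ∷ F) ≤ size q r + size q r + suc (length F)
          queue xs short = ℕ.≤-trans (ℕ.≤-reflexive (trans (cong (λ k → length xs + k) (List.length-++ xs)) (sym (ℕ.+-assoc (length xs) (length xs) _))))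
            (ℕ.+-monoˡ-≤ (suc (length F)) (ℕ.+-mono-≤ short short))
        explore-total (suc t) A (v ∷ E) F le = subst (ℚ._≤ bound (suc t) ℚ.* (two ^ℚ suc (length E + length F)))
          (sym (trans (total-++ (kills n A) (explore n (suc t) A E F ++ concatMap (λ xs → map (xs ++_) (explore n t (xs ++ A) (xs ++ v ∷ E) (xs ++ F))) (extensions n A v))) (cong (total (kills n A) ℚ.+_) (total-++ (explore n (suc t) A E F) (concatMap (λ xs → map (xs ++_) (explore n t (xs ++ A) (xs ++ v ∷ E) (xs ++ F))) (extensions n A v))))))
          (step {t} (^-≥1 1≤two (length E + length F)) (kills≤ A (room {length A} {t} le)) (explore-total (suc t) A E F le)
            (total-nonNeg (extensions n A v) *⁺ ^-nonNeg 0≤two (size q r + size q r)) (extensions≤ A v (room {length A} {t} le))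
            (branches {t} {suc (length E + length F)} A v (λ xs → explore n t (xs ++ A) (xs ++ v ∷ E) (xs ++ F)) λ xs short → ℚ.≤-trans
              (explore-total t (xs ++ A) (xs ++ v ∷ E) (xs ++ F) (room′ {t = t} xs A refl short le))
              (ℚ.*-monoˡ-≤-nonNeg (bound t) {{ℚ.nonNegative (0≤bound t)}} (^-mono-exp 1≤two (queue xs short)))))
          where
          queue : ∀ xs → length xs ≤ size q r → length (xs ++ v ∷ E) + length (xs ++ F) ≤ size q r + size q r + suc (length E + length F)
          queue xs short = ℕ.≤-trans (ℕ.≤-reflexive (trans (cong₂ _+_ (List.length-++ xs) (List.length-++ xs)) (eq (length xs) (length E) (length F))))
            (ℕ.+-monoˡ-≤ (suc (length E + length F)) (ℕ.+-mono-≤ short short))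
            where
            eq : ∀ x e f → x + suc e + (x + f) ≡ x + x + suc (e + f)
            eq = ℕ-solve-∀

open ExplorationWeights

-- Estimates from the threshold.

module WeightEstimates where

  -- The factor for all choices of determined vertices in one list, when at most m vertices are
  -- involved; it is polynomial in m.
  growth : ℕ → ℕ → ℕ → ℕ
  growth q r m = suc (spanBound 3 (depth q) m) ^ size q r

  module Estimates (q r : ℕ) (1≤a : 1 ≤ cost q r) (p : ℚ) (0≤p : 0ℚ ℚ.≤ p) (p≤1 : p ℚ.≤ 1ℚ) (n : ℕ) (1≤n : 1 ≤ n)
    (c : ℚ) (0≤c : 0ℚ ℚ.≤ c) (c≤1 : c ℚ.≤ 1ℚ) (threshold : (p ^ℚ cost q r) ℚ.* (ℕ→ℚ n ^ℚ r) ℚ.≤ c ^ℚ cost q r) where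

    open Totals p 0≤p p≤1 n 1≤n
    open Shapes q r

    private
      a = cost q r
      Q = depth q

    weightOf : ℕ × ℕ → ℚ
    weightOf (f , N) = (ν ^ℚ f) ℚ.* (p ^ℚ N)

    weightOf-nonNeg : ∀ s → 0ℚ ℚ.≤ weightOf s
    weightOf-nonNeg (f , N) = ^-nonNeg 0≤ν f *⁺ ^-nonNeg 0≤p N

    -- The a-th power makes the exponents integral: the threshold bounds (p^a n^r)^N by 1, and
    -- strictness of the light inequality spares one factor n.
    weightOf-light : ∀ {f N} → f * a < r * N → (weightOf (f , N) ^ℚ a) ℚ.* ν ℚ.≤ 1ℚ
    weightOf-light {f} {N} lt = begin
      (weightOf (f , N) ^ℚ a) ℚ.* ν                              ≡⟨ cong (ℚ._* ν) (^-distrib-* (ν ^ℚ f) (p ^ℚ N) a) ⟩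
      ((ν ^ℚ f) ^ℚ a) ℚ.* ((p ^ℚ N) ^ℚ a) ℚ.* ν                  ≡⟨ cong₂ (λ x y → x ℚ.* y ℚ.* ν) (sym (^-* ν f a)) (trans (sym (^-* p N a)) (cong (p ^ℚ_) (ℕ.*-comm N a))) ⟩
      (ν ^ℚ (f * a)) ℚ.* (p ^ℚ (a * N)) ℚ.* ν                    ≡⟨ solve 3 (λ x y v → x :* y :* v := (v :* x) :* y) refl (ν ^ℚ (f * a)) (p ^ℚ (a * N)) ν ⟩
      (ν ^ℚ suc (f * a)) ℚ.* (p ^ℚ (a * N))                      ≤⟨ ℚ.*-monoʳ-≤-nonNeg (p ^ℚ (a * N)) {{ℚ.nonNegative (^-nonNeg 0≤p (a * N))}} (^-mono-exp 1≤ν lt) ⟩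
      (ν ^ℚ (r * N)) ℚ.* (p ^ℚ (a * N))                          ≡⟨ trans (ℚ.*-comm (ν ^ℚ (r * N)) (p ^ℚ (a * N))) (trans (cong₂ ℚ._*_ (^-* p a N) (^-* ν r N)) (sym (^-distrib-* (p ^ℚ a) (ν ^ℚ r) N))) ⟩
      ((p ^ℚ a) ℚ.* (ν ^ℚ r)) ^ℚ N                               ≤⟨ ^-≤1 (^-nonNeg 0≤p a *⁺ ^-nonNeg 0≤ν r) (ℚ.≤-trans threshold (^-≤1 0≤c c≤1 a)) N ⟩
      1ℚ                                                         ∎
      where
      open ℚ.≤-Reasoning
      open +-*-Solver using (solve; _:+_; _:*_; _:=_; con)

    scaled-light : ∀ {f N} g → g ^ a ≤ n → f * a < r * N → ℕ→ℚ g ℚ.* weightOf (f , N) ℚ.≤ 1ℚ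
    scaled-light {f} {N} g le lt = root-≤1 1≤a (begin
      (ℕ→ℚ g ℚ.* w) ^ℚ a            ≡⟨ ^-distrib-* (ℕ→ℚ g) w a ⟩
      (ℕ→ℚ g ^ℚ a) ℚ.* (w ^ℚ a)     ≤⟨ ℚ.*-monoʳ-≤-nonNeg (w ^ℚ a) {{ℚ.nonNegative (^-nonNeg (weightOf-nonNeg (f , N)) a)}}
                                        (ℚ.≤-trans (ℚ.≤-reflexive (sym (ℕ→ℚ-^ g a))) (ℕ→ℚ-mono le)) ⟩
      ν ℚ.* (w ^ℚ a)                ≡⟨ ℚ.*-comm ν _ ⟩
      (w ^ℚ a) ℚ.* ν                ≤⟨ weightOf-light {f} {N} lt ⟩
      1ℚ                            ∎)
      where
      open ℚ.≤-Reasoning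
      w = weightOf (f , N)

    mass-≤ : ∀ m shapes (x : ℚ) → (∀ {s} → s ∈ shapes → x ℚ.* weightOf s ℚ.≤ 1ℚ) →
      x ℚ.* mass Q m shapes ℚ.≤ ℕ→ℚ (length shapes)
    mass-≤ m shapes x h = begin
      x ℚ.* mass Q m shapes                         ≡⟨ sym (sumℚ-* x (map weightOf shapes)) ⟩
      sumℚ (map (x ℚ.*_) (map weightOf shapes))     ≡⟨ cong sumℚ (sym (List.map-∘ shapes)) ⟩
      sumℚ (map (λ s → x ℚ.* weightOf s) shapes)    ≤⟨ sumℚ-≤ _ 1ℚ shapes h ⟩
      ℕ→ℚ (length shapes) ℚ.* 1ℚ                    ≡⟨ ℚ.*-identityʳ _ ⟩
      ℕ→ℚ (length shapes)                           ∎
      where open ℚ.≤-Reasoning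

    mass-nonNeg : ∀ m shapes → 0ℚ ℚ.≤ mass Q m shapes
    mass-nonNeg m shapes = sumℚ-nonNeg shapes weightOf-nonNeg

    private
      box-small : ∀ {s} → s ∈ box → proj₂ s ≤ size q r
      box-small p = ℕ.≤-pred (Mem.∈-upTo⁻ (proj₂ (Mem.∈-cartesianProduct⁻ (upTo (r * (size q r + q))) _ p)))

      column : ∀ {f : ℕ} {P : ℕ → Set} (P? : ∀ N → Dec (P N)) {s : ℕ × ℕ} → s ∈ map (f ,_) (filter P? (upTo (suc (size q r)))) →
        ∃ λ N → s ≡ (f , N) × P N × N ≤ size q r
      column P? p with Mem.∈-map⁻ _ p
      ... | N , N∈ , refl with Mem.∈-filter⁻ P? {xs = upTo (suc (size q r))} N∈
      ... | N∈′ , pN = N , refl , pN , ℕ.≤-pred (Mem.∈-upTo⁻ N∈′)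

      column-small : ∀ {f : ℕ} {P : ℕ → Set} (P? : ∀ N → Dec (P N)) {s : ℕ × ℕ} → s ∈ map (f ,_) (filter P? (upTo (suc (size q r)))) →
        proj₂ s ≤ size q r
      column-small P? p with column P? p
      ... | N , refl , _ , le = le

      light-small : ∀ {s} → s ∈ lightShapes → proj₂ s ≤ size q r
      light-small p = box-small (proj₁ (Mem.∈-filter⁻ light? {xs = box} p))

      kill-small : ∀ {s} → s ∈ killShapes → proj₂ s ≤ size q r
      kill-small p = box-small (proj₁ (Mem.∈-filter⁻ kill? {xs = box} p))

      generated-short : ∀ {Q A} f N {xs} → xs ∈ generated n Q A f N → length xs ≤ N
      generated-short f zero (here refl) = z≤n
      generated-short {Q} {A} zero (suc N) p with find (Mem.∈-concatMap⁻ (λ x → map (x ∷_) (generated n Q (x ∷ A) zero N)) {xs = spanⁿ 3 Q A} p)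
      ... | x , _ , p′ with Mem.∈-map⁻ (x ∷_) p′
      ... | ys , ys∈ , refl = s≤s (generated-short zero N ys∈)
      generated-short {Q} {A} (suc f) (suc N) p with Mem.∈-++⁻ (concatMap (λ x → map (x ∷_) (generated n Q (x ∷ A) f N)) (applyUpTo suc n)) p
      ... | inj₁ p₁ with find (Mem.∈-concatMap⁻ (λ x → map (x ∷_) (generated n Q (x ∷ A) f N)) {xs = applyUpTo suc n} p₁)
      ... | x , _ , p′ with Mem.∈-map⁻ (x ∷_) p′
      ... | ys , ys∈ , refl = s≤s (generated-short f N ys∈)
      generated-short {Q} {A} (suc f) (suc N) p | inj₂ p₁ with find (Mem.∈-concatMap⁻ (λ x → map (x ∷_) (generated n Q (x ∷ A) (suc f) N)) {xs = spanⁿ 3 Q A} p₁)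
      ... | x , _ , p′ with Mem.∈-map⁻ (x ∷_) p′
      ... | ys , ys∈ , refl = s≤s (generated-short (suc f) N ys∈)

      family-short : ∀ {A} shapes → (∀ {s} → s ∈ shapes → proj₂ s ≤ size q r) → ∀ {xs} → xs ∈ family n Q A shapes → length xs ≤ size q r
      family-short shapes small p with find (Mem.∈-concatMap⁻ _ {xs = shapes} p)
      ... | (f , N) , s∈ , p′ = ℕ.≤-trans (generated-short f N p′) (small s∈)

    extensions-short : ∀ A v {xs} → xs ∈ extensions n A v → length xs ≤ size q r
    extensions-short A v p with Mem.∈-++⁻ (family n Q A lightShapes) p
    ... | inj₁ p₁ = family-short lightShapes light-small p₁
    ... | inj₂ p₂ = family-short regularShapes (column-small (cost q r ℕ.≤?_)) p₂

    -- The capacity is 1 + `size`, whatever the length of the run, so the coefficient of c is a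
    -- constant.
    regular-total : ∀ v → total (family n Q [ v ] regularShapes) ℚ.≤
      ℕ→ℚ (growth q r (suc (size q r)) * length regularShapes) ℚ.* c
    regular-total v = begin
      total (family n Q [ v ] regularShapes)                            ≤⟨ family-total Q (suc (size q r)) [ v ] regularShapes (column-small (cost q r ℕ.≤?_)) ℕ.≤-refl ⟩
      ℕ→ℚ G ℚ.* mass Q (suc (size q r)) regularShapes                   ≤⟨ ℚ.*-monoˡ-≤-nonNeg (ℕ→ℚ G) {{ℚ.nonNegative (ℕ→ℚ-nonNeg G)}} (sumℚ-≤ weightOf c regularShapes each) ⟩
      ℕ→ℚ G ℚ.* (ℕ→ℚ (length regularShapes) ℚ.* c)                      ≡⟨ trans (sym (ℚ.*-assoc (ℕ→ℚ G) _ c)) (cong (ℚ._* c) (sym (ℕ→ℚ-* G (length regularShapes)))) ⟩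
      ℕ→ℚ (G * length regularShapes) ℚ.* c                              ∎
      where
      open ℚ.≤-Reasoning
      G = growth q r (suc (size q r))
      each : ∀ {s} → s ∈ regularShapes → weightOf s ℚ.≤ c
      each p∈ with column {r} {λ N → cost q r ≤ N} (cost q r ℕ.≤?_) p∈
      ... | N , refl , a≤N , _ = begin
        (ν ^ℚ r) ℚ.* (p ^ℚ N)      ≤⟨ ℚ.*-monoˡ-≤-nonNeg (ν ^ℚ r) {{ℚ.nonNegative (^-nonNeg 0≤ν r)}} (^-anti 0≤p p≤1 a≤N) ⟩
        (ν ^ℚ r) ℚ.* (p ^ℚ a)      ≡⟨ ℚ.*-comm (ν ^ℚ r) (p ^ℚ a) ⟩
        (p ^ℚ a) ℚ.* (ν ^ℚ r)      ≤⟨ threshold ⟩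
        c ^ℚ a                     ≤⟨ ^-anti 0≤c c≤1 1≤a ⟩
        c ^ℚ 1                     ≡⟨ ℚ.*-identityʳ c ⟩
        c                          ∎

    module _ (M T : ℕ) where

      -- Room for the starting line, T extensions, and one more list.
      horizon G : ℕ
      horizon = suc (suc T) * size q r
      G    = growth q r horizon

      private
        g  = ℕ→ℚ G
        μ  = ℕ→ℚ M
        0≤g = ℕ→ℚ-nonNeg G
        0≤μ = ℕ→ℚ-nonNeg M

      G≥1 : 1 ≤ G
      G≥1 = ℕ.m^n>0 (suc (spanBound 3 Q horizon)) (size q r)

      private
        1≤g : 1ℚ ℚ.≤ g
        1≤g = ℕ→ℚ-≥1 G≥1

      κ : ℚ
      κ = g ℚ.* mass Q horizon killShapes

      0≤κ : 0ℚ ℚ.≤ κ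
      0≤κ = 0≤g *⁺ mass-nonNeg horizon killShapes

      open Recursion q r horizon κ 0≤κ

      -- One factor G belongs to the start and one to the kill, and the power a matches
      -- `scaled-light`. In `expo`, n^2 G bounds the starts up to a constant factor, and M is the
      -- accuracy required.
      module _ (dense : (G * G * M) ^ a ≤ n) (expo : n * n * (G * M) ≤ 2 ^ T) where

        private
          μgg : ℕ→ℚ (G * G * M) ≡ μ ℚ.* (g ℚ.* g)
          μgg = trans (ℕ→ℚ-* (G * G) M) (trans (cong (ℚ._* μ) (ℕ→ℚ-* G G)) (ℚ.*-comm (g ℚ.* g) μ))

          μg-light : ∀ {f N} → f * a < r * N → μ ℚ.* g ℚ.* weightOf (f , N) ℚ.≤ 1ℚ
          μg-light {f} {N} lt = ℚ.≤-trans (ℚ.*-monoʳ-≤-nonNeg (weightOf (f , N)) {{ℚ.nonNegative (weightOf-nonNeg (f , N))}}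
            (subst (μ ℚ.* g ℚ.≤_) (sym μgg) (ℚ.*-monoˡ-≤-nonNeg μ {{ℚ.nonNegative 0≤μ}}
              (subst (ℚ._≤ g ℚ.* g) (ℚ.*-identityʳ g) (ℚ.*-monoˡ-≤-nonNeg g {{ℚ.nonNegative 0≤g}} 1≤g)))))
            (scaled-light {f} {N} (G * G * M) dense lt)

          family-light : ∀ A shapes → (∀ {s} → s ∈ shapes → proj₂ s ≤ size q r) → (∀ {s} → s ∈ shapes → proj₁ s * a < r * proj₂ s) →
            length A + size q r ≤ horizon → μ ℚ.* total (family n Q A shapes) ℚ.≤ ℕ→ℚ (length shapes)
          family-light A shapes small light le = begin
            μ ℚ.* total (family n Q A shapes)          ≤⟨ ℚ.*-monoˡ-≤-nonNeg μ {{ℚ.nonNegative 0≤μ}} (family-total Q horizon A shapes small le) ⟩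
            μ ℚ.* (g ℚ.* mass Q horizon shapes)           ≡⟨ sym (ℚ.*-assoc μ g _) ⟩
            μ ℚ.* g ℚ.* mass Q horizon shapes             ≤⟨ mass-≤ horizon shapes (μ ℚ.* g) (λ {s} p → μg-light {proj₁ s} {proj₂ s} (light p)) ⟩
            ℕ→ℚ (length shapes)                        ∎
            where open ℚ.≤-Reasoning

          size≤horizon : size q r ≤ horizon
          size≤horizon = ℕ.m≤m+n (size q r) _

        light-total : ∀ A → length A + size q r ≤ horizon → μ ℚ.* total (family n Q A lightShapes) ℚ.≤ ℕ→ℚ (length lightShapes)
        light-total A le = family-light A lightShapes light-small (λ p → proj₂ (Mem.∈-filter⁻ light? {xs = box} p)) le

        private
          startKill-total : μ ℚ.* total (family n Q [] startKillShapes) ℚ.≤ ℕ→ℚ (length startKillShapes)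
          startKill-total = family-light [] startKillShapes (column-small (λ N → light? (2 , N))) light size≤horizon
            where
            light : ∀ {s} → s ∈ startKillShapes → proj₁ s * a < r * proj₂ s
            light p with column {2} {λ N → 2 * a < r * N} (λ N → light? (2 , N)) p
            ... | N , refl , lt , _ = lt

          start-weight = weightOf (2 , q)
          0≤sw = weightOf-nonNeg (2 , q)

          start-total : total (family n Q [] startShapes) ℚ.≤ g ℚ.* (ℕ→ℚ (length startShapes) ℚ.* start-weight)
          start-total = ℚ.≤-trans (family-total Q horizon [] startShapes (column-small (q ℕ.≤?_)) size≤horizon)
            (ℚ.*-monoˡ-≤-nonNeg g {{ℚ.nonNegative 0≤g}} (sumℚ-≤ weightOf start-weight startShapes each))
            where
            each : ∀ {s} → s ∈ startShapes → weightOf s ℚ.≤ start-weight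
            each p∈ with column {2} {λ N → q ≤ N} (q ℕ.≤?_) p∈
            ... | N , refl , q≤N , _ = ℚ.*-monoˡ-≤-nonNeg (ν ^ℚ 2) {{ℚ.nonNegative (^-nonNeg 0≤ν 2)}} (^-anti 0≤p p≤1 q≤N)

          κ-small : μ ℚ.* (g ℚ.* start-weight ℚ.* κ) ℚ.≤ ℕ→ℚ (length killShapes)
          κ-small = ℚ.≤-trans (ℚ.≤-reflexive (solve 4 (λ μ g w k → μ :* (g :* w :* (g :* k)) := (μ :* (g :* g) :* w) :* k) refl μ g start-weight (mass Q horizon killShapes)))
            (mass-≤ horizon killShapes (μ ℚ.* (g ℚ.* g) ℚ.* start-weight) each)
            where
            open +-*-Solver using (solve; _:+_; _:*_; _:=_; con)
            each : ∀ {s} → s ∈ killShapes → μ ℚ.* (g ℚ.* g) ℚ.* start-weight ℚ.* weightOf s ℚ.≤ 1ℚ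
            each {f , N} p∈ = subst (ℚ._≤ 1ℚ) (trans (cong₂ ℚ._*_ μgg (cong₂ ℚ._*_ (^-+ ν f 2) (^-+ p N q)))
                (solve 6 (λ m g a b x y → m :* (g :* g) :* (a :* b :* (x :* y)) := m :* (g :* g) :* (b :* y) :* (a :* x)) refl μ g (ν ^ℚ f) (ν ^ℚ 2) (p ^ℚ N) (p ^ℚ q)))
              -- A kill is estimated together with the start, whose shape is (2, q).
              (scaled-light {f + 2} {N + q} (G * G * M) dense (proj₂ (Mem.∈-filter⁻ kill? {xs = box} p∈)))

          expo-small : μ ℚ.* (g ℚ.* start-weight ℚ.* (half ^ℚ T)) ℚ.≤ 1ℚ
          expo-small = begin
            μ ℚ.* (g ℚ.* ((ν ^ℚ 2) ℚ.* (p ^ℚ q)) ℚ.* h)    ≤⟨ ℚ.*-monoˡ-≤-nonNeg μ {{ℚ.nonNegative 0≤μ}} (ℚ.*-monoʳ-≤-nonNeg h {{ℚ.nonNegative 0≤h}}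
                                                                (ℚ.*-monoˡ-≤-nonNeg g {{ℚ.nonNegative 0≤g}} (ℚ.*-monoˡ-≤-nonNeg (ν ^ℚ 2) {{ℚ.nonNegative (^-nonNeg 0≤ν 2)}} (^-≤1 0≤p p≤1 q)))) ⟩
            μ ℚ.* (g ℚ.* ((ν ^ℚ 2) ℚ.* 1ℚ) ℚ.* h)          ≡⟨ solve 4 (λ m g v h → m :* (g :* ((v :* (v :* con 1ℚ)) :* con 1ℚ) :* h) := (v :* v :* (g :* m)) :* h) refl μ g ν h ⟩
            (ν ℚ.* ν ℚ.* (g ℚ.* μ)) ℚ.* h                  ≡⟨ cong (ℚ._* h) (sym (trans (ℕ→ℚ-* (n * n) (G * M)) (cong₂ ℚ._*_ (ℕ→ℚ-* n n) (ℕ→ℚ-* G M)))) ⟩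
            ℕ→ℚ (n * n * (G * M)) ℚ.* h                    ≤⟨ ℚ.*-monoʳ-≤-nonNeg h {{ℚ.nonNegative 0≤h}} (ℕ→ℚ-mono expo) ⟩
            ℕ→ℚ (2 ^ T) ℚ.* h                              ≡⟨ cong (ℚ._* h) (ℕ→ℚ-^ 2 T) ⟩
            (two ^ℚ T) ℚ.* (half ^ℚ T)                     ≡⟨ trans (sym (^-distrib-* two half T)) (1^ T) ⟩
            1ℚ                                             ∎
            where
            open ℚ.≤-Reasoning
            open +-*-Solver using (solve; _:+_; _:*_; _:=_; con)
            h = half ^ℚ T
            0≤h = ^-nonNeg (ℚ.nonNegative⁻¹ half) T

        constant : ℕ
        constant = length startKillShapes + length startShapes * 2 ^ (size q r + size q r) * (4 * length killShapes + 1)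

        witnesses-total : (∀ A v → length A + size q r ≤ horizon → ℕ→ℚ 8 ℚ.* (total (extensions n A v) ℚ.* b) ℚ.≤ 1ℚ) →
          μ ℚ.* total (witnesses n T) ℚ.≤ ℕ→ℚ constant
        witnesses-total ext = begin
          μ ℚ.* total (witnesses n T)
            ≡⟨ cong (μ ℚ.*_) (total-++ (family n Q [] startKillShapes) (concatMap F starts)) ⟩
          μ ℚ.* (total (family n Q [] startKillShapes) ℚ.+ total (concatMap F starts))
            ≡⟨ ℚ.*-distribˡ-+ μ _ _ ⟩
          μ ℚ.* total (family n Q [] startKillShapes) ℚ.+ μ ℚ.* total (concatMap F starts)
            ≤⟨ ℚ.+-mono-≤ startKill-total runs ⟩
          ℕ→ℚ (length startKillShapes) ℚ.+ ℕ→ℚ (s₁ * B * (4 * length killShapes + 1))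
            ≡⟨ sym (ℕ→ℚ-+ (length startKillShapes) _) ⟩
          ℕ→ℚ constant ∎
          where
          open ℚ.≤-Reasoning
          open +-*-Solver using (solve; _:+_; _:*_; _:=_; con)
          starts = family n Q [] startShapes
          s₁ = length startShapes
          B = 2 ^ (size q r + size q r)
          F = λ xs → map (xs ++_) (explore n T xs xs xs)
          0≤b : 0ℚ ℚ.≤ b
          0≤b = ^-nonNeg (ℕ→ℚ-nonNeg 2) (size q r + size q r)
          0≤X : 0ℚ ℚ.≤ b ℚ.* bound T
          0≤X = 0≤b *⁺ +⁺ (ℕ→ℚ-nonNeg 4 *⁺ 0≤κ) (^-nonNeg (ℚ.nonNegative⁻¹ half) T)
          one-run : ∀ {xs} → xs ∈ starts → total (F xs) ℚ.≤ b ℚ.* bound T ℚ.* (p ^ℚ length xs)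
          one-run {xs} xs∈ = begin
            total (F xs)                                             ≡⟨ total-map-++ xs (explore n T xs xs xs) ⟩
            (p ^ℚ length xs) ℚ.* total (explore n T xs xs xs)        ≤⟨ ℚ.*-monoˡ-≤-nonNeg (p ^ℚ length xs) {{ℚ.nonNegative (^-nonNeg 0≤p (length xs))}} (ℚ.≤-trans
                (explore-total (λ A le → family-total Q horizon A killShapes kill-small le) extensions-short ext T xs xs xs (ℕ.+-monoˡ-≤ (suc T * size q r) short))
                (ℚ.*-monoˡ-≤-nonNeg (bound T) {{ℚ.nonNegative (+⁺ (ℕ→ℚ-nonNeg 4 *⁺ 0≤κ) (^-nonNeg (ℚ.nonNegative⁻¹ half) T))}} (^-mono-exp (ℕ→ℚ-≥1 {2} (s≤s z≤n)) (ℕ.+-mono-≤ short short)))) ⟩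
            (p ^ℚ length xs) ℚ.* (bound T ℚ.* b)                     ≡⟨ solve 3 (λ x y z → x :* (y :* z) := z :* y :* x) refl (p ^ℚ length xs) (bound T) b ⟩
            b ℚ.* bound T ℚ.* (p ^ℚ length xs)                       ∎
            where
            short : length xs ≤ size q r
            short = family-short startShapes (column-small (q ℕ.≤?_)) xs∈
          all-runs : total (concatMap F starts) ℚ.≤ b ℚ.* bound T ℚ.* total starts
          all-runs = begin
            total (concatMap F starts)                                    ≡⟨ total-concatMap F starts ⟩
            sumℚ (map (λ xs → total (F xs)) starts)                       ≤⟨ sumℚ-mono starts one-run ⟩
            sumℚ (map (λ xs → b ℚ.* bound T ℚ.* (p ^ℚ length xs)) starts) ≡⟨ cong sumℚ (List.map-∘ starts) ⟩
            sumℚ (map (b ℚ.* bound T ℚ.*_) (map (λ xs → p ^ℚ length xs) starts))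
                                                                          ≡⟨ sumℚ-* (b ℚ.* bound T) (map (λ xs → p ^ℚ length xs) starts) ⟩
            b ℚ.* bound T ℚ.* total starts                                ∎
          runs : μ ℚ.* total (concatMap F starts) ℚ.≤ ℕ→ℚ (s₁ * B * (4 * length killShapes + 1))
          runs = begin
            μ ℚ.* total (concatMap F starts)
              ≤⟨ ℚ.*-monoˡ-≤-nonNeg μ {{ℚ.nonNegative 0≤μ}} (ℚ.≤-trans all-runs (ℚ.*-monoˡ-≤-nonNeg (b ℚ.* bound T) {{ℚ.nonNegative 0≤X}} start-total)) ⟩
            μ ℚ.* (b ℚ.* (ℕ→ℚ 4 ℚ.* κ ℚ.+ h) ℚ.* (g ℚ.* (ℕ→ℚ s₁ ℚ.* start-weight)))
              ≡⟨ solve 8 (λ m b f k h g s w → m :* (b :* (f :* k :+ h) :* (g :* (s :* w)))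
                   := s :* b :* (f :* (m :* (g :* w :* k)) :+ m :* (g :* w :* h))) refl μ b (ℕ→ℚ 4) κ h g (ℕ→ℚ s₁) start-weight ⟩
            ℕ→ℚ s₁ ℚ.* b ℚ.* (ℕ→ℚ 4 ℚ.* (μ ℚ.* (g ℚ.* start-weight ℚ.* κ)) ℚ.+ μ ℚ.* (g ℚ.* start-weight ℚ.* h))
              ≤⟨ ℚ.*-monoˡ-≤-nonNeg (ℕ→ℚ s₁ ℚ.* b) {{ℚ.nonNegative (ℕ→ℚ-nonNeg s₁ *⁺ 0≤b)}}
                   (ℚ.+-mono-≤ (ℚ.*-monoˡ-≤-nonNeg (ℕ→ℚ 4) {{ℚ.nonNegative (ℕ→ℚ-nonNeg 4)}} κ-small) expo-small) ⟩
            ℕ→ℚ s₁ ℚ.* b ℚ.* (ℕ→ℚ 4 ℚ.* ℕ→ℚ (length killShapes) ℚ.+ 1ℚ)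
              ≡⟨ cong₂ ℚ._*_ (trans (cong (ℕ→ℚ s₁ ℚ.*_) (sym (ℕ→ℚ-^ 2 (size q r + size q r)))) (sym (ℕ→ℚ-* s₁ B)))
                   (trans (cong (ℚ._+ 1ℚ) (sym (ℕ→ℚ-* 4 (length killShapes)))) (sym (ℕ→ℚ-+ (4 * length killShapes) 1))) ⟩
            ℕ→ℚ (s₁ * B) ℚ.* ℕ→ℚ (4 * length killShapes + 1)
              ≡⟨ sym (ℕ→ℚ-* (s₁ * B) (4 * length killShapes + 1)) ⟩
            ℕ→ℚ (s₁ * B * (4 * length killShapes + 1)) ∎
            where h = half ^ℚ T

open WeightEstimates

-- Polynomial against exponential growth, and the number of steps.

module GrowthRates where

  PolyBounded : (ℕ → ℕ) → Set
  PolyBounded h = ∃ λ C → ∃ λ k → ∀ T → h T ≤ C * suc T ^ k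

  poly-const : ∀ c → PolyBounded (λ _ → c)
  poly-const c = c , 0 , λ T → ℕ.≤-reflexive (sym (ℕ.*-identityʳ c))

  poly-id : PolyBounded (λ T → T)
  poly-id = 1 , 1 , λ T → ℕ.≤-trans (ℕ.n≤1+n T) (ℕ.≤-reflexive (eq T))
    where
    eq : ∀ T → suc T ≡ 1 * (suc T * 1)
    eq = ℕ-solve-∀

  poly-+ : ∀ {g h} → PolyBounded g → PolyBounded h → PolyBounded (λ T → g T + h T)
  poly-+ {g} {h} (C , k , p) (D , l , q) = C + D , k + l , λ T → begin
    g T + h T                                      ≤⟨ ℕ.+-mono-≤ (p T) (q T) ⟩
    C * suc T ^ k + D * suc T ^ l                  ≤⟨ ℕ.+-mono-≤ (ℕ.*-monoʳ-≤ C (ℕ.^-monoʳ-≤ (suc T) (ℕ.m≤m+n k l))) (ℕ.*-monoʳ-≤ D (ℕ.^-monoʳ-≤ (suc T) (ℕ.m≤n+m l k))) ⟩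
    C * suc T ^ (k + l) + D * suc T ^ (k + l)      ≡⟨ sym (ℕ.*-distribʳ-+ (suc T ^ (k + l)) C D) ⟩
    (C + D) * suc T ^ (k + l)                      ∎
    where open ℕ.≤-Reasoning

  poly-* : ∀ {g h} → PolyBounded g → PolyBounded h → PolyBounded (λ T → g T * h T)
  poly-* {g} {h} (C , k , p) (D , l , q) = C * D , k + l , λ T → begin
    g T * h T                                      ≤⟨ ℕ.*-mono-≤ (p T) (q T) ⟩
    C * suc T ^ k * (D * suc T ^ l)                ≡⟨ eq C (suc T ^ k) D (suc T ^ l) ⟩
    C * D * (suc T ^ k * suc T ^ l)                ≡⟨ cong (C * D *_) (sym (ℕ.^-distribˡ-+-* (suc T) k l)) ⟩
    C * D * suc T ^ (k + l)                        ∎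
    where
    open ℕ.≤-Reasoning
    eq : ∀ a b c d → a * b * (c * d) ≡ a * c * (b * d)
    eq = ℕ-solve-∀

  poly-^ : ∀ {h} → PolyBounded h → ∀ s → PolyBounded (λ T → h T ^ s)
  poly-^ p zero    = poly-const 1
  poly-^ p (suc s) = poly-* p (poly-^ p s)

  poly-suc : ∀ {h} → PolyBounded h → PolyBounded (λ T → suc (h T))
  poly-suc = poly-+ (poly-const 1)

  poly-spanBound : ∀ j {Q h} → PolyBounded h → PolyBounded (λ T → spanBound j Q (h T))
  poly-spanBound zero    p = p
  poly-spanBound (suc j) {Q} p = poly-+ ih (poly-* (poly-* ih ih) (poly-const (interpSize Q)))
    where ih = poly-spanBound j {Q} p

  *-^ : ∀ x y k → (x * y) ^ k ≡ x ^ k * y ^ k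
  *-^ x y zero    = refl
  *-^ x y (suc k) = trans (cong (x * y *_) (*-^ x y k)) (eq x y (x ^ k) (y ^ k))
    where
    eq : ∀ x y a b → x * y * (a * b) ≡ x * a * (y * b)
    eq = ℕ-solve-∀

  suc≤2^ : ∀ s → suc s ≤ 2 ^ s
  suc≤2^ zero    = s≤s z≤n
  suc≤2^ (suc s) = ℕ.≤-trans (ℕ.+-mono-≤ {1} {2 ^ s} (ℕ.m^n>0 2 s) (suc≤2^ s)) (ℕ.≤-reflexive (eq (2 ^ s)))
    where
    eq : ∀ x → x + x ≡ 2 * x
    eq = ℕ-solve-∀

  -- (T + 1)^m ≤ m^m 2^T, by comparing T/m + 1 with 2^(T/m).
  exponential-beats : ∀ C k → ∃ λ T₀ → ∀ T → T₀ ≤ T → C * suc T ^ k ≤ 2 ^ T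
  exponential-beats C k = C * m ^ m , λ T T₀≤T → ℕ.*-cancelˡ-≤ (m ^ m) {{ℕ.>-nonZero (ℕ.m^n>0 m m)}} (begin
    m ^ m * (C * suc T ^ k)            ≡⟨ eq (m ^ m) C (suc T ^ k) ⟩
    C * m ^ m * suc T ^ k              ≤⟨ ℕ.*-monoˡ-≤ (suc T ^ k) (ℕ.m≤n⇒m≤1+n T₀≤T) ⟩
    suc T ^ m                          ≤⟨ ℕ.^-monoˡ-≤ m (ℕ.≤-trans (s≤s (ℕ.≤-reflexive (ℕ.m≡m%n+[m/n]*n T m))) (ℕ.+-monoˡ-≤ (T ℕ./ m * m) (ℕ.m%n<n T m))) ⟩
    (suc (T ℕ./ m) * m) ^ m            ≡⟨ *-^ (suc (T ℕ./ m)) m m ⟩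
    suc (T ℕ./ m) ^ m * m ^ m          ≤⟨ ℕ.*-monoˡ-≤ (m ^ m) (ℕ.^-monoˡ-≤ m (suc≤2^ (T ℕ./ m))) ⟩
    (2 ^ (T ℕ./ m)) ^ m * m ^ m        ≡⟨ cong (_* m ^ m) (ℕ.^-*-assoc 2 (T ℕ./ m) m) ⟩
    2 ^ (T ℕ./ m * m) * m ^ m          ≤⟨ ℕ.*-monoˡ-≤ (m ^ m) (ℕ.^-monoʳ-≤ 2 (ℕ.m/n*n≤m T m)) ⟩
    2 ^ T * m ^ m                      ≡⟨ ℕ.*-comm (2 ^ T) (m ^ m) ⟩
    m ^ m * 2 ^ T                      ∎)
    where
    open ℕ.≤-Reasoning
    m = suc k
    eq : ∀ a b c → a * (b * c) ≡ b * a * c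
    eq = ℕ-solve-∀

  power-of-two : ∀ x → 1 ≤ x → ∃ λ T → x ≤ 2 ^ T × 2 ^ T ≤ 2 * x
  power-of-two (suc zero) _ = 0 , ℕ.≤-refl , s≤s z≤n
  power-of-two (suc (suc x)) _ with power-of-two (suc x) (s≤s z≤n)
  ... | T , lo , hi with suc (suc x) ℕ.≤? 2 ^ T
  ... | yes le = T , le , ℕ.≤-trans hi (ℕ.*-monoʳ-≤ 2 (ℕ.n≤1+n (suc x)))
  ... | no ¬le = suc T , ℕ.≤-trans (ℕ.+-mono-≤ {1} (s≤s z≤n) ℕ.≤-refl) (ℕ.≤-trans (ℕ.≤-reflexive (eq (suc x))) (ℕ.*-monoʳ-≤ 2 lo)) ,
                 ℕ.*-monoʳ-≤ 2 (ℕ.<⇒≤ (ℕ.≰⇒> ¬le))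
    where
    eq : ∀ x → x + x ≡ 2 * x
    eq = ℕ-solve-∀

  n≤n³ : ∀ n → 1 ≤ n → n ≤ n * n * n
  n≤n³ n 1≤n = ℕ.m≤n*m n (n * n) {{ℕ.>-nonZero (ℕ.*-mono-≤ 1≤n 1≤n)}}

  -- T is chosen with n^3 ≤ 2^T ≤ 2n^3, hence of order log n. If n < h T, then 2^T would be at most
  -- a polynomial in T, impossible for large T. The cube leaves n^2 for the starts and one factor n
  -- for the growth and the accuracy.
  cutoff : ∀ {h} → PolyBounded h → ∃ λ N → ∀ n → N ≤ n → 1 ≤ n × ∃ λ T → h T ≤ n × n * n * n ≤ 2 ^ T
  cutoff {h} ph with poly-suc (poly-* (poly-const 2) (poly-* (poly-* ph ph) ph))
  ... | C , k , bound with exponential-beats C k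
  ... | T₀ , beats = suc (2 ^ T₀) , choose
    where
    choose : ∀ n → suc (2 ^ T₀) ≤ n → 1 ≤ n × ∃ λ T → h T ≤ n × n * n * n ≤ 2 ^ T
    choose n le with 1≤n ← ℕ.≤-trans (s≤s z≤n) le
      with power-of-two (n * n * n) (ℕ.≤-trans 1≤n (n≤n³ n 1≤n))
    ... | T , lo , hi = 1≤n , T , hT≤n , lo
      where
      T₀≤T : T₀ ≤ T
      T₀≤T = ℕ.≮⇒≥ λ T<T₀ → ℕ.<⇒≱ (ℕ.≤-trans le (ℕ.≤-trans (n≤n³ n 1≤n) lo)) (ℕ.^-monoʳ-≤ 2 (ℕ.<⇒≤ T<T₀))
      hT≤n : h T ≤ n
      hT≤n = ℕ.≮⇒≥ λ n<h → ℕ.<⇒≱ (ℕ.≤-trans (bound T) (beats T T₀≤T)) (ℕ.≤-trans hi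
        (ℕ.*-monoʳ-≤ 2 (ℕ.*-mono-≤ (ℕ.*-mono-≤ (ℕ.<⇒≤ n<h) (ℕ.<⇒≤ n<h)) (ℕ.<⇒≤ n<h))))

open GrowthRates

-- From subsets of [n] to hypergraphs and colourings.

has⇒∈S : ∀ {n} k (S : Vec Bool n) → has k S ≡ true → suc k ∈S S
has⇒∈S zero    (b Vec.∷ S) eq = s≤s z≤n , s≤s z≤n , eq
has⇒∈S (suc k) (b Vec.∷ S) eq with has⇒∈S k S eq
... | _ , lt , e = s≤s z≤n , s≤s lt , e

∈S⇒has : ∀ {n} k (S : Vec Bool n) → suc k ∈S S → has k S ≡ true
∈S⇒has zero    (b Vec.∷ S) (_ , _ , eq) = eq
∈S⇒has (suc k) (b Vec.∷ S) (_ , s≤s lt , eq) = ∈S⇒has k S (s≤s z≤n , lt , eq)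
∈S⇒has zero    Vec.[] (_ , () , _)
∈S⇒has (suc k) Vec.[] (_ , () , _)

_∈S?_ : ∀ v {n} (S : Vec Bool n) → Dec (v ∈S S)
zero  ∈S? S = no λ { (() , _) }
suc k ∈S? S = map′ (has⇒∈S k S) (∈S⇒has k S) (has k S Bool.≟ true)

∈S-bounds : ∀ {v n} (S : Vec Bool n) → v ∈S S → 1 ≤ v × v ≤ n
∈S-bounds {suc v} S (1≤v , v<n , _) = 1≤v , v<n

hasAll-true : ∀ {n} u (S : Vec Bool n) → (∀ {k} → k ∈ u → has k S ≡ true) → hasAll u S ≡ true
hasAll-true []      S h = refl
hasAll-true (k ∷ u) S h rewrite h {k} (here refl) = hasAll-true u S (h ∘ there)

avoids⇒ : ∀ {n} ws (S : Vec Bool n) → avoids ws S ≡ true → ∀ {w} → w ∈ ws → contains w S ≡ false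
avoids⇒ (w ∷ ws) S eq (here refl) with contains w S
... | false = refl
avoids⇒ (w ∷ ws) S eq (there p) with contains w S
... | false = avoids⇒ ws S eq p

does⁻ : {P : Set} (P? : Dec P) → not (Dec.does P?) ≡ false → P
does⁻ (yes p) _ = p

module FromSubset {q r : ℕ} (3≤r : 3 ≤ r) (r<q : r < q) {n : ℕ} (S : Vec Bool n) where

  private
    candidates = cartesianProduct (upTo (suc n)) (applyUpTo suc n)

    inside? : ∀ e → Dec (All (_∈S S) (pts q e))
    inside? e = All.all? (_∈S? S) (pts q e)

    Lf = filter inside? candidates

    -- A vertex on no long edge can be red at no cost, so a short edge containing one takes care of
    -- itself.
    short? : ∀ f → Dec (All (_∈ concatMap (pts q) Lf) (pts r f))
    short? f = All.all? (_∈? concatMap (pts q) Lf) (pts r f)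

    candidate≥1 : ∀ {e} → e ∈ candidates → 1 ≤ proj₂ e
    candidate≥1 p with Mem.∈-applyUpTo⁻ suc (proj₂ (Mem.∈-cartesianProduct⁻ (upTo (suc n)) _ p))
    ... | _ , _ , refl = s≤s z≤n

    candidate : ∀ {a d} → 1 ≤ d → a ≤ n → d ≤ n → (a , d) ∈ candidates
    candidate 1≤d a≤n d≤n = Mem.∈-cartesianProduct⁺ (Mem.∈-upTo⁺ (s≤s a≤n)) (∈-applyUpTo-suc 1≤d d≤n)

    progression-bounds : ∀ {k a d} → 2 ≤ k → (∀ i → i < k → (a + i * d) ∈S S) → a ≤ n × d ≤ n
    progression-bounds {k} {a} {d} 2≤k h =
      ℕ.≤-trans (ℕ.m≤m+n a 0) (proj₂ (∈S-bounds S (h 0 (ℕ.<⇒≤ 2≤k)))) ,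
      ℕ.≤-trans (ℕ.≤-trans (ℕ.m≤m+n d 0) (ℕ.m≤n+m (1 * d) a)) (proj₂ (∈S-bounds S (h 1 2≤k)))

    2≤r : 2 ≤ r
    2≤r = ℕ.≤-trans (ℕ.n≤1+n 2) 3≤r

  hypergraph : Hypergraph q r
  hypergraph = record
    { 3≤r = 3≤r ; r<q = r<q
    ; Lfam = Lf
    ; Sfam = filter short? candidates
    ; V = filter (_∈S? S) (upTo (suc n))
    ; long≥1  = λ p → candidate≥1 (proj₁ (Mem.∈-filter⁻ inside? p))
    ; short≥1 = λ p → candidate≥1 (proj₁ (Mem.∈-filter⁻ short? p))
    ; long⊆V  = λ {e} e∈ x∈ → let x∈S = All.lookup (proj₂ (Mem.∈-filter⁻ inside? {xs = candidates} e∈)) x∈ in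
        Mem.∈-filter⁺ (_∈S? S) (Mem.∈-upTo⁺ (s≤s (proj₂ (∈S-bounds S x∈S)))) x∈S
    ; short⊆  = λ {f} f∈ x∈ → find (Mem.∈-concatMap⁻ (pts q) {xs = Lf} (All.lookup (proj₂ (Mem.∈-filter⁻ short? {xs = candidates} f∈)) x∈))
    }

  open Hypergraph hypergraph using (V; Lfam; Sfam)

  bounded : ∀ {x} → x ∈ V → 1 ≤ x × x ≤ n
  bounded p = ∈S-bounds S (proj₂ (Mem.∈-filter⁻ (_∈S? S) {xs = upTo (suc n)} p))

  colourable : ∀ β → (∀ {e} → e ∈ Lfam → ∃ λ x → x ∈ pts q e × x ∈ β) → (∀ {f} → f ∈ Sfam → ¬ (pts r f ⊆ β)) →
    AsymColourable q r S
  colourable β hit noBlue = χ , long , short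
    where
    U = concatMap (pts q) Lf
    -- Blue is cut down to vertices of long edges. Hitting long edges is unaffected, and every blue
    -- short edge belongs to `Sfam`.
    blue? : ∀ v → Dec (v ∈ β × v ∈ U)
    blue? v = v ∈? β ×-dec v ∈? U
    χ : ℕ → Bool
    χ v = not (Dec.does (blue? v))
    blue : ∀ {v} → v ∈ β → v ∈ U → χ v ≡ false
    blue {v} a b = cong not (dec-true (blue? v) (a , b))
    blue⁻ : ∀ {v} → χ v ≡ false → v ∈ β × v ∈ U
    blue⁻ {v} = does⁻ (blue? v)
    long : ∀ a d → 1 ≤ d → (∀ i → i < q → (a + i * d) ∈S S) → ¬ allColoured χ true q a d
    long a d 1≤d h red with progression-bounds {q} {a} {d} (ℕ.≤-trans 2≤r (ℕ.<⇒≤ r<q)) h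
    ... | a≤n , d≤n with Mem.∈-filter⁺ inside? (candidate 1≤d a≤n d≤n)
                           (All.tabulate λ x∈ → let i , i<q , eq = ∈-pts⁻ {q} (a , d) x∈ in subst (_∈S S) (sym eq) (h i i<q))
    ... | e∈ with hit e∈
    ... | x , x∈ , x∈β with ∈-pts⁻ {q} (a , d) x∈
    ... | i , i<q , refl with trans (sym (red i i<q)) (blue x∈β (Mem.∈-concatMap⁺ (pts q) (lose e∈ x∈)))
    ... | ()
    short : ∀ a d → 1 ≤ d → (∀ i → i < r → (a + i * d) ∈S S) → ¬ allColoured χ false r a d
    short a d 1≤d h all with progression-bounds {r} {a} {d} 2≤r h
    ... | a≤n , d≤n = noBlue (Mem.∈-filter⁺ short? (candidate 1≤d a≤n d≤n) (All.tabulate (proj₂ ∘ point))) (proj₁ ∘ point)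
      where
      point : ∀ {x} → x ∈ pts r (a , d) → x ∈ β × x ∈ U
      point x∈ = let i , i<r , eq = ∈-pts⁻ {r} (a , d) x∈ in blue⁻ (trans (cong χ eq) (all i i<r))

  good⇒colourable : ∀ T → avoids (filter proper? (Shapes.witnesses q r n T)) S ≡ true → AsymColourable q r S
  good⇒colourable T eq = let β , hit , noBlue = Exploration.colouring hypergraph n bounded T av in colourable β hit noBlue
    where
    -- A new list is distinct and its vertices lie in S, so it is proper and would be one of the
    -- lists that S avoids.
    av : ∀ {w} → w ∈ Shapes.witnesses q r n T → ¬ New V [] w
    av {w} w∈ (mkNew u _ inV) = case trans (sym (avoids⇒ _ S eq (Mem.∈-filter⁺ proper? w∈ (u , λ p → case proj₁ (bounded (inV p)) of λ ()))))
      (hasAll-true (down w) S λ {k} k∈ → ∈S⇒has k S (proj₂ (Mem.∈-filter⁻ (_∈S? S) {xs = upTo (suc n)} (inV (∈-down⁻ w k∈))))) of λ ()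

-- Choice of the constants, and the conclusion.

1≰0 : ¬ (1ℚ ℚ.≤ 0ℚ)
1≰0 h = ℚ.<-irrefl refl (ℚ.<-≤-trans (ℚ.positive⁻¹ 1ℚ) h)

inverse : ℕ → ℚ
inverse k = ℚ.fromℚᵘ (ℚᵘ.mkℚᵘ (+ 1) k)

abstract

  inverse-* : ∀ k → ℕ→ℚ (suc k) ℚ.* inverse k ≡ 1ℚ
  inverse-* k = ℚ.toℚᵘ-injective (ℚᵘ.≃-trans (ℚ.toℚᵘ-homo-* (ℕ→ℚ (suc k)) (inverse k))
    (ℚᵘ.≃-trans (ℚᵘ.*-cong (ℚ.toℚᵘ-fromℚᵘ (ℚᵘ.mkℚᵘ (+ suc k) 0)) (ℚ.toℚᵘ-fromℚᵘ (ℚᵘ.mkℚᵘ (+ 1) k)))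
      (ℚᵘ.*≡* (cong +_ (eq k)))))
    where
    eq : ∀ k → suc k * 1 * 1 ≡ 1 * (1 * suc k)
    eq = ℕ-solve-∀

  inverse-positive : ∀ k → 0ℚ ℚ.< inverse k
  inverse-positive k with ℚ.<-cmp 0ℚ (inverse k)
  ... | tri< lt _ _ = lt
  ... | tri≈ _ eq _ = ⊥-elim (ℚ.<⇒≢ {0ℚ} {1ℚ} (ℚ.positive⁻¹ 1ℚ) (trans (sym (ℚ.*-zeroʳ (ℕ→ℚ (suc k)))) (trans (cong (ℕ→ℚ (suc k) ℚ.*_) eq) (inverse-* k))))
  ... | tri> _ _ gt = ⊥-elim (1≰0 (subst (ℚ._≤ 0ℚ) (inverse-* k)
        (subst (ℕ→ℚ (suc k) ℚ.* inverse k ℚ.≤_) (ℚ.*-zeroʳ (ℕ→ℚ (suc k))) (ℚ.*-monoˡ-≤-nonNeg (ℕ→ℚ (suc k)) {{ℚ.nonNegative (ℕ→ℚ-nonNeg (suc k))}} (ℚ.<⇒≤ gt)))))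

scale≤1 : ∀ {K M x} → 1 ≤ M → K ≤ M → ℕ→ℚ M ℚ.* x ℚ.≤ 1ℚ → ℕ→ℚ K ℚ.* x ℚ.≤ 1ℚ
scale≤1 {K} {M} {x} 1≤M K≤M h with ℚ.≤-total 0ℚ x
... | inj₁ 0≤x = ℚ.≤-trans (ℚ.*-monoʳ-≤-nonNeg x {{ℚ.nonNegative 0≤x}} (ℕ→ℚ-mono K≤M)) h
... | inj₂ x≤0 = ℚ.≤-trans (subst (ℕ→ℚ K ℚ.* x ℚ.≤_) (ℚ.*-zeroʳ (ℕ→ℚ K)) (ℚ.*-monoˡ-≤-nonNeg (ℕ→ℚ K) {{ℚ.nonNegative (ℕ→ℚ-nonNeg K)}} x≤0)) 0≤1

cancel-ℕ : ∀ {M x y} → 1 ≤ M → ℕ→ℚ M ℚ.* x ℚ.≤ ℕ→ℚ M ℚ.* y → x ℚ.≤ y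
cancel-ℕ {M} {x} {y} 1≤M h = ℚ.*-cancelˡ-≤-pos (ℕ→ℚ M) {{ℚ.positive (ℚ.<-≤-trans (ℚ.positive⁻¹ 1ℚ) (ℕ→ℚ-≥1 1≤M))}} h

module Constants (q r : ℕ) (3≤r : 3 ≤ r) (r<q : r < q) where

  open Shapes q r

  1≤a : 1 ≤ cost q r
  1≤a = ℕ.*-mono-≤ (ℕ.≤-trans (s≤s z≤n) r<q) (ℕ.∸-monoˡ-≤ {2} {r} 1 (ℕ.≤-trans (ℕ.n≤1+n 2) 3≤r))

  B R L₁ K : ℕ
  B  = 2 ^ (size q r + size q r)
  R  = growth q r (suc (size q r)) * length regularShapes
  L₁ = suc (length lightShapes)
  K  = length startKillShapes + length startShapes * B * (4 * length killShapes + 1)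

  -- The recursion allows a total extension weight of 1/(8B). Light and regular extensions get half
  -- each, and the regular ones weigh at most R c.
  c : ℚ
  c = inverse (16 * B * R)

  0≤c : 0ℚ ℚ.≤ c
  0≤c = ℚ.<⇒≤ (inverse-positive (16 * B * R))

  c≤1 : c ℚ.≤ 1ℚ
  c≤1 = subst (ℚ._≤ 1ℚ) (ℚ.*-identityˡ c) (scale≤1 {1} {suc (16 * B * R)} (s≤s z≤n) (s≤s z≤n) (ℚ.≤-reflexive (inverse-* (16 * B * R))))

  module At (p : ℕ → ℚ) (0≤p : ∀ n → 0ℚ ℚ.≤ p n) (p≤1 : ∀ n → p n ℚ.≤ 1ℚ)
    (threshold : ∀ n → 1 ≤ n → (p n ^ℚ cost q r) ℚ.* (ℕ→ℚ n ^ℚ r) ℚ.≤ c ^ℚ cost q r)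
    (ε : ℚ) (D : ℕ) (1≤Dε : 1ℚ ℚ.≤ ℕ→ℚ D ℚ.* ε) where

    -- The first summand pushes the light extensions below 1/(16B). The second one turns the bound
    -- K/M on the witnesses into at most ε, since D ε ≥ 1. Only the size of n depends on it, not c.
    M : ℕ
    M = suc (16 * B * L₁ + suc K * D)

    rate : ℕ → ℕ
    rate T = (growth q r (suc (suc T) * size q r) * growth q r (suc (suc T) * size q r) * M) ^ cost q r

    rate-poly : PolyBounded rate
    rate-poly = poly-^ (poly-* (poly-* g g) (poly-const M)) (cost q r)
      where
      g : PolyBounded (λ T → growth q r (suc (suc T) * size q r))
      g = poly-^ (poly-suc (poly-spanBound 3 {depth q} (poly-* (poly-suc (poly-suc poly-id)) (poly-const (size q r))))) (size q r)

    module _ (n : ℕ) (1≤n : 1 ≤ n) (T : ℕ) (dense : rate T ≤ n) (n³≤ : n * n * n ≤ 2 ^ T) where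

      open Estimates q r 1≤a (p n) (0≤p n) (p≤1 n) n 1≤n c 0≤c c≤1 (threshold n 1≤n)
      open Totals (p n) (0≤p n) (p≤1 n) n 1≤n

      private
        G′ = growth q r (suc (suc T) * size q r)

        expo : n * n * (G′ * M) ≤ 2 ^ T
        expo = ℕ.≤-trans (ℕ.*-monoʳ-≤ (n * n) (ℕ.≤-trans (ℕ.≤-trans (ℕ.*-monoˡ-≤ M (ℕ.m≤m*n G′ G′ {{ℕ.>-nonZero (G≥1 M T)}})) base≤) dense)) n³≤
          where
          x = G′ * G′ * M
          base≤ : x ≤ x ^ cost q r
          base≤ = subst (_≤ x ^ cost q r) (ℕ.^-identityʳ x) (ℕ.^-monoʳ-≤ x {{ℕ.>-nonZero (ℕ.*-mono-≤ (ℕ.*-mono-≤ (G≥1 M T) (G≥1 M T)) (s≤s z≤n))}} 1≤a)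

        b : ℚ
        b = ℕ→ℚ 2 ^ℚ (size q r + size q r)

        0≤b : 0ℚ ℚ.≤ b
        0≤b = ^-nonNeg (ℕ→ℚ-nonNeg 2) (size q r + size q r)

        B≡b : ℕ→ℚ B ≡ b
        B≡b = ℕ→ℚ-^ 2 (size q r + size q r)

        sixteenth : ∀ x → ℕ→ℚ (16 * B) ℚ.* x ≡ ℕ→ℚ 16 ℚ.* (x ℚ.* b)
        sixteenth x = trans (cong (ℚ._* x) (trans (ℕ→ℚ-* 16 B) (cong (ℕ→ℚ 16 ℚ.*_) B≡b)))
          (trans (ℚ.*-assoc (ℕ→ℚ 16) b x) (cong (ℕ→ℚ 16 ℚ.*_) (ℚ.*-comm b x)))

        light≤ : ∀ A → length A + size q r ≤ horizon M T → ℕ→ℚ (16 * B) ℚ.* total (family n (depth q) A lightShapes) ℚ.≤ 1ℚ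
        light≤ A le = cancel-ℕ {L₁} (s≤s z≤n) (begin
          ℕ→ℚ L₁ ℚ.* (ℕ→ℚ (16 * B) ℚ.* x)      ≡⟨ trans (sym (ℚ.*-assoc (ℕ→ℚ L₁) (ℕ→ℚ (16 * B)) x)) (cong (ℚ._* x) (trans (sym (ℕ→ℚ-* L₁ (16 * B))) (cong ℕ→ℚ (ℕ.*-comm L₁ (16 * B))))) ⟩
          ℕ→ℚ (16 * B * L₁) ℚ.* x              ≤⟨ ℚ.*-monoʳ-≤-nonNeg x {{ℚ.nonNegative (total-nonNeg (family n (depth q) A lightShapes))}} (ℕ→ℚ-mono (ℕ.m≤n⇒m≤1+n (ℕ.m≤m+n (16 * B * L₁) (suc K * D)))) ⟩
          ℕ→ℚ M ℚ.* x                          ≤⟨ light-total M T dense expo A le ⟩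
          ℕ→ℚ (length lightShapes)             ≤⟨ ℕ→ℚ-mono (ℕ.n≤1+n (length lightShapes)) ⟩
          ℕ→ℚ L₁                               ≡⟨ sym (ℚ.*-identityʳ (ℕ→ℚ L₁)) ⟩
          ℕ→ℚ L₁ ℚ.* 1ℚ                        ∎)
          where
          open ℚ.≤-Reasoning
          x = total (family n (depth q) A lightShapes)

        regular≤ : ∀ v → ℕ→ℚ (16 * B) ℚ.* total (family n (depth q) [ v ] regularShapes) ℚ.≤ 1ℚ
        regular≤ v = begin
          ℕ→ℚ (16 * B) ℚ.* total (family n (depth q) [ v ] regularShapes)
                                                ≤⟨ ℚ.*-monoˡ-≤-nonNeg (ℕ→ℚ (16 * B)) {{ℚ.nonNegative (ℕ→ℚ-nonNeg (16 * B))}} (regular-total v) ⟩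
          ℕ→ℚ (16 * B) ℚ.* (ℕ→ℚ R ℚ.* c)        ≡⟨ trans (sym (ℚ.*-assoc (ℕ→ℚ (16 * B)) (ℕ→ℚ R) c)) (cong (ℚ._* c) (sym (ℕ→ℚ-* (16 * B) R))) ⟩
          ℕ→ℚ (16 * B * R) ℚ.* c                ≤⟨ scale≤1 {16 * B * R} {suc (16 * B * R)} (s≤s z≤n) (ℕ.n≤1+n _) (ℚ.≤-reflexive (inverse-* (16 * B * R))) ⟩
          1ℚ                                    ∎
          where open ℚ.≤-Reasoning

        extensions≤ : ∀ A v → length A + size q r ≤ horizon M T → ℕ→ℚ 8 ℚ.* (total (extensions n A v) ℚ.* b) ℚ.≤ 1ℚ
        extensions≤ A v le = cancel-ℕ {2} (s≤s z≤n) (begin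
          ℕ→ℚ 2 ℚ.* (ℕ→ℚ 8 ℚ.* (total (extensions n A v) ℚ.* b))
            ≡⟨ cong (λ k → ℕ→ℚ 2 ℚ.* (ℕ→ℚ 8 ℚ.* (k ℚ.* b))) (total-++ (family n (depth q) A lightShapes) (family n (depth q) [ v ] regularShapes)) ⟩
          ℕ→ℚ 2 ℚ.* (ℕ→ℚ 8 ℚ.* ((x ℚ.+ y) ℚ.* b))
            ≡⟨ solve 3 (λ x y b → con (ℕ→ℚ 2) :* (con (ℕ→ℚ 8) :* ((x :+ y) :* b)) := con (ℕ→ℚ 16) :* (x :* b) :+ con (ℕ→ℚ 16) :* (y :* b)) refl x y b ⟩
          ℕ→ℚ 16 ℚ.* (x ℚ.* b) ℚ.+ ℕ→ℚ 16 ℚ.* (y ℚ.* b)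
            ≤⟨ ℚ.+-mono-≤ (subst (ℚ._≤ 1ℚ) (sixteenth x) (light≤ A le)) (subst (ℚ._≤ 1ℚ) (sixteenth y) (regular≤ v)) ⟩
          1ℚ ℚ.+ 1ℚ
            ≡⟨ refl ⟩
          ℕ→ℚ 2 ℚ.* 1ℚ ∎)
          where
          open ℚ.≤-Reasoning
          open +-*-Solver using (solve; _:+_; _:*_; _:=_; con)
          x = total (family n (depth q) A lightShapes)
          y = total (family n (depth q) [ v ] regularShapes)

      total≤ε : total (witnesses n T) ℚ.≤ ε
      total≤ε = cancel-ℕ {M} (s≤s z≤n) (begin
        ℕ→ℚ M ℚ.* total (witnesses n T)    ≤⟨ witnesses-total M T dense expo extensions≤ ⟩
        ℕ→ℚ K                              ≤⟨ ℕ→ℚ-mono (ℕ.n≤1+n K) ⟩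
        ℕ→ℚ (suc K)                        ≡⟨ sym (ℚ.*-identityʳ (ℕ→ℚ (suc K))) ⟩
        ℕ→ℚ (suc K) ℚ.* 1ℚ                 ≤⟨ ℚ.*-monoˡ-≤-nonNeg (ℕ→ℚ (suc K)) {{ℚ.nonNegative (ℕ→ℚ-nonNeg (suc K))}} 1≤Dε ⟩
        ℕ→ℚ (suc K) ℚ.* (ℕ→ℚ D ℚ.* ε)      ≡⟨ trans (sym (ℚ.*-assoc (ℕ→ℚ (suc K)) (ℕ→ℚ D) ε)) (cong (ℚ._* ε) (sym (ℕ→ℚ-* (suc K) D))) ⟩
        ℕ→ℚ (suc K * D) ℚ.* ε              ≤⟨ ℚ.*-monoʳ-≤-nonNeg ε {{ℚ.nonNegative 0≤ε}} (ℕ→ℚ-mono (ℕ.m≤n⇒m≤1+n (ℕ.m≤n+m (suc K * D) (16 * B * L₁)))) ⟩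
        ℕ→ℚ M ℚ.* ε                        ∎)
        where
        open ℚ.≤-Reasoning
        0≤ε : 0ℚ ℚ.≤ ε
        0≤ε with ℚ.≤-total 0ℚ ε
        ... | inj₁ h = h
        ... | inj₂ ε≤0 = ⊥-elim (1≰0 (ℚ.≤-trans 1≤Dε (subst (ℕ→ℚ D ℚ.* ε ℚ.≤_) (ℚ.*-zeroʳ (ℕ→ℚ D))
                (ℚ.*-monoˡ-≤-nonNeg (ℕ→ℚ D) {{ℚ.nonNegative (ℕ→ℚ-nonNeg D)}} ε≤0))))

      good-weight : 1ℚ ℚ.- ε ℚ.≤ sumℚ (map (weight (p n)) (goodSubsets n (witnesses n T)))
      good-weight = begin
        1ℚ ℚ.- ε                ≤⟨ ℚ.+-monoˡ-≤ (ℚ.- ε) (ℚ.≤-trans (goodSubsets-weight n (witnesses n T)) (ℚ.+-monoʳ-≤ W total≤ε)) ⟩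
        W ℚ.+ ε ℚ.- ε           ≡⟨ trans (ℚ.+-assoc W ε (ℚ.- ε)) (trans (cong (λ k → W ℚ.+ k) (ℚ.+-inverseʳ ε)) (ℚ.+-identityʳ W)) ⟩
        W                       ∎
        where
        open ℚ.≤-Reasoning
        W = sumℚ (map (weight (p n)) (goodSubsets n (witnesses n T)))

      good-unique : Unique (goodSubsets n (witnesses n T))
      good-unique = Unique.filter⁺ (λ S → T? (avoids (filter proper? (witnesses n T)) S)) (subsets-unique n)

      good-colourable : All (AsymColourable q r) (goodSubsets n (witnesses n T))
      good-colourable = All.map (λ {S} t → FromSubset.good⇒colourable 3≤r r<q S T (Equivalence.to Bool.T-≡ t))
        (All.all-filter (λ S → T? (avoids (filter proper? (witnesses n T)) S)) (subsets n))

theorem6p3 : (q₁ q₂ : ℕ) → 3 ≤ q₂ → q₂ < q₁ →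
    Σ ℚ λ c → 0ℚ ℚ.< c ×
    ((p : ℕ → ℚ) → (∀ n → 0ℚ ℚ.≤ p n) → (∀ n → p n ℚ.≤ 1ℚ) →
    (∀ n → 1 ≤ n → (p n ^ℚ (q₁ ℕ.* (q₂ ∸ 1))) ℚ.* (ℕ→ℚ n ^ℚ q₂) ℚ.≤ c ^ℚ (q₁ ℕ.* (q₂ ∸ 1))) →
    (ε : ℚ) → 0ℚ ℚ.< ε →
    ∃ λ N → ∀ n → n ≥ N →
    Σ (List (Vec Bool n)) λ L →
    Unique L × All (AsymColourable q₁ q₂) L ×
    (1ℚ ℚ.- ε) ℚ.≤ sumℚ (map (weight (p n)) L))
theorem6p3 q r 3≤r r<q = c , inverse-positive (16 * B * R) , λ p 0≤p p≤1 threshold ε 0<ε →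
  let D , 1≤Dε = archimedean ε 0<ε
      open At p 0≤p p≤1 threshold ε D 1≤Dε
      N , choose = cutoff rate-poly
  in N , λ n n≥N → let 1≤n , T , dense , n³≤ = choose n n≥N in
    Measure.goodSubsets (p n) (0≤p n) (p≤1 n) n (Shapes.witnesses q r n T) ,
    good-unique n 1≤n T dense n³≤ , good-colourable n 1≤n T dense n³≤ , good-weight n 1≤n T dense n³≤
  where open Constants q r 3≤r r<q
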